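{- Let $\lambda\vdash n$, let $S^\lambda$ be the Specht module with basis $\mathcal{B}=\{e_T: T\in\mathrm{SYT}(\lambda)\}$, totally ordered by $e_S\vartriangleleft e_T$ iff $S\vartriangleleft T$. Then $(S^\lambda,\mathcal{B},\vartriangleleft)$ is strongly quasisymmetric characteristic compatible.
   Context: Tableaux in French notation (bottom row longest; north/south = higher/lower row, west/east = left/right). $\mathrm{SYT}(\lambda)$: standard Young tableaux (entries $1,\dots,n$ increasing along rows and up columns). $e_T=\sum_\sigma\mathrm{sgn}(\sigma)\{\sigma T\}$ over column-preserving permutations, $\{\cdot\}$ being tabloids; $\mathfrak{S}_n$ acts on $S^\lambda$ by permuting letters. For standard $S,T$ of the same shape, $S\vartriangleleft T$ means the smallest letter occupying different positions in $S$ and $T$ lies further to the (weakly) northwest in $T$ than in $S$; this is a total order on $\mathrm{SYT}(\lambda)$. SQCC: let $M$ be a finite-dimensional $\mathfrak{S}_n$-module with basis $\mathcal{B}=\{v_1,\dots,v_k\}$ totally ordered $v_1\le\cdots\le v_k$; for $w=\sum c_jv_j\neq0$, $\mathrm{tt}(w)=c_jv_j$ for the $\le$-smallest $v_j$ with $c_j\ne0$. Define $\overline{\pi}_i$ on $\mathcal{B}$ (extended linearly): $\overline{\pi}_i(v_t)=0$ if $\mathrm{tt}(s_iv_t)=v_t$; $-v_t$ if $s_iv_t=v_j>v_t$ for some basis $v_j$ or $s_iv_t=-v_t$; $s_iv_t$ if $s_iv_t=v_j<v_t$ for some basis $v_j$ — assuming every basis element falls in one of these cases. If these satisfy the 0-Hecke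 relations $\overline{\pi}_i^2=-\overline{\pi}_i$, $\overline{\pi}_i\overline{\pi}_j=\overline{\pi}_j\overline{\pi}_i$ ($|i-j|\ge2$), $\overline{\pi}_i\overline{\pi}_{i+1}\overline{\pi}_i=\overline{\pi}_{i+1}\overline{\pi}_i\overline{\pi}_{i+1}$, call the resulting $\mathcal{H}_n(0)$-module $\widehat M$; $(M,\mathcal{B},\le)$ is SQCC if this holds and $F^Q_{char}(\widehat M)=F_{char}(M)$. Here $C_I$ ($I\subseteq[n-1]$) is the one-dimensional $\mathcal{H}_n(0)$-module with $\overline{\pi}_i$ acting by $-1$ for $i\in I$ and $0$ otherwise; $F^Q_{char}(N)=\sum_jF_{I_j}$ for composition factors $C_{I_1},\dots,C_{I_m}$ of $N$, with $F_I=\sum x_{i_1}\cdots x_{i_n}$ over $1\le i_1\le\cdots\le i_n$, $i_j<i_{j+1}$ for $j\in I$; $F_{char}$ sends Specht modules $S^\mu$ to Schur functions $s_\mu$. -}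

module Defs where

-- Conventions:
--  * A shape is a list of row lengths sh = (λ₁, λ₂, …), row 0 = bottom row (French).
--  * Cells are pairs (row , column), both 0-based; row r+1 lies north of row r.
--  * A filling of shape sh is a word w : List ℕ aligned with the list 'cells sh'
--    (row-major order, bottom row first): the k-th entry of w sits in the k-th cell.
--  * Letters are 1 … n.  Tabloids are encoded by the list of rows of the letters 1 … n.
--  * Ground field: ℚ.

open import Data.Nat as ℕ using (ℕ; zero; suc; _<_; _≤_; _∸_; _≡ᵇ_; _<ᵇ_; _≤ᵇ_; _⊔_)
open import Data.Nat.ListAction using (sum)
open import Data.Bool using (Bool; true; false; _∧_; _∨_; not; if_then_else_)
open import Data.List using (List; []; _∷_; length; map; foldr; concatMap; upTo; zip; _++_)
open import Data.List.Relation.Unary.All using (All)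
open import Data.List.Relation.Unary.Linked using (Linked)
open import Data.List.Membership.Propositional using (_∈_)
open import Data.Product using (Σ; _×_; _,_; proj₁; proj₂)
open import Data.Sum using (_⊎_)
open import Data.Rational as Q using (ℚ; 0ℚ; 1ℚ)
open import Relation.Binary.PropositionalEquality using (_≡_; _≢_)

filterᵇ : {A : Set} → (A → Bool) → List A → List A
filterᵇ p [] = []
filterᵇ p (x ∷ xs) = if p x then x ∷ filterᵇ p xs else filterᵇ p xs

allᵇ : {A : Set} → (A → Bool) → List A → Bool
allᵇ p [] = true
allᵇ p (x ∷ xs) = p x ∧ allᵇ p xs

countᵇ : {A : Set} → (A → Bool) → List A → ℕ
countᵇ p xs = length (filterᵇ p xs)

eqListᵇ : List ℕ → List ℕ → Bool
eqListᵇ [] [] = true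
eqListᵇ (x ∷ xs) (y ∷ ys) = (x ≡ᵇ y) ∧ eqListᵇ xs ys
eqListᵇ _ _ = false

at : List ℕ → ℕ → ℕ
at [] k = 0
at (x ∷ xs) zero = x
at (x ∷ xs) (suc k) = at xs k

sumℚ : List ℚ → ℚ
sumℚ = foldr Q._+_ 0ℚ

letters : ℕ → List ℕ
letters n = map suc (upTo n)

insertAll : ℕ → List ℕ → List (List ℕ)
insertAll x [] = (x ∷ []) ∷ []
insertAll x (y ∷ ys) = (x ∷ y ∷ ys) ∷ map (y ∷_) (insertAll x ys)

perms : List ℕ → List (List ℕ)
perms [] = [] ∷ []
perms (x ∷ xs) = concatMap (insertAll x) (perms xs)

words : ℕ → ℕ → List (List ℕ)
words zero m = [] ∷ []
words (suc n) m = concatMap (λ w → map (_∷ w) (letters m)) (words n m)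

IsPartition : List ℕ → ℕ → Set
IsPartition sh n = All (λ k → 0 < k) sh × Linked (λ a b → b ≤ a) sh × sum sh ≡ n

Cell : Set
Cell = ℕ × ℕ

cellsFrom : ℕ → List ℕ → List Cell
cellsFrom r [] = []
cellsFrom r (l ∷ ls) = map (r ,_) (upTo l) ++ cellsFrom (suc r) ls

cells : List ℕ → List Cell
cells = cellsFrom 0

cellAtL : List Cell → ℕ → Cell
cellAtL [] k = (0 , 0)
cellAtL (c ∷ cs) zero = c
cellAtL (c ∷ cs) (suc k) = cellAtL cs k

cellAt : List ℕ → ℕ → Cell
cellAt sh k = cellAtL (cells sh) k

filled : List ℕ → List ℕ → List (Cell × ℕ)
filled sh w = zip (cells sh) w

cellOfL : List (Cell × ℕ) → ℕ → Cell
cellOfL [] a = (0 , 0)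
cellOfL ((x , b) ∷ rest) a = if b ≡ᵇ a then x else cellOfL rest a

cellOf : List ℕ → List ℕ → ℕ → Cell
cellOf sh w a = cellOfL (filled sh w) a

allPairsᵇ : {A : Set} → (A → A → Bool) → List A → Bool
allPairsᵇ p xs = allᵇ (λ x → allᵇ (λ y → p x y) xs) xs

standardShapeᵇ : List ℕ → List ℕ → Bool
standardShapeᵇ sh w = allPairsᵇ ok (filled sh w)
  where
  ok : Cell × ℕ → Cell × ℕ → Bool
  ok ((r , c) , a) ((r' , c') , b) =
    (not ((r ≡ᵇ r') ∧ (c <ᵇ c')) ∨ (a <ᵇ b)) ∧ (not ((c ≡ᵇ c') ∧ (r <ᵇ r')) ∨ (a <ᵇ b))

semistandardShapeᵇ : List ℕ → List ℕ → Bool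
semistandardShapeᵇ sh w = allPairsᵇ ok (filled sh w)
  where
  ok : Cell × ℕ → Cell × ℕ → Bool
  ok ((r , c) , a) ((r' , c') , b) =
    (not ((r ≡ᵇ r') ∧ (c <ᵇ c')) ∨ (a ≤ᵇ b)) ∧ (not ((c ≡ᵇ c') ∧ (r <ᵇ r')) ∨ (a <ᵇ b))

syt : List ℕ → ℕ → List (List ℕ)
syt sh n = filterᵇ (standardShapeᵇ sh) (perms (letters n))

colPerms : List ℕ → ℕ → List (List ℕ)
colPerms sh n = filterᵇ colOK (perms (upTo n))
  where
  colOK : List ℕ → Bool
  colOK p = allᵇ (λ ck → proj₂ (cellAt sh (proj₂ ck)) ≡ᵇ proj₂ (proj₁ ck)) (zip (cells sh) p)

inversions : List ℕ → ℕ
inversions [] = 0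
inversions (x ∷ xs) = countᵇ (λ y → y <ᵇ x) xs ℕ.+ inversions xs

evenᵇ : ℕ → Bool
evenᵇ zero = true
evenᵇ (suc k) = not (evenᵇ k)

sgn : List ℕ → ℚ
sgn p = if evenᵇ (inversions p) then 1ℚ else Q.- 1ℚ

-- the filling σT: the entry of T in position (p k) is moved to position k
permute : List ℕ → List ℕ → List ℕ
permute w p = map (at w) p

-- tabloid {w}, encoded as the list (row of letter 1, …, row of letter n)
Tabloid : Set
Tabloid = List ℕ

tabloid : List ℕ → ℕ → List ℕ → Tabloid
tabloid sh n w = map (λ a → proj₁ (cellOf sh w a)) (letters n)

-- the tabloid module M^sh over ℚ: finitely supported functions on tabloids
TVec : Set
TVec = Tabloid → ℚ

_≈ᵥ_ : TVec → TVec → Set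
v ≈ᵥ v' = ∀ τ → v τ ≡ v' τ

negᵥ : TVec → TVec
negᵥ v τ = Q.- (v τ)

poly : List ℕ → ℕ → List ℕ → TVec
poly sh n T τ =
  sumℚ (map (λ p → if eqListᵇ (tabloid sh n (permute T p)) τ then sgn p else 0ℚ) (colPerms sh n))

-- transposition s_i (letters i, i+1) acting on position indices 0 … n-1 of a tabloid code
swapIdx : ℕ → ℕ → ℕ
swapIdx i k = if k ≡ᵇ (i ∸ 1) then i else (if k ≡ᵇ i then i ∸ 1 else k)

swapCode : ℕ → Tabloid → Tabloid
swapCode i τ = map (λ k → at τ (swapIdx i k)) (upTo (length τ))

actS : ℕ → TVec → TVec
actS i v τ = v (swapCode i τ)

_◁[_]_ : List ℕ → List ℕ → List ℕ → Set
S ◁[ sh ] T = Σ ℕ λ a →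
  (1 ≤ a) ×
  (∀ b → 1 ≤ b → b < a → cellOf sh S b ≡ cellOf sh T b) ×
  (cellOf sh S a ≢ cellOf sh T a) ×
  (proj₁ (cellOf sh S a) ≤ proj₁ (cellOf sh T a)) ×
  (proj₂ (cellOf sh T a) ≤ proj₂ (cellOf sh S a))

-- coordinate vectors w.r.t. B (only the values on SYT(sh) matter)
Coord : Set
Coord = List ℕ → ℚ

_≈[_,_]_ : Coord → List ℕ → ℕ → Coord → Set
c ≈[ sh , n ] d = All (λ S → c S ≡ d S) (syt sh n)

zeroC : Coord
zeroC S = 0ℚ

negC : Coord → Coord
negC c S = Q.- (c S)

addC : Coord → Coord → Coord
addC c d S = c S Q.+ d S

δ : List ℕ → Coord
δ T S = if eqListᵇ S T then 1ℚ else 0ℚ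

comb : List ℕ → ℕ → Coord → TVec
comb sh n c τ = sumℚ (map (λ S → c S Q.* poly sh n S τ) (syt sh n))

-- the defining case analysis of π̄_i(e_T) = q (in coordinates)
PiSpec : List ℕ → ℕ → ℕ → List ℕ → Coord → Set
PiSpec sh n i T q =
  -- case 1: tt(s_i e_T) = e_T, and π̄_i e_T = 0
  ((Σ Coord λ c → (actS i (poly sh n T) ≈ᵥ comb sh n c) × (c T ≡ 1ℚ) ×
       (∀ S → S ∈ syt sh n → S ◁[ sh ] T → c S ≡ 0ℚ))
     × (q ≈[ sh , n ] zeroC))
  ⊎
  (((Σ (List ℕ) λ S → S ∈ syt sh n × T ◁[ sh ] S × (actS i (poly sh n T) ≈ᵥ poly sh n S))
     ⊎ (actS i (poly sh n T) ≈ᵥ negᵥ (poly sh n T)))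
     × (q ≈[ sh , n ] negC (δ T)))
  ⊎
  (Σ (List ℕ) λ S → S ∈ syt sh n × S ◁[ sh ] T × (actS i (poly sh n T) ≈ᵥ poly sh n S)
     × (q ≈[ sh , n ] δ S))

πbar : List ℕ → ℕ → (List ℕ → Coord) → Coord → Coord
πbar sh n p c S = sumℚ (map (λ T → c T Q.* p T S) (syt sh n))

HeckeRelations : List ℕ → ℕ → (ℕ → List ℕ → Coord) → Set
HeckeRelations sh n p =
  (∀ i → 1 ≤ i → i < n → ∀ c →
     πbar sh n (p i) (πbar sh n (p i) c) ≈[ sh , n ] negC (πbar sh n (p i) c)) ×
  (∀ i j → 1 ≤ i → i < n → 1 ≤ j → j < n → 2 ℕ.+ i ≤ j → ∀ c →
     πbar sh n (p i) (πbar sh n (p j) c) ≈[ sh , n ] πbar sh n (p j) (πbar sh n (p i) c)) ×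
  (∀ i → 1 ≤ i → suc i < n → ∀ c →
     πbar sh n (p i) (πbar sh n (p (suc i)) (πbar sh n (p i) c))
       ≈[ sh , n ] πbar sh n (p (suc i)) (πbar sh n (p i) (πbar sh n (p (suc i)) c)))

spanC : ℕ → (ℕ → ℚ) → (ℕ → Coord) → Coord
spanC k a u S = sumℚ (map (λ j → a j Q.* u j S) (upTo k))

-- 0 = M_0 ⊂ M_1 ⊂ … ⊂ M_N = Ŝ, M_k = span(u_0,…,u_{k-1}), N = |SYT(sh)|,
-- with M_{k+1}/M_k ≅ C_{I k}  (π̄_i u_k ≡ -[i ∈ I k] u_k  mod M_k)
IsCompositionSeries : List ℕ → ℕ → (ℕ → List ℕ → Coord) → (ℕ → Coord) → (ℕ → ℕ → Bool) → Set
IsCompositionSeries sh n p u I =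
  (∀ (a : ℕ → ℚ) → spanC (length (syt sh n)) a u ≈[ sh , n ] zeroC →
     ∀ k → k < length (syt sh n) → a k ≡ 0ℚ) ×
  (∀ k → k < length (syt sh n) → ∀ i → 1 ≤ i → i < n →
     Σ (ℕ → ℚ) λ b →
       addC (πbar sh n (p i) (u k)) (if I k i then u k else zeroC) ≈[ sh , n ] spanC k b u)

-- Quasisymmetric and Schur functions, via their coefficients.
-- A degree-n monomial x_{i_1}⋯x_{i_n} is encoded by the weakly increasing list (i_1,…,i_n).

IsMonomial : ℕ → List ℕ → Set
IsMonomial n ms = (length ms ≡ n) × All (λ k → 1 ≤ k) ms × Linked _≤_ ms

-- coefficient of the monomial ms in F_I   (I ⊆ [n-1] given as a Bool predicate)
coeffF : ℕ → (ℕ → Bool) → List ℕ → ℕ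
coeffF n I ms =
  if allᵇ (λ j → not (I j) ∨ (at ms (j ∸ 1) <ᵇ at ms j)) (filterᵇ (λ j → j <ᵇ n) (letters n))
  then 1 else 0

maxL : List ℕ → ℕ
maxL = foldr _⊔_ 0

sameContentᵇ : ℕ → List ℕ → List ℕ → Bool
sameContentᵇ m w ms = allᵇ (λ v → countᵇ (_≡ᵇ v) w ≡ᵇ countᵇ (_≡ᵇ v) ms) (letters m)

coeffSchur : List ℕ → ℕ → List ℕ → ℕ
coeffSchur sh n ms =
  countᵇ (λ w → semistandardShapeᵇ sh w ∧ sameContentᵇ (maxL ms) w ms) (words n (maxL ms))

SQCC-Specht : List ℕ → ℕ → Set
SQCC-Specht sh n =
  Σ (ℕ → List ℕ → Coord) λ p →
    -- every basis element falls in one of the cases, p i T = π̄_i(e_T)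
    (∀ i → 1 ≤ i → i < n → ∀ T → T ∈ syt sh n → PiSpec sh n i T (p i T)) ×
    HeckeRelations sh n p ×
    -- F^Q_char(Ŝ) = F_char(S^sh) = s_sh
    (Σ (ℕ → Coord) λ u → Σ (ℕ → ℕ → Bool) λ I →
       IsCompositionSeries sh n p u I ×
       (∀ ms → IsMonomial n ms →
          sum (map (λ k → coeffF n (I k) ms) (upTo (length (syt sh n)))) ≡ coeffSchur sh n ms))

-- Put π̄ᵢ e_T = -e_T, 0 or e_{sᵢT} according as the row of i + 1 in T is above, equal to or below that of i.
-- The 0-Hecke relations then only involve the rows of the letters moved, and the T sorted by ◁ give a
-- composition series with factors C_{Des(T)}; standardization of semistandard tableaux turns Σ_T F_{Des(T)}
-- into s_λ.
--
-- The remaining point is the case of i and i + 1 in one row, where sᵢ e_T must be e_T plus later basis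
-- vectors. View tabloids as words in the rows, i.e. as a weight space of a tensor power of the vector
-- representation of gl. Polytabloids are highest weight vectors, and by sl₂-theory a highest weight vector
-- vanishing at all Yamanouchi words (the tabloids of standard tableaux) is zero. As e_S({T}) is
-- unitriangular in standard S, T, eliminating along ◁ expands sᵢ e_T = e_{sᵢT}; the leading term is e_T since
-- {sᵢT} = {T}.

module Submission where

-- In the induction behind the vanishing statement, deleting the first letter of a word weakens the
-- hypothesis: if `E v = 0` and `v₀` is the part of `v` with first letter `r`, only `E² v₀ = 0`
-- survives. So `raise-injective` has to treat all powers of `E` at once, although it is finally
-- applied with the first power. Divided powers satisfy a recursion on words whose coefficients are
-- all 1, and the induction divides by an integer in one place only, `raise-head-zero`.
--
-- Elimination along ◁ matches a polytabloid with its candidate expansion at the tabloids of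
-- standard tableaux only. That the difference is a highest weight vector makes this enough, and
-- replaces the usual Garnir relations.
--
-- When `i` and `i + 1` share a row, `sᵢT` does not increase along rows. Leading terms are therefore
-- studied for all column-increasing fillings, and ◁ is traded for a number `rank` that depends on
-- the tabloid alone and so makes sense for `sᵢT` as well.

open import Defs
open import Data.Nat as ℕ using (ℕ; zero; suc; _<_; _≤_; _∸_; _≡ᵇ_; _<ᵇ_; _≤ᵇ_; z≤n; s≤s)
open import Data.Nat.Properties as ℕₚ using
  (<⇒≤; <-irrefl; ≤-trans; ≤-reflexive; suc-injective; <-cmp; ≤-refl; <⇒≢; n<1+n; m≤n⇒m<n∨m≡n; 1+n≢n; <-trans; m<n⇒m<1+n; <-≤-trans;
   ≤-pred; <-asym; ≮⇒≥; m≤n⇒m≤1+n; ≰⇒>; <⇒≱; ≤-antisym; n≤1+n; ≤∧≢⇒<; ≤-<-trans)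
open import Data.Nat.ListAction using (sum)
open import Data.Nat.ListAction.Properties using (sum-↭)
open import Data.Bool using (Bool; true; false; _∧_; _∨_; not; if_then_else_; T)
open import Data.List using (List; []; _∷_; length; map; concatMap; upTo; downFrom; applyUpTo; zip; _++_; reverse)
open import Data.List.Properties as Listₚ using (map-∘; map-cong; length-map; length-upTo; map-upTo; reverse-involutive; ∷-injectiveˡ; ∷-injectiveʳ)
open import Data.List.Relation.Unary.All as All using (All; []; _∷_)
open import Data.List.Relation.Unary.Any as Any using (Any; here; there)
import Data.List.Relation.Unary.Any.Properties as Anyₚ
open import Data.List.Relation.Unary.AllPairs using (AllPairs; []; _∷_)
import Data.List.Relation.Unary.AllPairs.Properties as AllPairsₚ
open import Data.List.Relation.Unary.Linked using (Linked; []; _∷_)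
import Data.List.Relation.Unary.Linked.Properties as Linkedₚ
open import Data.List.Relation.Unary.Unique.Propositional using (Unique)
import Data.List.Relation.Unary.Unique.Propositional.Properties as Uniqueₚ
open import Data.List.Membership.Propositional using (_∈_; _∉_; find; lose)
open import Data.List.Membership.Propositional.Properties using (∈-map⁺; ∈-map⁻; ∈-++⁺ˡ; ∈-++⁺ʳ; ∈-++⁻; ∈-∃++; ∈-concatMap⁺; ∈-concatMap⁻; ∈-upTo⁺; ∈-upTo⁻)
open import Data.List.Membership.Propositional.Properties.WithK using (unique∧set⇒bag)
open import Data.List.Relation.Binary.BagAndSetEquality using (∼bag⇒↭)
open import Data.List.Relation.Binary.Permutation.Propositional using (_↭_; ↭-sym; prep; swap; refl) renaming (trans to trans↭)
open import Data.List.Relation.Binary.Permutation.Propositional.Properties as ↭ₚ using (∈-resp-↭; ↭-length; shift)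
import Data.List.Sort
open import Data.Product using (Σ; _×_; _,_; proj₁; proj₂)
import Data.Product.Properties as Productₚ
open import Data.Sum using (_⊎_; inj₁; inj₂)
open import Data.Empty using (⊥-elim)
open import Data.Unit using (⊤; tt)
open import Data.Rational as Q using (ℚ; 0ℚ; 1ℚ; _+_; _*_; -_)
open import Data.Rational.Properties as Qₚ using
  (+-identityˡ; +-identityʳ; *-identityˡ; *-identityʳ; *-zeroˡ; *-zeroʳ; neg-distribˡ-*; neg-distribʳ-*; +-inverseˡ; +-inverseʳ)
open import Algebra.Properties.Group Qₚ.+-0-group using (⁻¹-involutive)
open import Function using (_∘_; id; mk⇔)
open import Relation.Binary.Definitions using (tri<; tri≈; tri>)
import Relation.Binary.Construct.On as On
open import Relation.Nullary using (¬_; Dec; yes; no)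
open import Relation.Binary.PropositionalEquality using (_≡_; _≢_; refl; sym; trans; cong; cong₂; subst; subst₂; module ≡-Reasoning; ≢-sym)

-- Filters, counts and duplicate-free lists.

module _ {A : Set} (p : A → Bool) where

  ∈-filterᵇ⁺ : ∀ {x xs} → x ∈ xs → p x ≡ true → x ∈ filterᵇ p xs
  ∈-filterᵇ⁺ {xs = y ∷ xs} (here refl) px rewrite px = here refl
  ∈-filterᵇ⁺ {xs = y ∷ xs} (there x∈) px with p y
  ... | true = there (∈-filterᵇ⁺ x∈ px)
  ... | false = ∈-filterᵇ⁺ x∈ px

  ∈-filterᵇ⁻ : ∀ {x} xs → x ∈ filterᵇ p xs → x ∈ xs × p x ≡ true
  ∈-filterᵇ⁻ (y ∷ xs) x∈ with p y in eq
  ∈-filterᵇ⁻ (y ∷ xs) (here refl) | true = here refl , eq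
  ∈-filterᵇ⁻ (y ∷ xs) (there x∈)  | true =
    let x∈xs , px = ∈-filterᵇ⁻ xs x∈ in there x∈xs , px
  ∈-filterᵇ⁻ (y ∷ xs) x∈ | false =
    let x∈xs , px = ∈-filterᵇ⁻ xs x∈ in there x∈xs , px

  filterᵇ-unique : ∀ {xs} → Unique xs → Unique (filterᵇ p xs)
  filterᵇ-unique [] = []
  filterᵇ-unique {x ∷ xs} (x∉ ∷ u) with p x
  ... | true = All.tabulate (λ y∈ → All.lookup x∉ (proj₁ (∈-filterᵇ⁻ xs y∈))) ∷ filterᵇ-unique u
  ... | false = filterᵇ-unique u

  countᵇ-≤ : ∀ xs → countᵇ p xs ≤ length xs
  countᵇ-≤ [] = z≤n
  countᵇ-≤ (x ∷ xs) with p x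
  ... | true = s≤s (countᵇ-≤ xs)
  ... | false = m≤n⇒m≤1+n (countᵇ-≤ xs)

  countᵇ-↭ : ∀ {xs ys} → xs ↭ ys → countᵇ p xs ≡ countᵇ p ys
  countᵇ-↭ refl = refl
  countᵇ-↭ (prep x r) with p x
  ... | true = cong suc (countᵇ-↭ r)
  ... | false = countᵇ-↭ r
  countᵇ-↭ (swap x y r) with p x | p y
  ... | true  | true = cong (suc ∘ suc) (countᵇ-↭ r)
  ... | true  | false = cong suc (countᵇ-↭ r)
  ... | false | true = cong suc (countᵇ-↭ r)
  ... | false | false = countᵇ-↭ r
  countᵇ-↭ (trans↭ r s) = trans (countᵇ-↭ r) (countᵇ-↭ s)

countᵇ-cong : ∀ {A : Set} {p q : A → Bool} xs → (∀ {x} → x ∈ xs → p x ≡ q x) → countᵇ p xs ≡ countᵇ q xs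
countᵇ-cong [] h = refl
countᵇ-cong {p = p} {q} (x ∷ xs) h with p x | q x | h (here refl)
... | true  | .true  | refl = cong suc (countᵇ-cong xs (h ∘ there))
... | false | .false | refl = countᵇ-cong xs (h ∘ there)

countᵇ-map : ∀ {A B : Set} (p : B → Bool) (f : A → B) xs → countᵇ p (map f xs) ≡ countᵇ (p ∘ f) xs
countᵇ-map p f [] = refl
countᵇ-map p f (x ∷ xs) with p (f x)
... | true = cong suc (countᵇ-map p f xs)
... | false = countᵇ-map p f xs

countᵇ-mono : ∀ {A : Set} {p q : A → Bool} xs → (∀ {x} → x ∈ xs → p x ≡ true → q x ≡ true) →
              countᵇ p xs ≤ countᵇ q xs
countᵇ-mono [] h = z≤n
countᵇ-mono {p = p} {q} (x ∷ xs) h with p x | q x | h (here refl)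
... | true  | true  | _ = s≤s (countᵇ-mono xs (h ∘ there))
... | true  | false | e with e refl
... | ()
countᵇ-mono (x ∷ xs) h | false | true  | _ = m≤n⇒m≤1+n (countᵇ-mono xs (h ∘ there))
countᵇ-mono (x ∷ xs) h | false | false | _ = countᵇ-mono xs (h ∘ there)

countᵇ-mono-< : ∀ {A : Set} {p q : A → Bool} {y} xs → (∀ {x} → x ∈ xs → p x ≡ true → q x ≡ true) →
                y ∈ xs → p y ≡ false → q y ≡ true → countᵇ p xs < countᵇ q xs
countᵇ-mono-< {p = p} {q} (x ∷ xs) h (here refl) py qy rewrite py | qy = s≤s (countᵇ-mono xs (h ∘ there))
countᵇ-mono-< {p = p} {q} (x ∷ xs) h (there y∈) py qy with p x | q x | h (here refl)
... | true  | true  | _ = s≤s (countᵇ-mono-< xs (h ∘ there) y∈ py qy)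
... | true  | false | e with e refl
... | ()
countᵇ-mono-< (x ∷ xs) h (there y∈) py qy | false | true  | _ = m≤n⇒m≤1+n (countᵇ-mono-< xs (h ∘ there) y∈ py qy)
countᵇ-mono-< (x ∷ xs) h (there y∈) py qy | false | false | _ = countᵇ-mono-< xs (h ∘ there) y∈ py qy

map-cong-∈ : ∀ {A B : Set} {f g : A → B} xs → (∀ {x} → x ∈ xs → f x ≡ g x) → map f xs ≡ map g xs
map-cong-∈ [] h = refl
map-cong-∈ (x ∷ xs) h = cong₂ _∷_ (h (here refl)) (map-cong-∈ xs (h ∘ there))

map-injective-∈ : ∀ {A B : Set} {f g : A → B} xs → map f xs ≡ map g xs → ∀ {x} → x ∈ xs → f x ≡ g x
map-injective-∈ (x ∷ xs) e (here refl) = ∷-injectiveˡ e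
map-injective-∈ (x ∷ xs) e (there x∈) = map-injective-∈ xs (∷-injectiveʳ e) x∈

map-unique : ∀ {A B : Set} (f : A → B) {xs} → (∀ {x y} → x ∈ xs → y ∈ xs → f x ≡ f y → x ≡ y) →
             Unique xs → Unique (map f xs)
map-unique f inj [] = []
map-unique f {x ∷ xs} inj (x∉ ∷ u) =
  All.tabulate fresh ∷ map-unique f (λ a b → inj (there a) (there b)) u
  where
  fresh : ∀ {z} → z ∈ map f xs → f x ≢ z
  fresh z∈ e with ∈-map⁻ f z∈
  ... | y , y∈ , refl = All.lookup x∉ y∈ (inj (here refl) (there y∈) e)

-- The map `r` recovers from an element of a block `f x` the `x` that it came from, so different
-- blocks are disjoint.
concatMap-unique : ∀ {A B : Set} (f : A → List B) (r : B → A) {xs} → Unique xs →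
                   (∀ {x} → x ∈ xs → Unique (f x)) → (∀ {x y} → x ∈ xs → y ∈ f x → r y ≡ x) →
                   Unique (concatMap f xs)
concatMap-unique f r [] uf rf = []
concatMap-unique f r {x ∷ xs} (x∉ ∷ u) uf rf =
  Uniqueₚ.++⁺ (uf (here refl)) (concatMap-unique f r u (uf ∘ there) (rf ∘ there)) disj
  where
  disj : ∀ {z} → ¬ (z ∈ f x × z ∈ concatMap f xs)
  disj (z∈ , z∈') with find (∈-concatMap⁻ f z∈')
  ... | y , y∈ , z∈fy = All.lookup x∉ y∈ (trans (sym (rf (here refl) z∈)) (rf (there y∈) z∈fy))

unique-∉ : ∀ {A : Set} {x : A} {xs} → Unique (x ∷ xs) → x ∉ xs
unique-∉ (x∉ ∷ _) x∈ = All.lookup x∉ x∈ refl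

unique-resp-↭ : ∀ {A : Set} {xs ys : List A} → xs ↭ ys → Unique xs → Unique ys
unique-resp-↭ refl u = u
unique-resp-↭ (prep x r) (x∉ ∷ u) = ↭ₚ.All-resp-↭ r x∉ ∷ unique-resp-↭ r u
unique-resp-↭ (swap x y r) ((x≢y ∷ x∉) ∷ (y∉ ∷ u)) =
  (≢-sym x≢y ∷ ↭ₚ.All-resp-↭ r y∉) ∷ (↭ₚ.All-resp-↭ r x∉ ∷ unique-resp-↭ r u)
unique-resp-↭ (trans↭ r s) u = unique-resp-↭ s (unique-resp-↭ r u)

unique-set-↭ : ∀ {A : Set} {xs ys : List A} → Unique xs → Unique ys →
               (∀ {x} → x ∈ xs → x ∈ ys) → (∀ {x} → x ∈ ys → x ∈ xs) → xs ↭ ys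
unique-set-↭ u v f g = ∼bag⇒↭ (unique∧set⇒bag u v (mk⇔ f g))

∈-remove : ∀ {A : Set} {x y : A} as {bs} → y ∈ as ++ x ∷ bs → x ≢ y → y ∈ as ++ bs
∈-remove as y∈ x≢y with ∈-++⁻ as y∈
... | inj₁ y∈as = ∈-++⁺ˡ y∈as
... | inj₂ (here refl) = ⊥-elim (x≢y refl)
... | inj₂ (there y∈bs) = ∈-++⁺ʳ as y∈bs

unique-⊆-length : ∀ {A : Set} {xs ys : List A} → Unique xs → (∀ {x} → x ∈ xs → x ∈ ys) → length xs ≤ length ys
unique-⊆-length [] h = z≤n
unique-⊆-length {xs = x ∷ xs} (x∉ ∷ u) h with ∈-∃++ (h (here refl))
... | as , bs , refl = subst (suc (length xs) ≤_) (sym (↭-length (shift x as bs)))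
      (s≤s (unique-⊆-length u (λ y∈ → ∈-remove as (h (there y∈)) (All.lookup x∉ y∈))))

-- Pigeonhole: once each element of `xs` has been struck out of `ys`, the bound on the lengths
-- leaves nothing over. It turns injections into bijections without an explicit inverse.
unique-⊆-↭ : ∀ {A : Set} {xs ys : List A} → Unique xs → (∀ {x} → x ∈ xs → x ∈ ys) →
             length ys ≤ length xs → xs ↭ ys
unique-⊆-↭ {ys = []} [] h le = refl
unique-⊆-↭ {xs = x ∷ xs} (x∉ ∷ u) h le with ∈-∃++ (h (here refl))
... | as , bs , refl = trans↭
      (prep x (unique-⊆-↭ u (λ y∈ → ∈-remove as (h (there y∈)) (All.lookup x∉ y∈))
        (≤-pred (subst (_≤ suc (length xs)) (↭-length (shift x as bs)) le))))
      (↭-sym (shift x as bs))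

bijection-length : ∀ {A B : Set} {xs : List A} {ys : List B} (f : A → B) (g : B → A) → Unique xs → Unique ys →
  (∀ {x} → x ∈ xs → f x ∈ ys × g (f x) ≡ x) → (∀ {y} → y ∈ ys → g y ∈ xs × f (g y) ≡ y) →
  length xs ≡ length ys
bijection-length {xs = xs} {ys} f g ux uy hf hg =
  ≤-antisym (embed f g ux hf) (embed g f uy hg)
  where
  embed : ∀ {A B : Set} {xs : List A} {ys : List B} (f : A → B) (g : B → A) → Unique xs →
          (∀ {x} → x ∈ xs → f x ∈ ys × g (f x) ≡ x) → length xs ≤ length ys
  embed {xs = xs} {ys} f g ux hf = subst (_≤ length ys) (length-map f xs)
    (unique-⊆-length
      (map-unique f (λ x∈ y∈ e → trans (sym (proj₂ (hf x∈))) (trans (cong g e) (proj₂ (hf y∈)))) ux) sub)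
    where
    sub : ∀ {z} → z ∈ map f xs → z ∈ ys
    sub z∈ with ∈-map⁻ f z∈
    ... | x , x∈ , refl = proj₁ (hf x∈)

-- Boolean tests and the propositions that they decide.

T⇒≡ : ∀ {b} → T b → b ≡ true
T⇒≡ {true} _ = refl

≡⇒T : ∀ {b} → b ≡ true → T b
≡⇒T refl = tt

∧-true⁻ : ∀ {a b} → a ∧ b ≡ true → a ≡ true × b ≡ true
∧-true⁻ {true} {true} refl = refl , refl

allᵇ⁻ : ∀ {A : Set} {p : A → Bool} {xs} → allᵇ p xs ≡ true → ∀ {x} → x ∈ xs → p x ≡ true
allᵇ⁻ {xs = x ∷ xs} e (here refl) = proj₁ (∧-true⁻ e)
allᵇ⁻ {p = p} {xs = x ∷ xs} e (there x∈) = allᵇ⁻ {p = p} (proj₂ (∧-true⁻ {p x} e)) x∈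

allᵇ⁺ : ∀ {A : Set} {p : A → Bool} xs → (∀ {x} → x ∈ xs → p x ≡ true) → allᵇ p xs ≡ true
allᵇ⁺ [] h = refl
allᵇ⁺ (x ∷ xs) h rewrite h (here refl) = allᵇ⁺ xs (h ∘ there)

≡ᵇ-true : ∀ {m n} → (m ≡ᵇ n) ≡ true → m ≡ n
≡ᵇ-true {m} {n} e = ℕₚ.≡ᵇ⇒≡ m n (≡⇒T e)

≡ᵇ-refl : ∀ m → (m ≡ᵇ m) ≡ true
≡ᵇ-refl zero = refl
≡ᵇ-refl (suc m) = ≡ᵇ-refl m

≡ᵇ-false : ∀ {m n} → m ≢ n → (m ≡ᵇ n) ≡ false
≡ᵇ-false {m} {n} ne with m ≡ᵇ n in e
... | true = ⊥-elim (ne (≡ᵇ-true e))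
... | false = refl

<ᵇ-true : ∀ {m n} → (m <ᵇ n) ≡ true → m < n
<ᵇ-true {m} {n} e = ℕₚ.<ᵇ⇒< m n (≡⇒T e)

<⇒<ᵇ-true : ∀ {m n} → m < n → (m <ᵇ n) ≡ true
<⇒<ᵇ-true lt = T⇒≡ (ℕₚ.<⇒<ᵇ lt)

≮⇒<ᵇ-false : ∀ {m n} → n ≤ m → (m <ᵇ n) ≡ false
≮⇒<ᵇ-false {m} {n} le with m <ᵇ n in e
... | true = ⊥-elim (<⇒≱ (<ᵇ-true e) le)
... | false = refl

≤ᵇ-true : ∀ {m n} → (m ≤ᵇ n) ≡ true → m ≤ n
≤ᵇ-true {m} {n} e = ℕₚ.≤ᵇ⇒≤ m n (≡⇒T e)

≤⇒≤ᵇ-true : ∀ {m n} → m ≤ n → (m ≤ᵇ n) ≡ true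
≤⇒≤ᵇ-true le = T⇒≡ (ℕₚ.≤⇒≤ᵇ le)

eqListᵇ-refl : ∀ w → eqListᵇ w w ≡ true
eqListᵇ-refl [] = refl
eqListᵇ-refl (x ∷ w) rewrite ≡ᵇ-refl x = eqListᵇ-refl w

eqListᵇ-true : ∀ v w → eqListᵇ v w ≡ true → v ≡ w
eqListᵇ-true [] [] e = refl
eqListᵇ-true (x ∷ v) (y ∷ w) e =
  let ex , ew = ∧-true⁻ {x ≡ᵇ y} e in cong₂ _∷_ (≡ᵇ-true ex) (eqListᵇ-true v w ew)

eqListᵇ-false : ∀ {v w} → v ≢ w → eqListᵇ v w ≡ false
eqListᵇ-false {v} {w} ne with eqListᵇ v w in e
... | true = ⊥-elim (ne (eqListᵇ-true v w e))
... | false = refl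

bool-ext : ∀ {a b} → (a ≡ true → b ≡ true) → (b ≡ true → a ≡ true) → a ≡ b
bool-ext {true}  {b} f g = sym (f refl)
bool-ext {false} {true} f g = g refl
bool-ext {false} {false} f g = refl

_≟ʷ_ : (v w : List ℕ) → Dec (v ≡ w)
v ≟ʷ w = Listₚ.≡-dec ℕ._≟_ v w

-- Finite sums over ℚ

∑ : ∀ {A : Set} → List A → (A → ℚ) → ℚ
∑ xs f = sumℚ (map f xs)

∑-cong : ∀ {A : Set} xs {f g : A → ℚ} → (∀ {x} → x ∈ xs → f x ≡ g x) → ∑ xs f ≡ ∑ xs g
∑-cong xs h = cong sumℚ (map-cong-∈ xs h)

∑-zero : ∀ {A : Set} xs {f : A → ℚ} → (∀ {x} → x ∈ xs → f x ≡ 0ℚ) → ∑ xs f ≡ 0ℚ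
∑-zero [] h = refl
∑-zero (x ∷ xs) h = trans (cong₂ _+_ (h (here refl)) (∑-zero xs (h ∘ there))) (+-identityˡ 0ℚ)

interchange : ∀ a b c d → (a + b) + (c + d) ≡ (a + c) + (b + d)
interchange a b c d = begin
  (a + b) + (c + d) ≡⟨ Qₚ.+-assoc a b (c + d) ⟩
  a + (b + (c + d)) ≡⟨ cong (a +_) (Qₚ.+-assoc b c d) ⟨
  a + ((b + c) + d) ≡⟨ cong (λ z → a + (z + d)) (Qₚ.+-comm b c) ⟩
  a + ((c + b) + d) ≡⟨ cong (a +_) (Qₚ.+-assoc c b d) ⟩
  a + (c + (b + d)) ≡⟨ Qₚ.+-assoc a c (b + d) ⟨
  (a + c) + (b + d) ∎
  where open ≡-Reasoning

∑-+ : ∀ {A : Set} xs (f g : A → ℚ) → ∑ xs (λ x → f x + g x) ≡ ∑ xs f + ∑ xs g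
∑-+ [] f g = sym (+-identityˡ 0ℚ)
∑-+ (x ∷ xs) f g = trans (cong (f x + g x +_) (∑-+ xs f g)) (interchange (f x) (g x) (∑ xs f) (∑ xs g))

∑-*ˡ : ∀ {A : Set} xs c (f : A → ℚ) → ∑ xs (λ x → c * f x) ≡ c * ∑ xs f
∑-*ˡ [] c f = sym (*-zeroʳ c)
∑-*ˡ (x ∷ xs) c f = trans (cong (c * f x +_) (∑-*ˡ xs c f)) (sym (Qₚ.*-distribˡ-+ c (f x) (∑ xs f)))

∑-*ʳ : ∀ {A : Set} xs c (f : A → ℚ) → ∑ xs (λ x → f x * c) ≡ ∑ xs f * c
∑-*ʳ [] c f = sym (*-zeroˡ c)
∑-*ʳ (x ∷ xs) c f = trans (cong (f x * c +_) (∑-*ʳ xs c f)) (sym (Qₚ.*-distribʳ-+ c (f x) (∑ xs f)))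

∑-neg : ∀ {A : Set} xs (f : A → ℚ) → ∑ xs (λ x → - f x) ≡ - ∑ xs f
∑-neg [] f = refl
∑-neg (x ∷ xs) f = trans (cong (- f x +_) (∑-neg xs f)) (sym (Qₚ.neg-distrib-+ (f x) (∑ xs f)))

∑-swap : ∀ {A B : Set} xs ys (f : A → B → ℚ) → ∑ xs (λ x → ∑ ys (f x)) ≡ ∑ ys (λ y → ∑ xs (λ x → f x y))
∑-swap [] ys f = sym (∑-zero ys (λ _ → refl))
∑-swap (x ∷ xs) ys f = trans (cong (∑ ys (f x) +_) (∑-swap xs ys f)) (sym (∑-+ ys (f x) (λ y → ∑ xs (λ x → f x y))))

∑-↭ : ∀ {A : Set} {xs ys} (f : A → ℚ) → xs ↭ ys → ∑ xs f ≡ ∑ ys f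
∑-↭ f refl = refl
∑-↭ f (prep x r) = cong (f x +_) (∑-↭ f r)
∑-↭ {xs = _ ∷ _ ∷ xs} {ys = _ ∷ _ ∷ ys} f (swap x y r) = begin
  f x + (f y + ∑ xs f) ≡⟨ Qₚ.+-assoc (f x) (f y) (∑ xs f) ⟨
  f x + f y + ∑ xs f ≡⟨ cong₂ _+_ (Qₚ.+-comm (f x) (f y)) (∑-↭ f r) ⟩
  f y + f x + ∑ ys f ≡⟨ Qₚ.+-assoc (f y) (f x) (∑ ys f) ⟩
  f y + (f x + ∑ ys f) ∎
  where open ≡-Reasoning
∑-↭ f (trans↭ r s) = trans (∑-↭ f r) (∑-↭ f s)

∑-map : ∀ {A B : Set} (g : A → B) xs (f : B → ℚ) → ∑ (map g xs) f ≡ ∑ xs (f ∘ g)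
∑-map g xs f = cong sumℚ (sym (map-∘ xs))

∑-single : ∀ {A : Set} {xs} (f : A → ℚ) {x} → Unique xs → x ∈ xs →
           (∀ {y} → y ∈ xs → y ≢ x → f y ≡ 0ℚ) → ∑ xs f ≡ f x
∑-single {xs = x ∷ xs} f (x∉ ∷ u) (here refl) h =
  trans (cong (f x +_) (∑-zero xs (λ y∈ → h (there y∈) (≢-sym (All.lookup x∉ y∈))))) (+-identityʳ (f x))
∑-single {xs = z ∷ xs} f (z∉ ∷ u) (there x∈) h =
  trans (cong₂ _+_ (h (here refl) (All.lookup z∉ x∈)) (∑-single f u x∈ (h ∘ there))) (+-identityˡ _)

∑-reindex : ∀ {A : Set} {xs} (φ : A → A) (f : A → ℚ) → Unique xs → (∀ {x} → x ∈ xs → φ x ∈ xs) →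
            (∀ {x} → x ∈ xs → φ (φ x) ≡ x) → ∑ xs (f ∘ φ) ≡ ∑ xs f
∑-reindex {xs = xs} φ f u cl inv = trans (sym (∑-map φ xs f)) (∑-↭ f r)
  where
  sub : ∀ {z} → z ∈ map φ xs → z ∈ xs
  sub z∈ with ∈-map⁻ φ z∈
  ... | x , x∈ , refl = cl x∈
  sup : ∀ {z} → z ∈ xs → z ∈ map φ xs
  sup z∈ = subst (_∈ map φ xs) (inv z∈) (∈-map⁺ φ (cl z∈))
  r : map φ xs ↭ xs
  r = unique-set-↭ (map-unique φ (λ x∈ y∈ e → trans (sym (inv x∈)) (trans (cong φ e) (inv y∈))) u) u sub sup

x+x≡0⇒x≡0 : ∀ x → x + x ≡ 0ℚ → x ≡ 0ℚ
x+x≡0⇒x≡0 x e = begin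
  x ≡⟨ *-identityˡ x ⟨
  (Q.½ * (1ℚ + 1ℚ)) * x ≡⟨ Qₚ.*-assoc Q.½ (1ℚ + 1ℚ) x ⟩
  Q.½ * ((1ℚ + 1ℚ) * x) ≡⟨ cong (Q.½ *_) (Qₚ.*-distribʳ-+ x 1ℚ 1ℚ) ⟩
  Q.½ * (1ℚ * x + 1ℚ * x) ≡⟨ cong (Q.½ *_) (cong₂ _+_ (*-identityˡ x) (*-identityˡ x)) ⟩
  Q.½ * (x + x) ≡⟨ cong (Q.½ *_) e ⟩
  Q.½ * 0ℚ ≡⟨ *-zeroʳ Q.½ ⟩
  0ℚ ∎
  where open ≡-Reasoning

-- Reindexing by `φ` shows that the sum is its own negative. This treats fixed points of `φ` and
-- two-element orbits alike.
∑-antisymmetric : ∀ {A : Set} {xs} (φ : A → A) (f : A → ℚ) → Unique xs → (∀ {x} → x ∈ xs → φ x ∈ xs) →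
                  (∀ {x} → x ∈ xs → φ (φ x) ≡ x) → (∀ {x} → x ∈ xs → f (φ x) ≡ - f x) → ∑ xs f ≡ 0ℚ
∑-antisymmetric {xs = xs} φ f u cl inv anti = x+x≡0⇒x≡0 _ (begin
  ∑ xs f + ∑ xs f ≡⟨ cong (_+ ∑ xs f) (sym (∑-reindex φ f u cl inv)) ⟩
  ∑ xs (f ∘ φ) + ∑ xs f ≡⟨ cong (_+ ∑ xs f) (trans (∑-cong xs anti) (∑-neg xs f)) ⟩
  - ∑ xs f + ∑ xs f ≡⟨ +-inverseˡ (∑ xs f) ⟩
  0ℚ ∎)
  where open ≡-Reasoning

-- Raising operators on functions of words

occ : ℕ → List ℕ → ℕ
occ x = countᵇ (_≡ᵇ x)

occ-≡ : ∀ x w → occ x (x ∷ w) ≡ suc (occ x w)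
occ-≡ x w rewrite ≡ᵇ-refl x = refl

occ-≢ : ∀ {x y} w → y ≢ x → occ x (y ∷ w) ≡ occ x w
occ-≢ w ne rewrite ≡ᵇ-false ne = refl

multiple : ℕ → ℚ → ℚ
multiple zero    x = 0ℚ
multiple (suc k) x = x + multiple k x

multiple-zero : ∀ k → multiple k 0ℚ ≡ 0ℚ
multiple-zero zero = refl
multiple-zero (suc k) = trans (+-identityˡ _) (multiple-zero k)

multiple-+ : ∀ k x y → multiple k (x + y) ≡ multiple k x + multiple k y
multiple-+ zero x y = refl
multiple-+ (suc k) x y = trans (cong (x + y +_) (multiple-+ k x y)) (interchange x y (multiple k x) (multiple k y))

multiple-pos : ∀ k {x} → 0ℚ Q.< x → 0ℚ Q.≤ multiple k x
multiple-pos zero lt = Qₚ.≤-refl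
multiple-pos (suc k) lt = Qₚ.+-mono-≤ (Qₚ.<⇒≤ lt) (multiple-pos k lt)

multiple-neg : ∀ k {x} → x Q.< 0ℚ → multiple k x Q.≤ 0ℚ
multiple-neg zero lt = Qₚ.≤-refl
multiple-neg (suc k) lt = Qₚ.+-mono-≤ (Qₚ.<⇒≤ lt) (multiple-neg k lt)

-- The order of ℚ excludes torsion: adding copies of a positive number stays positive, and likewise
-- for a negative one.
multiple-cancel : ∀ k {x} → multiple (suc k) x ≡ 0ℚ → x ≡ 0ℚ
multiple-cancel k {x} e with Qₚ.<-cmp x 0ℚ
... | tri< lt _ _ = ⊥-elim (Qₚ.<-irrefl e (Qₚ.+-mono-<-≤ lt (multiple-neg k lt)))

... | tri≈ _ x≡0 _ = x≡0
... | tri> _ _ gt = ⊥-elim (Qₚ.<-irrefl (sym e) (Qₚ.+-mono-<-≤ gt (multiple-pos k gt)))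

-- The coefficients of (E^j / j!) v, where E = Σ (change one letter r + 1 to r).
raise : ℕ → ℕ → (List ℕ → ℚ) → List ℕ → ℚ
raise r zero    v w = v w
raise r (suc j) v [] = 0ℚ
raise r (suc j) v (x ∷ w) =
  raise r (suc j) (v ∘ (x ∷_)) w + (if x ≡ᵇ r then raise r j (v ∘ (suc r ∷_)) w else 0ℚ)

raise-∷-≡ : ∀ r j v w → raise r (suc j) v (r ∷ w) ≡ raise r (suc j) (v ∘ (r ∷_)) w + raise r j (v ∘ (suc r ∷_)) w
raise-∷-≡ r j v w rewrite ≡ᵇ-refl r = refl

raise-∷-≢ : ∀ {r x} j v w → x ≢ r → raise r j v (x ∷ w) ≡ raise r j (v ∘ (x ∷_)) w
raise-∷-≢ zero v w ne = refl
raise-∷-≢ (suc j) v w ne rewrite ≡ᵇ-false ne = +-identityʳ _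

-- The operator is homogeneous: its coefficient at `u` sees only words in which `j` letters `r` of
-- `u` have become `r + 1`. The conditions handed to `h` are what later allows a function to be
-- replaced by its restriction to one weight.
raise-local : ∀ r j {v v'} u →
  (∀ w → length w ≡ length u → occ r w ℕ.+ j ≡ occ r u → occ (suc r) w ≡ occ (suc r) u ℕ.+ j → v w ≡ v' w) →
  raise r j v u ≡ raise r j v' u
raise-local r zero u h = h u refl (ℕₚ.+-identityʳ _) (sym (ℕₚ.+-identityʳ _))
raise-local r (suc j) [] h = refl
raise-local r (suc j) {v} {v'} (x ∷ u) h with x ℕ.≟ r
... | yes refl = begin
  raise r (suc j) v (r ∷ u) ≡⟨ raise-∷-≡ r j v u ⟩
  raise r (suc j) (v ∘ (r ∷_)) u + raise r j (v ∘ (suc r ∷_)) u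
    ≡⟨ cong₂ _+_ (raise-local r (suc j) u same) (raise-local r j u changed) ⟩
  raise r (suc j) (v' ∘ (r ∷_)) u + raise r j (v' ∘ (suc r ∷_)) u ≡⟨ raise-∷-≡ r j v' u ⟨
  raise r (suc j) v' (r ∷ u) ∎
  where
  open ≡-Reasoning
  same : ∀ w → length w ≡ length u → occ r w ℕ.+ suc j ≡ occ r u → occ (suc r) w ≡ occ (suc r) u ℕ.+ suc j →
         v (r ∷ w) ≡ v' (r ∷ w)
  same w l e e' = h (r ∷ w) (cong suc l)
    (trans (cong (ℕ._+ suc j) (occ-≡ r w)) (trans (cong suc e) (sym (occ-≡ r u))))
    (trans (occ-≢ w (≢-sym 1+n≢n)) (trans e' (cong (ℕ._+ suc j) (sym (occ-≢ u (≢-sym 1+n≢n))))))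
  changed : ∀ w → length w ≡ length u → occ r w ℕ.+ j ≡ occ r u → occ (suc r) w ≡ occ (suc r) u ℕ.+ j →
         v (suc r ∷ w) ≡ v' (suc r ∷ w)
  changed w l e e' = h (suc r ∷ w) (cong suc l)
    (trans (cong (ℕ._+ suc j) (occ-≢ w 1+n≢n))
      (trans (ℕₚ.+-suc _ j) (trans (cong suc e) (sym (occ-≡ r u)))))
    (trans (occ-≡ (suc r) w) (trans (cong suc e')
      (trans (sym (ℕₚ.+-suc _ j)) (cong (ℕ._+ suc j) (sym (occ-≢ u (≢-sym 1+n≢n)))))))
... | no x≢r = begin
  raise r (suc j) v (x ∷ u) ≡⟨ raise-∷-≢ (suc j) v u x≢r ⟩
  raise r (suc j) (v ∘ (x ∷_)) u ≡⟨ raise-local r (suc j) u same ⟩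
  raise r (suc j) (v' ∘ (x ∷_)) u ≡⟨ raise-∷-≢ (suc j) v' u x≢r ⟨
  raise r (suc j) v' (x ∷ u) ∎
  where
  open ≡-Reasoning
  same : ∀ w → length w ≡ length u → occ r w ℕ.+ suc j ≡ occ r u → occ (suc r) w ≡ occ (suc r) u ℕ.+ suc j →
         v (x ∷ w) ≡ v' (x ∷ w)
  same w l e e' with x ℕ.≟ suc r
  ... | yes refl = h (x ∷ w) (cong suc l)
        (trans (cong (ℕ._+ suc j) (occ-≢ w x≢r)) (trans e (sym (occ-≢ u x≢r))))
        (trans (occ-≡ x w) (trans (cong suc e') (cong (ℕ._+ suc j) (sym (occ-≡ x u)))))
  ... | no x≢sr = h (x ∷ w) (cong suc l)
        (trans (cong (ℕ._+ suc j) (occ-≢ w x≢r)) (trans e (sym (occ-≢ u x≢r))))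
        (trans (occ-≢ w x≢sr) (trans e' (cong (ℕ._+ suc j) (sym (occ-≢ u x≢sr)))))

raise-cong : ∀ r j {v v'} u → (∀ w → length w ≡ length u → v w ≡ v' w) → raise r j v u ≡ raise r j v' u
raise-cong r j u h = raise-local r j u (λ w l _ _ → h w l)

raise-zero : ∀ r j u → raise r j (λ _ → 0ℚ) u ≡ 0ℚ
raise-zero r zero u = refl
raise-zero r (suc j) [] = refl
raise-zero r (suc j) (x ∷ u) with x ≡ᵇ r
... | true = trans (cong₂ _+_ (raise-zero r (suc j) u) (raise-zero r j u)) (+-identityˡ 0ℚ)
... | false = trans (cong (_+ 0ℚ) (raise-zero r (suc j) u)) (+-identityˡ 0ℚ)

raise-+ : ∀ r j v v' u → raise r j (λ w → v w + v' w) u ≡ raise r j v u + raise r j v' u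
raise-+ r zero v v' u = refl
raise-+ r (suc j) v v' [] = refl
raise-+ r (suc j) v v' (x ∷ u) with x ≡ᵇ r
... | true = trans (cong₂ _+_ (raise-+ r (suc j) (v ∘ (x ∷_)) (v' ∘ (x ∷_)) u) (raise-+ r j (v ∘ (suc r ∷_)) (v' ∘ (suc r ∷_)) u)) (interchange (raise r (suc j) (v ∘ (x ∷_)) u) _ _ _)
... | false = trans (cong (_+ 0ℚ) (raise-+ r (suc j) (v ∘ (x ∷_)) (v' ∘ (x ∷_)) u)) (interchange (raise r (suc j) (v ∘ (x ∷_)) u) _ 0ℚ 0ℚ)

raise-* : ∀ r j c v u → raise r j (λ w → c * v w) u ≡ c * raise r j v u
raise-* r zero c v u = refl
raise-* r (suc j) c v [] = sym (*-zeroʳ c)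
raise-* r (suc j) c v (x ∷ u) with x ≡ᵇ r
... | true = trans (cong₂ _+_ (raise-* r (suc j) c (v ∘ (x ∷_)) u) (raise-* r j c (v ∘ (suc r ∷_)) u)) (sym (Qₚ.*-distribˡ-+ c _ _))
... | false = trans (cong₂ _+_ (raise-* r (suc j) c (v ∘ (x ∷_)) u) (sym (*-zeroʳ c))) (sym (Qₚ.*-distribˡ-+ c _ _))

raise-∑ : ∀ {A : Set} r j xs (f : A → List ℕ → ℚ) u → raise r j (λ w → ∑ xs (λ x → f x w)) u ≡ ∑ xs (λ x → raise r j (f x) u)
raise-∑ r j [] f u = raise-zero r j u
raise-∑ r j (x ∷ xs) f u = trans (raise-+ r j (f x) (λ w → ∑ xs (λ x → f x w)) u) (cong (raise r j (f x) u +_) (raise-∑ r j xs f u))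

-- Every choice of `j + 1` positions arises `j + 1` times, according to which of them is changed by
-- the outer operator.
raise-∘ : ∀ r j v w → raise r 1 (raise r j v) w ≡ multiple (suc j) (raise r (suc j) v w)
raise-∘ r zero v w = sym (+-identityʳ _)
raise-∘ r (suc j) v [] = sym (multiple-zero (suc (suc j)))
raise-∘ r (suc j) v (x ∷ w) with x ℕ.≟ r
... | no x≢r = begin
  raise r 1 (raise r (suc j) v) (x ∷ w) ≡⟨ raise-∷-≢ 1 (raise r (suc j) v) w x≢r ⟩
  raise r 1 (raise r (suc j) v ∘ (x ∷_)) w ≡⟨ raise-cong r 1 w (λ u _ → raise-∷-≢ (suc j) v u x≢r) ⟩
  raise r 1 (raise r (suc j) (v ∘ (x ∷_))) w ≡⟨ raise-∘ r (suc j) (v ∘ (x ∷_)) w ⟩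
  multiple (suc (suc j)) (raise r (suc (suc j)) (v ∘ (x ∷_)) w) ≡⟨ cong (multiple (suc (suc j))) (sym (raise-∷-≢ (suc (suc j)) v w x≢r)) ⟩
  multiple (suc (suc j)) (raise r (suc (suc j)) v (x ∷ w)) ∎
  where open ≡-Reasoning
... | yes refl = begin
  raise r 1 (raise r (suc j) v) (r ∷ w)
    ≡⟨ raise-∷-≡ r 0 (raise r (suc j) v) w ⟩
  raise r 1 (raise r (suc j) v ∘ (r ∷_)) w + raise r (suc j) v (suc r ∷ w)
    ≡⟨ cong₂ _+_ (raise-cong r 1 w (λ u _ → raise-∷-≡ r j v u)) (raise-∷-≢ (suc j) v w 1+n≢n) ⟩
  raise r 1 (λ u → raise r (suc j) v₀ u + raise r j v₁ u) w + raise r (suc j) v₁ w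
    ≡⟨ cong (_+ raise r (suc j) v₁ w) (raise-+ r 1 (raise r (suc j) v₀) (raise r j v₁) w) ⟩
  raise r 1 (raise r (suc j) v₀) w + raise r 1 (raise r j v₁) w + raise r (suc j) v₁ w
    ≡⟨ cong (_+ raise r (suc j) v₁ w) (cong₂ _+_ (raise-∘ r (suc j) v₀ w) (raise-∘ r j v₁ w)) ⟩
  multiple (suc (suc j)) (raise r (suc (suc j)) v₀ w) + multiple (suc j) b + b
    ≡⟨ Qₚ.+-assoc (multiple (suc (suc j)) (raise r (suc (suc j)) v₀ w)) (multiple (suc j) b) b ⟩
  multiple (suc (suc j)) (raise r (suc (suc j)) v₀ w) + (multiple (suc j) b + b)
    ≡⟨ cong (multiple (suc (suc j)) (raise r (suc (suc j)) v₀ w) +_) (Qₚ.+-comm (multiple (suc j) b) b) ⟩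
  multiple (suc (suc j)) (raise r (suc (suc j)) v₀ w) + multiple (suc (suc j)) b
    ≡⟨ multiple-+ (suc (suc j)) (raise r (suc (suc j)) v₀ w) b ⟨
  multiple (suc (suc j)) (raise r (suc (suc j)) v₀ w + b)
    ≡⟨ cong (multiple (suc (suc j))) (sym (raise-∷-≡ r (suc j) v w)) ⟩
  multiple (suc (suc j)) (raise r (suc (suc j)) v (r ∷ w)) ∎
  where
  open ≡-Reasoning
  v₀ = v ∘ (r ∷_)
  v₁ = v ∘ (suc r ∷_)
  b = raise r (suc j) v₁ w

a+0≡0 : ∀ {a b} → a + b ≡ 0ℚ → a ≡ 0ℚ → b ≡ 0ℚ
a+0≡0 {b = b} e refl = trans (sym (+-identityˡ b)) e

-- Let `v₀` and `v₁` be the parts of `v` with first letter `r` and `r + 1`, and write E^(k) for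
-- divided powers. At these two heads the hypothesis reads E^(j+1) v₀ + E^(j) v₁ = 0 and E^(j+1) v₁
-- = 0. Applying E to the first equation removes its second term by the second equation, and a
-- positive multiple of E^(j+2) v₀ remains.
raise-head-zero : ∀ n r j v → (∀ u → length u ≡ suc n → raise r (suc j) v u ≡ 0ℚ) →
                  ∀ u → length u ≡ n → raise r (suc (suc j)) (v ∘ (r ∷_)) u ≡ 0ℚ
raise-head-zero n r j v h u lu = multiple-cancel (suc j) (begin
  multiple (suc (suc j)) (raise r (suc (suc j)) v₀ u) ≡⟨ raise-∘ r (suc j) v₀ u ⟨
  raise r 1 (raise r (suc j) v₀) u ≡⟨ +-identityʳ _ ⟨
  raise r 1 (raise r (suc j) v₀) u + 0ℚ ≡⟨ cong (raise r 1 (raise r (suc j) v₀) u +_) v₁-zero ⟨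
  raise r 1 (raise r (suc j) v₀) u + raise r 1 (raise r j v₁) u ≡⟨ raise-+ r 1 (raise r (suc j) v₀) (raise r j v₁) u ⟨
  raise r 1 (λ z → raise r (suc j) v₀ z + raise r j v₁ z) u
    ≡⟨ raise-cong r 1 u (λ z lz → trans (sym (raise-∷-≡ r j v z)) (h (r ∷ z) (cong suc (trans lz lu)))) ⟩
  raise r 1 (λ _ → 0ℚ) u ≡⟨ raise-zero r 1 u ⟩
  0ℚ ∎)
  where
  open ≡-Reasoning
  v₀ = v ∘ (r ∷_)
  v₁ = v ∘ (suc r ∷_)
  v₁-zero : raise r 1 (raise r j v₁) u ≡ 0ℚ
  v₁-zero = trans (raise-∘ r j v₁ u) (trans (cong (multiple (suc j))
    (trans (sym (raise-∷-≢ (suc j) v u 1+n≢n)) (h (suc r ∷ u) (cong suc lu))))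
    (multiple-zero (suc j)))

-- The sl₂ fact that E^j is injective on weights at most -j.
raise-injective : ∀ n r j v → (∀ u → length u ≡ n → raise r j v u ≡ 0ℚ) →
                  ∀ w → length w ≡ n → occ r w ℕ.+ j ≤ occ (suc r) w → v w ≡ 0ℚ
raise-injective n r zero v h w l le = h w l
raise-injective zero r (suc j) v h [] l ()
raise-injective (suc n) r (suc j) v h (x ∷ w) l le with x ℕ.≟ r | x ℕ.≟ suc r
... | no x≢r | no x≢sr = raise-injective n r (suc j) (v ∘ (x ∷_))
        (λ u lu → trans (sym (raise-∷-≢ (suc j) v u x≢r)) (h (x ∷ u) (cong suc lu)))
        w (suc-injective l)
        (subst₂ _≤_ (cong (ℕ._+ suc j) (occ-≢ w x≢r)) (occ-≢ w x≢sr) le)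
-- Head `r`: the tail has one `r` less, so it meets the weight bound with the exponent raised by
-- one, which is the exponent that `raise-head-zero` provides.
... | yes refl | _ = lower w (suc-injective l)
        (subst₂ _≤_ (trans (cong (ℕ._+ suc j) (occ-≡ r w)) (sym (ℕₚ.+-suc _ (suc j))))
          (occ-≢ w (≢-sym 1+n≢n)) le)
  where
  lower : ∀ u → length u ≡ n → occ r u ℕ.+ suc (suc j) ≤ occ (suc r) u → v (r ∷ u) ≡ 0ℚ
  lower = raise-injective n r (suc (suc j)) (v ∘ (r ∷_)) (raise-head-zero n r j v h)
-- Head `r + 1`: if the tail meets the weight bound by itself, induction with exponent `suc j`
-- applies to `v₁`. Otherwise the tail lies exactly on the boundary `B = A + j`, where only the
-- exponent `j` fits.
... | no x≢r | yes refl = upper (occ r w ℕ.+ suc j ℕ.≤? occ (suc r) w)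
  where
  v₁ = v ∘ (suc r ∷_)
  lw : length w ≡ n
  lw = suc-injective l
  zero₁ : ∀ u → length u ≡ n → raise r (suc j) v₁ u ≡ 0ℚ
  zero₁ u lu = trans (sym (raise-∷-≢ (suc j) v u x≢r)) (h (suc r ∷ u) (cong suc lu))
  lower : ∀ u → length u ≡ n → occ r u ℕ.+ suc (suc j) ≤ occ (suc r) u → v (r ∷ u) ≡ 0ℚ
  lower = raise-injective n r (suc (suc j)) (v ∘ (r ∷_)) (raise-head-zero n r j v h)
  le₁ : occ r w ℕ.+ suc j ≤ suc (occ (suc r) w)
  le₁ = subst₂ _≤_ (cong (ℕ._+ suc j) (occ-≢ w x≢r)) (occ-≡ (suc r) w) le
  upper : Dec (occ r w ℕ.+ suc j ≤ occ (suc r) w) → v₁ w ≡ 0ℚ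
  upper (yes le') = raise-injective n r (suc j) v₁ zero₁ w lw le'
  upper (no nle) = trans (sym restrict-at) (raise-injective n r j v̂ v̂-zero w lw (≤-reflexive (sym balance)))
    where
    A = occ r w
    B = occ (suc r) w
    balance : B ≡ A ℕ.+ j
    balance = ≤-antisym (≤-pred (subst (suc B ≤_) (ℕₚ.+-suc A j) (≰⇒> nle)))
                (≤-pred (subst (_≤ suc B) (ℕₚ.+-suc A j) le₁))
    -- The hypothesis at heads `r` gives E^(j) v₁ = - E^(j+1) v₀ for divided powers, and the right
    -- side vanishes by `lower`, but only at words `u` of the weight reached from `w`. Hence `v₁` is
    -- first cut down to the weight `(A , B)` of `w`; at all other `u` the cut-down function
    -- contributes nothing.
    v̂ : List ℕ → ℚ
    v̂ u = if (occ r u ≡ᵇ A) ∧ (occ (suc r) u ≡ᵇ B) then v₁ u else 0ℚ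
    restrict : ∀ u → occ r u ≡ A → occ (suc r) u ≡ B → v̂ u ≡ v₁ u
    restrict u e e' rewrite e | e' | ≡ᵇ-refl A | ≡ᵇ-refl B = refl
    restrict-at : v̂ w ≡ v₁ w
    restrict-at = restrict w refl refl
    restrict-off : ∀ u → ¬ (occ r u ≡ A × occ (suc r) u ≡ B) → v̂ u ≡ 0ℚ
    restrict-off u ne with (occ r u ≡ᵇ A) ∧ (occ (suc r) u ≡ᵇ B) in eq
    ... | false = refl
    ... | true = let a , b = ∧-true⁻ {occ r u ≡ᵇ A} eq in ⊥-elim (ne (≡ᵇ-true a , ≡ᵇ-true b))
    v̂-zero : ∀ u → length u ≡ n → raise r j v̂ u ≡ 0ℚ
    v̂-zero u lu with occ r u ℕ.≟ A ℕ.+ j | occ (suc r) u ℕ.≟ A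
    ... | yes e | yes e' = begin
        raise r j v̂ u ≡⟨ raise-local r j u (λ z _ p q → restrict z
                               (ℕₚ.+-cancelʳ-≡ j (occ r z) A (trans p e)) (trans q (trans (cong (ℕ._+ j) e') (sym balance)))) ⟩
        raise r j v₁ u ≡⟨ a+0≡0 (trans (sym (raise-∷-≡ r j v u)) (h (r ∷ u) (cong suc lu))) above ⟩
        0ℚ ∎
      where
      open ≡-Reasoning
      above : raise r (suc j) (v ∘ (r ∷_)) u ≡ 0ℚ
      above = trans (raise-local r (suc j) u (λ z lz p q → lower z (trans lz lu) (≤-reflexive (begin
          occ r z ℕ.+ suc (suc j) ≡⟨ ℕₚ.+-suc (occ r z) (suc j) ⟩
          suc (occ r z ℕ.+ suc j) ≡⟨ cong suc (trans p e) ⟩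
          suc (A ℕ.+ j) ≡⟨ ℕₚ.+-suc A j ⟨
          A ℕ.+ suc j ≡⟨ cong (ℕ._+ suc j) e' ⟨
          occ (suc r) u ℕ.+ suc j ≡⟨ q ⟨
          occ (suc r) z ∎)))) (raise-zero r (suc j) u)
    ... | no ne | _ = trans (raise-local r j u (λ z _ p q → restrict-off z (λ (a , b) → ne (trans (sym p) (cong (ℕ._+ j) a))))) (raise-zero r j u)
    ... | yes _ | no ne = trans (raise-local r j u (λ z _ p q → restrict-off z (λ (a , b) →
            ne (ℕₚ.+-cancelʳ-≡ j (occ (suc r) u) A (trans (sym q) (trans b balance)))))) (raise-zero r j u)

-- Words are read from the last letter: the head is the row of the largest entry.
Yamanouchi : List ℕ → Set
Yamanouchi [] = ⊤
Yamanouchi (zero ∷ w) = Yamanouchi w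
Yamanouchi (suc y ∷ w) = Yamanouchi w × occ (suc y) w < occ y w

-- Among the last letters occurring in v, the largest has a coefficient that is again a highest weight
-- vector; so the support of a nonzero v contains a Yamanouchi word.
highest-weight-zero : ∀ n K v → (∀ r u → length u ≡ n → raise r 1 v u ≡ 0ℚ) →
  (∀ w → length w ≡ n → Any (K ≤_) w → v w ≡ 0ℚ) → (∀ w → length w ≡ n → Yamanouchi w → v w ≡ 0ℚ) →
  ∀ w → length w ≡ n → v w ≡ 0ℚ
highest-weight-zero zero K v kill bound yam [] l = yam [] refl tt
highest-weight-zero (suc n) K v kill bound yam (x ∷ w) l =
  descend K x (ℕₚ.m≤n+m K x) w (suc-injective l)
  where
  -- Downward induction on the first letter, with `d` as fuel until `K` is reached. Raising `v` at a
  -- word with head `x` also produces the value at head `x + 1`; that value must already be known to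
  -- vanish before `v ∘ (x ∷_)` is again a highest weight vector.
  descend : ∀ d x → K ≤ x ℕ.+ d → ∀ w → length w ≡ n → v (x ∷ w) ≡ 0ℚ
  descend zero x le w l = bound (x ∷ w) (cong suc l) (here (subst (K ≤_) (ℕₚ.+-identityʳ x) le))
  descend (suc d) x le = highest-weight-zero n K (v ∘ (x ∷_)) kill'
    (λ w l any → bound (x ∷ w) (cong suc l) (there any)) yam'
    where
    kill' : ∀ r u → length u ≡ n → raise r 1 (v ∘ (x ∷_)) u ≡ 0ℚ
    kill' r u lu with x ℕ.≟ r
    ... | no x≢r = trans (sym (raise-∷-≢ 1 v u x≢r)) (kill r (x ∷ u) (cong suc lu))
    ... | yes refl = trans (sym (+-identityʳ _))
          (trans (cong (raise r 1 (v ∘ (r ∷_)) u +_) (sym (descend d (suc r) (subst (K ≤_) (ℕₚ.+-suc r d) le) u lu)))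
          (trans (sym (raise-∷-≡ r 0 v u)) (kill r (r ∷ u) (cong suc lu))))
    yam' : ∀ w → length w ≡ n → Yamanouchi w → v (x ∷ w) ≡ 0ℚ
    yam' w lw y = go x refl
      where
      go : ∀ z → z ≡ x → v (x ∷ w) ≡ 0ℚ
      go zero refl = yam (0 ∷ w) (cong suc lw) y
      go (suc z) refl with occ (suc z) w ℕ.<? occ z w
      ... | yes lt = yam (suc z ∷ w) (cong suc lw) (y , lt)
      -- The head breaks the Yamanouchi condition, so the whole word contains more letters `z + 1`
      -- than `z`. This is the weight bound for exponent 1.
      ... | no nlt = raise-injective (suc n) z 1 v (kill z) (suc z ∷ w) (cong suc lw)
            (≤-trans (≤-reflexive (trans (cong (ℕ._+ 1) (occ-≢ w 1+n≢n)) (ℕₚ.+-comm _ 1)))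
              (≤-trans (s≤s (≮⇒≥ nlt)) (≤-reflexive (sym (occ-≡ (suc z) w)))))

-- Permutations of a list, transpositions and signs

∈-insertAll⁺ : ∀ x as bs → as ++ x ∷ bs ∈ insertAll x (as ++ bs)
∈-insertAll⁺ x [] [] = here refl
∈-insertAll⁺ x [] (b ∷ bs) = here refl
∈-insertAll⁺ x (a ∷ as) bs = there (∈-map⁺ (a ∷_) (∈-insertAll⁺ x as bs))

∈-insertAll⁻ : ∀ x ys {q} → q ∈ insertAll x ys → Σ (List ℕ) λ as → Σ (List ℕ) λ bs → q ≡ as ++ x ∷ bs × ys ≡ as ++ bs
∈-insertAll⁻ x [] (here refl) = [] , [] , refl , refl
∈-insertAll⁻ x (y ∷ ys) (here refl) = [] , y ∷ ys , refl , refl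
∈-insertAll⁻ x (y ∷ ys) (there q∈) with ∈-map⁻ (y ∷_) q∈
... | q' , q'∈ , refl with ∈-insertAll⁻ x ys q'∈
... | as , bs , refl , refl = y ∷ as , bs , refl , refl

∈-perms⁻ : ∀ xs {q} → q ∈ perms xs → q ↭ xs
∈-perms⁻ [] (here refl) = refl
∈-perms⁻ (x ∷ xs) q∈ with find (∈-concatMap⁻ (insertAll x) q∈)
... | ys , ys∈ , q∈' with ∈-insertAll⁻ x ys q∈'
... | as , bs , refl , refl = trans↭ (shift x as bs) (prep x (∈-perms⁻ xs ys∈))

∈-perms⁺ : ∀ xs {q} → q ↭ xs → q ∈ perms xs
∈-perms⁺ [] r rewrite ↭ₚ.↭-empty-inv r = here refl
∈-perms⁺ (x ∷ xs) r with ∈-∃++ (∈-resp-↭ (↭-sym r) (here refl))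
... | as , bs , refl = ∈-concatMap⁺ (insertAll x)
      (lose (∈-perms⁺ xs (↭ₚ.drop-∷ (trans↭ (↭-sym (shift x as bs)) r))) (∈-insertAll⁺ x as bs))

insertAll-unique : ∀ x ys → x ∉ ys → Unique (insertAll x ys)
insertAll-unique x [] x∉ = [] ∷ []
insertAll-unique x (y ∷ ys) x∉ = All.tabulate fresh ∷ Uniqueₚ.map⁺ ∷-injectiveʳ (insertAll-unique x ys (x∉ ∘ there))
  where
  fresh : ∀ {q} → q ∈ map (y ∷_) (insertAll x ys) → x ∷ y ∷ ys ≢ q
  fresh q∈ e with ∈-map⁻ (y ∷_) q∈
  ... | _ , _ , refl = x∉ (here (∷-injectiveˡ e))

delete : ℕ → List ℕ → List ℕ
delete x = filterᵇ (λ y → not (y ≡ᵇ x))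

delete-∉ : ∀ {x} ys → x ∉ ys → delete x ys ≡ ys
delete-∉ [] x∉ = refl
delete-∉ (y ∷ ys) x∉ rewrite ≡ᵇ-false (λ e → x∉ (here (sym e))) = cong (y ∷_) (delete-∉ ys (x∉ ∘ there))

delete-insert : ∀ x as bs → x ∉ as ++ bs → delete x (as ++ x ∷ bs) ≡ as ++ bs
delete-insert x [] bs x∉ rewrite ≡ᵇ-refl x = delete-∉ bs x∉
delete-insert x (a ∷ as) bs x∉ rewrite ≡ᵇ-false (λ e → x∉ (here (sym e))) = cong (a ∷_) (delete-insert x as bs (x∉ ∘ there))

perms-unique : ∀ {xs} → Unique xs → Unique (perms xs)
perms-unique [] = [] ∷ []
perms-unique {x ∷ xs} (x∉ ∷ u) = concatMap-unique (insertAll x) (delete x) (perms-unique u)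
  (λ {ys} ys∈ → insertAll-unique x ys (fresh ys∈)) retract
  where
  fresh : ∀ {ys} → ys ∈ perms xs → x ∉ ys
  fresh ys∈ x∈ = All.lookup x∉ (∈-resp-↭ (∈-perms⁻ xs ys∈) x∈) refl
  retract : ∀ {ys q} → ys ∈ perms xs → q ∈ insertAll x ys → delete x q ≡ ys
  retract {ys} ys∈ q∈ with ∈-insertAll⁻ x ys q∈
  ... | as , bs , refl , refl = delete-insert x as bs (fresh ys∈)

at-map : ∀ (f : ℕ → ℕ) w {k} → k < length w → at (map f w) k ≡ f (at w k)
at-map f (x ∷ w) {zero} lt = refl
at-map f (x ∷ w) {suc k} (s≤s lt) = at-map f w lt

at-∈ : ∀ w {k} → k < length w → at w k ∈ w
at-∈ (x ∷ w) {zero} lt = here refl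
at-∈ (x ∷ w) {suc k} (s≤s lt) = there (at-∈ w lt)

∈-at : ∀ {w a} → a ∈ w → Σ ℕ λ k → k < length w × at w k ≡ a
∈-at (here refl) = 0 , s≤s z≤n , refl
∈-at (there a∈) = let k , lt , e = ∈-at a∈ in suc k , s≤s lt , e

at-injective : ∀ {w j k} → Unique w → j < length w → k < length w → at w j ≡ at w k → j ≡ k
at-injective {x ∷ w} {zero} {zero} u _ _ e = refl
at-injective {x ∷ w} {zero} {suc k} u _ (s≤s lt) e = ⊥-elim (unique-∉ u (subst (_∈ w) (sym e) (at-∈ w lt)))
at-injective {x ∷ w} {suc j} {zero} u (s≤s lt) _ e = ⊥-elim (unique-∉ u (subst (_∈ w) e (at-∈ w lt)))
at-injective {x ∷ w} {suc j} {suc k} (_ ∷ u) (s≤s lt) (s≤s lt') e = cong suc (at-injective u lt lt' e)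

map-at-upTo : ∀ w → map (at w) (upTo (length w)) ≡ w
map-at-upTo w = trans (map-upTo (at w) (length w)) (go w)
  where
  go : ∀ w → applyUpTo (at w) (length w) ≡ w
  go [] = refl
  go (x ∷ w) = cong (x ∷_) (go w)

length-letters : ∀ n → length (letters n) ≡ n
length-letters n = trans (length-map suc (upTo n)) (length-upTo n)

letters-unique : ∀ n → Unique (letters n)
letters-unique n = Uniqueₚ.map⁺ suc-injective (Uniqueₚ.upTo⁺ n)

∈-letters⁺ : ∀ {n a} → 1 ≤ a → a ≤ n → a ∈ letters n
∈-letters⁺ {a = suc a} _ le = ∈-map⁺ suc (∈-upTo⁺ le)

∈-letters⁻ : ∀ {n a} → a ∈ letters n → 1 ≤ a × a ≤ n
∈-letters⁻ a∈ with ∈-map⁻ suc a∈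
... | k , k∈ , refl = s≤s z≤n , ∈-upTo⁻ k∈

at-applyUpTo : ∀ n (f : ℕ → ℕ) {k} → k < n → at (applyUpTo f n) k ≡ f k
at-applyUpTo (suc n) f {zero} lt = refl
at-applyUpTo (suc n) f {suc k} (s≤s lt) = at-applyUpTo n (f ∘ suc) lt

at-letters : ∀ {n k} → k < n → at (letters n) k ≡ suc k
at-letters {n} {k} lt = trans (at-map suc (upTo n) (subst (k <_) (sym (length-upTo n)) lt)) (cong suc (at-applyUpTo n id lt))

tr : ℕ → ℕ → ℕ → ℕ
tr x y z = if z ≡ᵇ x then y else (if z ≡ᵇ y then x else z)

tr-left : ∀ x y → tr x y x ≡ y
tr-left x y rewrite ≡ᵇ-refl x = refl

tr-right : ∀ x y → tr x y y ≡ x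
tr-right x y with y ≡ᵇ x in e
... | true = ≡ᵇ-true e
... | false rewrite ≡ᵇ-refl y = refl

tr-other : ∀ {x y z} → z ≢ x → z ≢ y → tr x y z ≡ z
tr-other z≢x z≢y rewrite ≡ᵇ-false z≢x | ≡ᵇ-false z≢y = refl

data TrView (x y z : ℕ) : Set where
  is-left  : z ≡ x → tr x y z ≡ y → TrView x y z
  is-right : z ≡ y → tr x y z ≡ x → TrView x y z
  is-other : z ≢ x → z ≢ y → tr x y z ≡ z → TrView x y z

tr-view : ∀ x y z → TrView x y z
tr-view x y z with z ℕ.≟ x | z ℕ.≟ y
... | yes refl | _ = is-left refl (tr-left x y)
... | no _ | yes refl = is-right refl (tr-right x y)
... | no a | no b = is-other a b (tr-other a b)

tr-involutive : ∀ x y z → tr x y (tr x y z) ≡ z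
tr-involutive x y z with tr-view x y z
... | is-left refl e = trans (cong (tr x y) e) (tr-right x y)
... | is-right refl e = trans (cong (tr x y) e) (tr-left x y)
... | is-other a b e = trans (cong (tr x y) e) e

tr-comm : ∀ x y z → tr x y z ≡ tr y x z
tr-comm x y z with tr-view x y z
... | is-left refl e = trans e (sym (tr-right y x))
... | is-right refl e = trans e (sym (tr-left y x))
... | is-other a b e = trans e (sym (tr-other b a))

tr-injective : ∀ x y {z z'} → tr x y z ≡ tr x y z' → z ≡ z'
tr-injective x y {z} {z'} e = trans (sym (tr-involutive x y z)) (trans (cong (tr x y) e) (tr-involutive x y z'))

-- Conjugation of a transposition by an injection. With `f` itself a transposition it yields the
-- braid and commutation rules; with `f = suc` it passes between positions and letters.
tr-natural : ∀ (f : ℕ → ℕ) → (∀ {a b} → f a ≡ f b → a ≡ b) → ∀ x y z → f (tr x y z) ≡ tr (f x) (f y) (f z)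
tr-natural f inj x y z with tr-view x y z
... | is-left refl e = trans (cong f e) (sym (tr-left (f x) (f y)))
... | is-right refl e = trans (cong f e) (sym (tr-right (f x) (f y)))
... | is-other a b e = trans (cong f e) (sym (tr-other (a ∘ inj) (b ∘ inj)))

map-tr-involutive : ∀ x y w → map (tr x y) (map (tr x y) w) ≡ w
map-tr-involutive x y w = trans (sym (map-∘ w)) (trans (map-cong (tr-involutive x y) w) (Listₚ.map-id w))

map-tr-∈ : ∀ {x y z w} → x ∈ w → y ∈ w → z ∈ map (tr x y) w → z ∈ w
map-tr-∈ {x} {y} x∈ y∈ z∈ with ∈-map⁻ (tr x y) z∈
... | a , a∈ , refl with tr-view x y a
... | is-left _ e rewrite e = y∈
... | is-right _ e rewrite e = x∈
... | is-other _ _ e rewrite e = a∈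

map-tr-↭ : ∀ {x y w} → Unique w → x ∈ w → y ∈ w → map (tr x y) w ↭ w
map-tr-↭ {x} {y} {w} u x∈ y∈ = unique-⊆-↭ (Uniqueₚ.map⁺ (tr-injective x y) u) (map-tr-∈ x∈ y∈)
  (≤-reflexive (sym (length-map (tr x y) w)))

map-tr-∉ : ∀ {x y} w → x ∉ w → y ∉ w → map (tr x y) w ≡ w
map-tr-∉ {x} {y} w x∉ y∉ = trans (map-cong-∈ w (λ z∈ → tr-other (λ { refl → x∉ z∈ }) (λ { refl → y∉ z∈ }))) (Listₚ.map-id w)

ε : ℕ → ℚ
ε k = if evenᵇ k then 1ℚ else - 1ℚ

ε-suc : ∀ k → ε (suc k) ≡ - ε k
ε-suc k with evenᵇ k
... | true = refl
... | false = refl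

ε-+ : ∀ j k → ε (j ℕ.+ k) ≡ ε j * ε k
ε-+ zero k = sym (*-identityˡ (ε k))
ε-+ (suc j) k = begin
  ε (suc (j ℕ.+ k)) ≡⟨ ε-suc (j ℕ.+ k) ⟩
  - ε (j ℕ.+ k) ≡⟨ cong -_ (ε-+ j k) ⟩
  - (ε j * ε k) ≡⟨ neg-distribˡ-* (ε j) (ε k) ⟩
  (- ε j) * ε k ≡⟨ cong (_* ε k) (ε-suc j) ⟨
  ε (suc j) * ε k ∎
  where open ≡-Reasoning

sgn-∷ : ∀ a w → sgn (a ∷ w) ≡ ε (countᵇ (_<ᵇ a) w) * sgn w
sgn-∷ a w = ε-+ (countᵇ (_<ᵇ a) w) (inversions w)

sgn-∷-neg : ∀ a {w w'} → w ↭ w' → sgn w ≡ - sgn w' → sgn (a ∷ w) ≡ - sgn (a ∷ w')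
sgn-∷-neg a {w} {w'} r e = begin
  sgn (a ∷ w) ≡⟨ sgn-∷ a w ⟩
  ε (countᵇ (_<ᵇ a) w) * sgn w ≡⟨ cong₂ (λ k s → ε k * s) (countᵇ-↭ (_<ᵇ a) r) e ⟩
  ε (countᵇ (_<ᵇ a) w') * (- sgn w') ≡⟨ neg-distribʳ-* (ε (countᵇ (_<ᵇ a) w')) (sgn w') ⟨
  - (ε (countᵇ (_<ᵇ a) w') * sgn w') ≡⟨ cong -_ (sgn-∷ a w') ⟨
  - sgn (a ∷ w') ∎
  where open ≡-Reasoning

sgn-++-neg : ∀ as {w w'} → w ↭ w' → sgn w ≡ - sgn w' → sgn (as ++ w) ≡ - sgn (as ++ w')
sgn-++-neg [] r e = e
sgn-++-neg (a ∷ as) r e = sgn-∷-neg a (↭ₚ.++⁺ˡ as r) (sgn-++-neg as r e)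

inversions-swap : ∀ x y w → y < x → inversions (x ∷ y ∷ w) ≡ suc (inversions (y ∷ x ∷ w))
inversions-swap x y w lt rewrite <⇒<ᵇ-true lt | ≮⇒<ᵇ-false {x} {y} (<⇒≤ lt) =
  cong suc (trans (sym (ℕₚ.+-assoc a b c)) (trans (cong (ℕ._+ c) (ℕₚ.+-comm a b)) (ℕₚ.+-assoc b a c)))
  where
  a = countᵇ (_<ᵇ x) w
  b = countᵇ (_<ᵇ y) w
  c = inversions w

neg-flip : ∀ {a b} → a ≡ - b → b ≡ - a
neg-flip {b = b} e = trans (sym (⁻¹-involutive b)) (cong -_ (sym e))

sgn-swap : ∀ x y w → x ≢ y → sgn (x ∷ y ∷ w) ≡ - sgn (y ∷ x ∷ w)
sgn-swap x y w ne with <-cmp y x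
... | tri< lt _ _ = trans (cong ε (inversions-swap x y w lt)) (ε-suc (inversions (y ∷ x ∷ w)))
... | tri≈ _ e _ = ⊥-elim (ne (sym e))
... | tri> _ _ gt = neg-flip (trans (cong ε (inversions-swap y x w gt)) (ε-suc (inversions (x ∷ y ∷ w))))

sgn-move : ∀ x bs cs → x ∉ bs → sgn (x ∷ bs ++ cs) ≡ ε (length bs) * sgn (bs ++ x ∷ cs)
sgn-move x [] cs x∉ = sym (*-identityˡ _)
sgn-move x (b ∷ bs) cs x∉ = begin
  sgn (x ∷ b ∷ bs ++ cs)
    ≡⟨ sgn-swap x b (bs ++ cs) (x∉ ∘ here) ⟩
  - sgn (b ∷ x ∷ bs ++ cs)
    ≡⟨ cong -_ (sgn-∷ b (x ∷ bs ++ cs)) ⟩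
  - (ε (countᵇ (_<ᵇ b) (x ∷ bs ++ cs)) * sgn (x ∷ bs ++ cs))
    ≡⟨ cong -_ (cong₂ (λ k s → ε k * s) (countᵇ-↭ (_<ᵇ b) (↭-sym (shift x bs cs))) (sgn-move x bs cs (x∉ ∘ there))) ⟩
  - (e₁ * (e₂ * s)) ≡⟨ cong -_ (sym (Qₚ.*-assoc e₁ e₂ s)) ⟩
  - (e₁ * e₂ * s) ≡⟨ cong (λ t → - (t * s)) (Qₚ.*-comm e₁ e₂) ⟩
  - (e₂ * e₁ * s) ≡⟨ cong -_ (Qₚ.*-assoc e₂ e₁ s) ⟩
  - (e₂ * (e₁ * s)) ≡⟨ neg-distribˡ-* e₂ (e₁ * s) ⟩
  (- e₂) * (e₁ * s) ≡⟨ cong₂ _*_ (sym (ε-suc (length bs))) (sym (sgn-∷ b (bs ++ x ∷ cs))) ⟩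
  ε (suc (length bs)) * sgn (b ∷ bs ++ x ∷ cs) ∎
  where
  open ≡-Reasoning
  e₁ = ε (countᵇ (_<ᵇ b) (bs ++ x ∷ cs))
  e₂ = ε (length bs)
  s = sgn (bs ++ x ∷ cs)

exchange-↭ : ∀ (x y : ℕ) bs cs → x ∷ bs ++ y ∷ cs ↭ y ∷ bs ++ x ∷ cs
exchange-↭ x y bs cs = trans↭ (prep x (shift y bs cs)) (trans↭ (swap x y refl) (prep y (↭-sym (shift x bs cs))))

-- Carry `x` across `bs`, swap it with `y`, carry `y` back. Both journeys have the sign
-- `ε (length bs)`, so only the sign of the swap is left.
sgn-exchange : ∀ x y bs cs → x ≢ y → x ∉ bs → y ∉ bs → sgn (x ∷ bs ++ y ∷ cs) ≡ - sgn (y ∷ bs ++ x ∷ cs)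
sgn-exchange x y bs cs ne x∉ y∉ = begin
  sgn (x ∷ bs ++ y ∷ cs) ≡⟨ sgn-move x bs (y ∷ cs) x∉ ⟩
  ε (length bs) * sgn (bs ++ x ∷ y ∷ cs)
    ≡⟨ cong (ε (length bs) *_) (sgn-++-neg bs (swap x y refl) (sgn-swap x y cs ne)) ⟩
  ε (length bs) * (- sgn (bs ++ y ∷ x ∷ cs)) ≡⟨ neg-distribʳ-* (ε (length bs)) _ ⟨
  - (ε (length bs) * sgn (bs ++ y ∷ x ∷ cs)) ≡⟨ cong -_ (sgn-move y bs (x ∷ cs) y∉) ⟨
  - sgn (y ∷ bs ++ x ∷ cs) ∎
  where open ≡-Reasoning

unique-++⁻ˡ-∉ : ∀ {x : ℕ} as {bs} → Unique (as ++ bs) → x ∈ bs → x ∉ as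
unique-++⁻ˡ-∉ (a ∷ as) (a∉ ∷ u) x∈ (here refl) = All.lookup a∉ (∈-++⁺ʳ as x∈) refl
unique-++⁻ˡ-∉ (a ∷ as) (a∉ ∷ u) x∈ (there x∈as) = unique-++⁻ˡ-∉ as u x∈ x∈as

unique-++⁻ʳ : ∀ (as : List ℕ) {bs} → Unique (as ++ bs) → Unique bs
unique-++⁻ʳ [] u = u
unique-++⁻ʳ (a ∷ as) (_ ∷ u) = unique-++⁻ʳ as u

sgn-map-tr-ordered : ∀ x y as bs cs → Unique (as ++ x ∷ bs ++ y ∷ cs) →
                     sgn (map (tr x y) (as ++ x ∷ bs ++ y ∷ cs)) ≡ - sgn (as ++ x ∷ bs ++ y ∷ cs)
sgn-map-tr-ordered x y as bs cs u =
  trans (cong sgn mapped) (sgn-++-neg as (exchange-↭ y x bs cs) (sgn-exchange y x bs cs (≢-sym x≢y) y∉bs x∉bs))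
  where
  u₁ : Unique (x ∷ bs ++ y ∷ cs)
  u₁ = unique-++⁻ʳ as u
  u₂ : Unique (bs ++ y ∷ cs)
  u₂ = unique-++⁻ʳ (x ∷ []) u₁
  x∉ : x ∉ bs ++ y ∷ cs
  x∉ = unique-∉ u₁
  x≢y : x ≢ y
  x≢y refl = x∉ (∈-++⁺ʳ bs (here refl))
  x∉bs : x ∉ bs
  x∉bs = x∉ ∘ ∈-++⁺ˡ
  y∉bs : y ∉ bs
  y∉bs = unique-++⁻ˡ-∉ bs u₂ (here refl)
  mapped : map (tr x y) (as ++ x ∷ bs ++ y ∷ cs) ≡ as ++ y ∷ bs ++ x ∷ cs
  mapped = trans (Listₚ.map-++ (tr x y) as _)
    (cong₂ _++_ (map-tr-∉ as (unique-++⁻ˡ-∉ as u (here refl)) (unique-++⁻ˡ-∉ as u (there (∈-++⁺ʳ bs (here refl)))))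
    (cong₂ _∷_ (tr-left x y) (trans (Listₚ.map-++ (tr x y) bs _)
    (cong₂ _++_ (map-tr-∉ bs x∉bs y∉bs)
    (cong₂ _∷_ (tr-right x y) (map-tr-∉ cs (x∉ ∘ ∈-++⁺ʳ bs ∘ there) (unique-∉ (unique-++⁻ʳ bs u₂))))))))

-- Here the transposition acts on values, whereas `sgn-exchange` exchanges positions; in a
-- duplicate-free word the two agree. The cases say which of `x` and `y` comes first.
sgn-map-tr : ∀ {x y w} → Unique w → x ∈ w → y ∈ w → x ≢ y → sgn (map (tr x y) w) ≡ - sgn w
sgn-map-tr {x} {y} u x∈ y∈ ne with ∈-∃++ x∈
... | as , ds , refl with ∈-++⁻ as y∈
... | inj₂ (here refl) = ⊥-elim (ne refl)
... | inj₂ (there y∈ds) with ∈-∃++ y∈ds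
... | bs , cs , refl = sgn-map-tr-ordered x y as bs cs u
sgn-map-tr {x} {y} u x∈ y∈ ne | as , ds , refl | inj₁ y∈as with ∈-∃++ y∈as
... | as' , bs , refl = subst (λ w → sgn (map (tr x y) w) ≡ - sgn w) (sym reassoc)
      (trans (cong sgn (map-cong (tr-comm x y) (as' ++ y ∷ bs ++ x ∷ ds)))
        (sgn-map-tr-ordered y x as' bs ds (subst Unique reassoc u)))
  where
  reassoc : (as' ++ y ∷ bs) ++ x ∷ ds ≡ as' ++ y ∷ bs ++ x ∷ ds
  reassoc = Listₚ.++-assoc as' (y ∷ bs) (x ∷ ds)

inversions-sorted : ∀ {w} → AllPairs _<_ w → inversions w ≡ 0
inversions-sorted [] = refl
inversions-sorted {x ∷ w} (x< ∷ s) = cong₂ ℕ._+_ (none w x<) (inversions-sorted s)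
  where
  none : ∀ w → All (x <_) w → countᵇ (_<ᵇ x) w ≡ 0
  none [] [] = refl
  none (y ∷ w) (lt ∷ a) rewrite ≮⇒<ᵇ-false {y} {x} (<⇒≤ lt) = none w a

sgn-upTo : ∀ n → sgn (upTo n) ≡ 1ℚ
sgn-upTo n = cong ε (inversions-sorted (AllPairsₚ.applyUpTo⁺₁ id n (λ lt _ → lt)))

-- Cells and fillings

module _ {C : Set} where

  zip-∈ˡ : ∀ {cs : List C} {w : List ℕ} {c a} → (c , a) ∈ zip cs w → c ∈ cs
  zip-∈ˡ {c ∷ cs} {x ∷ w} (here refl) = here refl
  zip-∈ˡ {c ∷ cs} {x ∷ w} (there i) = there (zip-∈ˡ i)

  zip-∈ʳ : ∀ {cs : List C} {w : List ℕ} {c a} → (c , a) ∈ zip cs w → a ∈ w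
  zip-∈ʳ {c ∷ cs} {x ∷ w} (here refl) = here refl
  zip-∈ʳ {c ∷ cs} {x ∷ w} (there i) = there (zip-∈ʳ i)

  zip-coverˡ : ∀ {cs : List C} {w : List ℕ} {c} → length cs ≡ length w → c ∈ cs → Σ ℕ λ a → (c , a) ∈ zip cs w
  zip-coverˡ {c ∷ cs} {x ∷ w} l (here refl) = x , here refl
  zip-coverˡ {c ∷ cs} {x ∷ w} l (there i) = let a , j = zip-coverˡ (suc-injective l) i in a , there j

  zip-coverʳ : ∀ {cs : List C} {w : List ℕ} {a} → length cs ≡ length w → a ∈ w → Σ C λ c → (c , a) ∈ zip cs w
  zip-coverʳ {c ∷ cs} {x ∷ w} l (here refl) = c , here refl
  zip-coverʳ {c ∷ cs} {x ∷ w} l (there i) = let a , j = zip-coverʳ (suc-injective l) i in a , there j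

  zip-uniqueʳ : ∀ {cs : List C} {w : List ℕ} {c c' a} → Unique w → (c , a) ∈ zip cs w → (c' , a) ∈ zip cs w → c ≡ c'
  zip-uniqueʳ {c ∷ cs} {x ∷ w} u (here refl) (here refl) = refl
  zip-uniqueʳ {c ∷ cs} {x ∷ w} u (here refl) (there j) = ⊥-elim (unique-∉ u (zip-∈ʳ j))
  zip-uniqueʳ {c ∷ cs} {x ∷ w} u (there i) (here refl) = ⊥-elim (unique-∉ u (zip-∈ʳ i))
  zip-uniqueʳ {c ∷ cs} {x ∷ w} (_ ∷ u) (there i) (there j) = zip-uniqueʳ u i j

  zip-uniqueˡ : ∀ {cs : List C} {w : List ℕ} {c a b} → Unique cs → (c , a) ∈ zip cs w → (c , b) ∈ zip cs w → a ≡ b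
  zip-uniqueˡ {c ∷ cs} {x ∷ w} u (here refl) (here refl) = refl
  zip-uniqueˡ {c ∷ cs} {x ∷ w} u (here refl) (there j) = ⊥-elim (unique-∉ u (zip-∈ˡ j))
  zip-uniqueˡ {c ∷ cs} {x ∷ w} u (there i) (here refl) = ⊥-elim (unique-∉ u (zip-∈ˡ i))
  zip-uniqueˡ {c ∷ cs} {x ∷ w} (_ ∷ u) (there i) (there j) = zip-uniqueˡ u i j

  zip-map⁺ : ∀ (f : ℕ → ℕ) {cs : List C} {w c a} → (c , a) ∈ zip cs w → (c , f a) ∈ zip cs (map f w)
  zip-map⁺ f {c ∷ cs} {x ∷ w} (here refl) = here refl
  zip-map⁺ f {c ∷ cs} {x ∷ w} (there i) = there (zip-map⁺ f i)

  zip-map⁻ : ∀ (f : ℕ → ℕ) {cs : List C} {w c b} → (c , b) ∈ zip cs (map f w) → Σ ℕ λ a → b ≡ f a × (c , a) ∈ zip cs w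
  zip-map⁻ f {c ∷ cs} {x ∷ w} (here refl) = x , refl , here refl
  zip-map⁻ f {c ∷ cs} {x ∷ w} (there i) = let a , e , j = zip-map⁻ f i in a , e , there j

  zip-ext : ∀ {cs : List C} {v w : List ℕ} → Unique cs → length cs ≡ length v → length cs ≡ length w →
            (∀ {c a} → (c , a) ∈ zip cs v → (c , a) ∈ zip cs w) → v ≡ w
  zip-ext {[]} {[]} {[]} u l l' h = refl
  zip-ext {c ∷ cs} {x ∷ v} {y ∷ w} u@(c∉ ∷ u') l l' h =
    cong₂ _∷_ (zip-uniqueˡ u (h (here refl)) (here refl))
      (zip-ext u' (suc-injective l) (suc-injective l') (λ i → drop i (h (there i))))
    where
    drop : ∀ {d a} → (d , a) ∈ zip cs v → (d , a) ∈ (c , y) ∷ zip cs w → (d , a) ∈ zip cs w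
    drop i (here refl) = ⊥-elim (All.lookup c∉ (zip-∈ˡ i) refl)
    drop i (there j) = j

  zip-proj₂ : ∀ (cs : List C) (w : List ℕ) → length cs ≡ length w → map proj₂ (zip cs w) ≡ w
  zip-proj₂ [] [] l = refl
  zip-proj₂ (c ∷ cs) (x ∷ w) l = cong (x ∷_) (zip-proj₂ cs w (suc-injective l))

zip-at : ∀ {cs : List Cell} {w k} → k < length cs → length cs ≡ length w → (cellAtL cs k , at w k) ∈ zip cs w
zip-at {c ∷ cs} {x ∷ w} {zero} lt l = here refl
zip-at {c ∷ cs} {x ∷ w} {suc k} (s≤s lt) l = there (zip-at lt (suc-injective l))

zip-index : ∀ {cs : List Cell} {w c a} → (c , a) ∈ zip cs w → Σ ℕ λ k → k < length cs × k < length w × c ≡ cellAtL cs k × a ≡ at w k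
zip-index {c ∷ cs} {x ∷ w} (here refl) = 0 , s≤s z≤n , s≤s z≤n , refl , refl
zip-index {c ∷ cs} {x ∷ w} (there i) =
  let k , lt , lt' , e , e' = zip-index i in suc k , s≤s lt , s≤s lt' , e , e'

cellOfL-∈ : ∀ {cs w c a} → Unique w → (c , a) ∈ zip cs w → cellOfL (zip cs w) a ≡ c
cellOfL-∈ {c ∷ cs} {x ∷ w} u (here refl) rewrite ≡ᵇ-refl x = refl
cellOfL-∈ {c ∷ cs} {x ∷ w} u@(_ ∷ u') (there i)
  rewrite ≡ᵇ-false (λ e → unique-∉ u (subst (_∈ w) (sym e) (zip-∈ʳ i))) = cellOfL-∈ u' i

cellOfL-∉ : ∀ {cs w a} → a ∉ w → cellOfL (zip cs w) a ≡ (0 , 0)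
cellOfL-∉ {[]} {w} a∉ = refl
cellOfL-∉ {c ∷ cs} {[]} a∉ = refl
cellOfL-∉ {c ∷ cs} {x ∷ w} a∉ rewrite ≡ᵇ-false (λ e → a∉ (here (sym e))) = cellOfL-∉ {cs} (a∉ ∘ there)

∈-cellsFrom⁺ : ∀ s sh {r c} → c < at sh r → (s ℕ.+ r , c) ∈ cellsFrom s sh
∈-cellsFrom⁺ s (l ∷ ls) {zero} lt rewrite ℕₚ.+-identityʳ s = ∈-++⁺ˡ (∈-map⁺ (s ,_) (∈-upTo⁺ lt))
∈-cellsFrom⁺ s (l ∷ ls) {suc r} {c} lt =
  ∈-++⁺ʳ (map (s ,_) (upTo l)) (subst (λ t → (t , c) ∈ cellsFrom (suc s) ls) (sym (ℕₚ.+-suc s r)) (∈-cellsFrom⁺ (suc s) ls lt))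

∈-cellsFrom⁻ : ∀ s sh {x} → x ∈ cellsFrom s sh → Σ ℕ λ r → proj₁ x ≡ s ℕ.+ r × proj₂ x < at sh r
∈-cellsFrom⁻ s (l ∷ ls) x∈ with ∈-++⁻ (map (s ,_) (upTo l)) x∈
... | inj₁ i with ∈-map⁻ (s ,_) i
...   | c , c∈ , refl = 0 , sym (ℕₚ.+-identityʳ s) , ∈-upTo⁻ c∈
∈-cellsFrom⁻ s (l ∷ ls) x∈ | inj₂ i =
  let r , e , lt = ∈-cellsFrom⁻ (suc s) ls i in suc r , trans e (sym (ℕₚ.+-suc s r)) , lt

cellsFrom-unique : ∀ s sh → Unique (cellsFrom s sh)
cellsFrom-unique s [] = []
cellsFrom-unique s (l ∷ ls) =
  Uniqueₚ.++⁺ (Uniqueₚ.map⁺ (λ { refl → refl }) (Uniqueₚ.upTo⁺ l)) (cellsFrom-unique (suc s) ls) disj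
  where
  disj : ∀ {x} → ¬ (x ∈ map (s ,_) (upTo l) × x ∈ cellsFrom (suc s) ls)
  disj (i , j) with ∈-map⁻ (s ,_) i
  ... | c , _ , refl = let r , e , _ = ∈-cellsFrom⁻ (suc s) ls j in ℕₚ.m≢1+m+n s e

length-cellsFrom : ∀ s sh → length (cellsFrom s sh) ≡ sum sh
length-cellsFrom s [] = refl
length-cellsFrom s (l ∷ ls) = trans (Listₚ.length-++ (map (s ,_) (upTo l)))
  (cong₂ ℕ._+_ (trans (length-map (s ,_) (upTo l)) (length-upTo l)) (length-cellsFrom (suc s) ls))

∈-cells⁺ : ∀ sh {r c} → c < at sh r → (r , c) ∈ cells sh
∈-cells⁺ sh lt = ∈-cellsFrom⁺ 0 sh lt

∈-cells⁻ : ∀ sh {r c} → (r , c) ∈ cells sh → c < at sh r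
∈-cells⁻ sh x∈ with ∈-cellsFrom⁻ 0 sh x∈
... | r , refl , lt = lt

at-positive : ∀ sh {r c} → c < at sh r → r < length sh
at-positive (l ∷ ls) {zero} lt = s≤s z≤n
at-positive (l ∷ ls) {suc r} lt = s≤s (at-positive ls lt)

at-antitone : ∀ {sh} → Linked (λ a b → b ≤ a) sh → ∀ {r r'} → r ≤ r' → at sh r' ≤ at sh r
at-antitone {[]} lk le = z≤n
at-antitone {l ∷ ls} lk {zero} {zero} le = ≤-refl
at-antitone {l ∷ []} lk {zero} {suc r'} le = z≤n
at-antitone {l ∷ m ∷ ls} (m≤l ∷ lk) {zero} {suc r'} le = ≤-trans (at-antitone lk {zero} {r'} z≤n) m≤l
at-antitone {l ∷ []} lk {suc r} {suc r'} le = z≤n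
at-antitone {l ∷ m ∷ ls} (_ ∷ lk) {suc r} {suc r'} (s≤s le) = at-antitone lk le

-- The values `f 1`, ..., `f n` read as digits in base `M`, the most significant being `f 1`.
-- Lexicographic comparison becomes comparison of numbers.
key : ℕ → (ℕ → ℕ) → ℕ → ℕ
key M f zero = 0
key M f (suc n) = key M f n ℕ.* M ℕ.+ f (suc n)

key-cong : ∀ M {f g} n → (∀ a → 1 ≤ a → a ≤ n → f a ≡ g a) → key M f n ≡ key M g n
key-cong M zero h = refl
key-cong M (suc n) h = cong₂ (λ k x → k ℕ.* M ℕ.+ x) (key-cong M n (λ a l u → h a l (m≤n⇒m≤1+n u))) (h (suc n) (s≤s z≤n) ≤-refl)

-- Beyond the first difference the leading part of `f` is behind by at least one unit. That unit is
-- worth `M`, more than the next digit of `f` can make up.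
key-< : ∀ M {f g} n a → (∀ b → f b < M) → 1 ≤ a → a ≤ n → (∀ b → 1 ≤ b → b < a → f b ≡ g b) → f a < g a →
        key M f n < key M g n
key-< M zero (suc a) bf _ () pre lt
key-< M {f} {g} (suc n) a bf l u pre lt with m≤n⇒m<n∨m≡n u
... | inj₂ refl rewrite key-cong M {f} {g} n (λ b l u → pre b l (s≤s u)) = ℕₚ.+-monoʳ-< (key M g n ℕ.* M) lt
... | inj₁ (s≤s a≤n) = begin-strict
  key M f n ℕ.* M ℕ.+ f (suc n) <⟨ ℕₚ.+-monoʳ-< (key M f n ℕ.* M) (bf (suc n)) ⟩
  key M f n ℕ.* M ℕ.+ M ≡⟨ ℕₚ.+-comm (key M f n ℕ.* M) M ⟩
  suc (key M f n) ℕ.* M ≤⟨ ℕₚ.*-monoˡ-≤ M (key-< M n a bf l a≤n pre lt) ⟩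
  key M g n ℕ.* M ≤⟨ ℕₚ.m≤m+n (key M g n ℕ.* M) (g (suc n)) ⟩
  key M g n ℕ.* M ℕ.+ g (suc n) ∎
  where open ℕₚ.≤-Reasoning

first-difference : ∀ (f g : ℕ → ℕ) n → (∀ a → 1 ≤ a → a ≤ n → f a ≡ g a) ⊎
  (Σ ℕ λ a → 1 ≤ a × a ≤ n × (∀ b → 1 ≤ b → b < a → f b ≡ g b) × f a ≢ g a)
first-difference f g zero = inj₁ λ { (suc a) l () }
first-difference f g (suc n) with first-difference f g n
... | inj₂ (a , l , u , pre , ne) = inj₂ (a , l , m≤n⇒m≤1+n u , pre , ne)
... | inj₁ same with f (suc n) ℕ.≟ g (suc n)
...   | no ne = inj₂ (suc n , s≤s z≤n , ≤-refl , (λ b l lt → same b l (≤-pred lt)) , ne)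
...   | yes e = inj₁ go
  where
  go : ∀ a → 1 ≤ a → a ≤ suc n → f a ≡ g a
  go a l u with m≤n⇒m<n∨m≡n u
  ... | inj₁ (s≤s a≤n) = same a l a≤n
  ... | inj₂ refl = e

at-ext : ∀ {v w} → length v ≡ length w → (∀ k → k < length v → at v k ≡ at w k) → v ≡ w
at-ext {[]} {[]} l h = refl
at-ext {x ∷ v} {y ∷ w} l h = cong₂ _∷_ (h 0 (s≤s z≤n)) (at-ext (suc-injective l) (λ k lt → h (suc k) (s≤s lt)))

map-cancel-∈ : ∀ {A B : Set} {f : A → B} xs ys → (∀ {x y} → x ∈ xs → y ∈ ys → f x ≡ f y → x ≡ y) →
               map f xs ≡ map f ys → xs ≡ ys
map-cancel-∈ [] [] inj e = refl
map-cancel-∈ (x ∷ xs) (y ∷ ys) inj e =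
  cong₂ _∷_ (inj (here refl) (here refl) (∷-injectiveˡ e))
    (map-cancel-∈ xs ys (λ a b → inj (there a) (there b)) (∷-injectiveʳ e))

tr-bound : ∀ {x y z m} → x < m → y < m → z < m → tr x y z < m
tr-bound {x} {y} {z} lx ly lz with tr-view x y z
... | is-left _ e rewrite e = ly
... | is-right _ e rewrite e = lx
... | is-other _ _ e rewrite e = lz

length-swapCode : ∀ i τ → length (swapCode i τ) ≡ length τ
length-swapCode i τ = trans (length-map _ (upTo (length τ))) (length-upTo (length τ))

at-swapCode : ∀ i τ {k} → k < length τ → at (swapCode i τ) k ≡ at τ (swapIdx i k)
at-swapCode i τ {k} lt = trans (at-map _ (upTo (length τ)) (subst (k <_) (sym (length-upTo (length τ))) lt))
  (cong (at τ ∘ swapIdx i) (at-applyUpTo (length τ) id lt))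

-- `swapIdx i` is `tr (i ∸ 1) i` by definition. The bound keeps both positions inside the code,
-- since outside of it `at` returns a default value.
swapCode-involutive : ∀ {i} τ → i < length τ → swapCode i (swapCode i τ) ≡ τ
swapCode-involutive {i} τ lt = at-ext (trans (length-swapCode i (swapCode i τ)) (length-swapCode i τ)) (λ k k< →
  let k<' = subst (k <_) (length-swapCode i (swapCode i τ)) k<
      k<τ = subst (k <_) (length-swapCode i τ) k<' in
  trans (at-swapCode i (swapCode i τ) k<')
  (trans (at-swapCode i τ (tr-bound {i ∸ 1} {i} (≤-<-trans (ℕₚ.m∸n≤m i 1) lt) lt k<τ))
    (cong (at τ) (tr-involutive (i ∸ 1) i k))))

-- Raising the indicator function of a row word.

indicator : List ℕ → List ℕ → ℚ
indicator σ t = if eqListᵇ σ t then 1ℚ else 0ℚ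

update : (ℕ → ℕ) → ℕ → ℕ → ℕ → ℕ
update ρ a r b = if b ≡ᵇ a then r else ρ b

update-≡ : ∀ ρ {a b} r → b ≡ a → update ρ a r b ≡ r
update-≡ ρ {a} r refl rewrite ≡ᵇ-refl a = refl

update-≢ : ∀ ρ {a b} r → b ≢ a → update ρ a r b ≡ ρ b
update-≢ ρ r ne rewrite ≡ᵇ-false ne = refl

indicator-∷-≡ : ∀ x σ t → indicator (x ∷ σ) (x ∷ t) ≡ indicator σ t
indicator-∷-≡ x σ t rewrite ≡ᵇ-refl x = refl

indicator-∷-≢ : ∀ {x y} σ t → x ≢ y → indicator (x ∷ σ) (y ∷ t) ≡ 0ℚ
indicator-∷-≢ σ t ne rewrite ≡ᵇ-false ne = refl

if-zero : ∀ b {x} → x ≡ 0ℚ → (if b then x else 0ℚ) ≡ 0ℚ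
if-zero true e = e
if-zero false e = refl

-- The raising operator acts on a basis word as a derivation, with one summand for each letter that
-- can move from row `r + 1` to row `r`. `L` lists letters and `ρ` their rows; as `L` has no
-- repetitions, `update` changes a single place of the word.
raise-indicator : ∀ r ρ {L} → Unique L → ∀ u →
  raise r 1 (indicator (map ρ L)) u ≡ ∑ L (λ a → if ρ a ≡ᵇ suc r then indicator (map (update ρ a r) L) u else 0ℚ)
raise-indicator r ρ {[]} uL [] = refl
raise-indicator r ρ {[]} uL (x ∷ u) = cong₂ _+_ (raise-zero r 1 u) (if-zero (x ≡ᵇ r) refl)
raise-indicator r ρ {b ∷ L} uL [] = sym (∑-zero (b ∷ L) (λ {a} _ → if-zero (ρ a ≡ᵇ suc r) refl))
raise-indicator r ρ {b ∷ L} (b∉ ∷ uL) (x ∷ u) =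
  trans (cong₂ _+_ unchanged changed) (Qₚ.+-comm _ (if ρ b ≡ᵇ suc r then indicator (map (update ρ b r) (b ∷ L)) (x ∷ u) else 0ℚ))
  where
  at-b : map (update ρ b r) (b ∷ L) ≡ r ∷ map ρ L
  at-b = cong₂ _∷_ (update-≡ ρ r refl) (map-cong-∈ L (λ a∈ → update-≢ ρ r (λ e → All.lookup b∉ a∈ (sym e))))
  -- The recursion of `raise` tests the head `x` of the argument, the summand of `b` tests the row
  -- of `b`. Each side makes the other test through its indicator, so both require `x = r` and
  -- `ρ b = r + 1`.
  tests : (if x ≡ᵇ r then indicator (ρ b ∷ map ρ L) (suc r ∷ u) else 0ℚ) ≡
          (if ρ b ≡ᵇ suc r then indicator (r ∷ map ρ L) (x ∷ u) else 0ℚ)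
  tests with x ℕ.≟ r | ρ b ℕ.≟ suc r
  ... | yes refl | yes e rewrite e | ≡ᵇ-refl r = refl
  ... | yes refl | no ne rewrite ≡ᵇ-false ne = if-zero (r ≡ᵇ r) refl
  ... | no ne | yes e rewrite e | ≡ᵇ-refl r | ≡ᵇ-false ne | ≡ᵇ-false (≢-sym ne) = refl
  ... | no ne | no ne' rewrite ≡ᵇ-false ne | ≡ᵇ-false ne' = refl
  changed : (if x ≡ᵇ r then indicator (map ρ (b ∷ L)) (suc r ∷ u) else 0ℚ) ≡
            (if ρ b ≡ᵇ suc r then indicator (map (update ρ b r) (b ∷ L)) (x ∷ u) else 0ℚ)
  changed = trans tests (cong (λ z → if ρ b ≡ᵇ suc r then indicator z (x ∷ u) else 0ℚ) (sym at-b))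
  unchanged : raise r 1 (λ t → indicator (map ρ (b ∷ L)) (x ∷ t)) u ≡
              ∑ L (λ a → if ρ a ≡ᵇ suc r then indicator (map (update ρ a r) (b ∷ L)) (x ∷ u) else 0ℚ)
  unchanged with ρ b ℕ.≟ x
  ... | yes refl = begin
      raise r 1 (λ t → indicator (map ρ (b ∷ L)) (ρ b ∷ t)) u ≡⟨ raise-cong r 1 u (λ t _ → indicator-∷-≡ (ρ b) (map ρ L) t) ⟩
      raise r 1 (indicator (map ρ L)) u ≡⟨ raise-indicator r ρ uL u ⟩
      ∑ L (λ a → if ρ a ≡ᵇ suc r then indicator (map (update ρ a r) L) u else 0ℚ)
        ≡⟨ ∑-cong L (λ {a} a∈ → cong (λ q → if ρ a ≡ᵇ suc r then q else 0ℚ)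
             (trans (sym (indicator-∷-≡ (ρ b) (map (update ρ a r) L) u))
               (cong (λ y → indicator (y ∷ map (update ρ a r) L) (ρ b ∷ u)) (sym (update-≢ ρ r (All.lookup b∉ a∈)))))) ⟩
      ∑ L (λ a → if ρ a ≡ᵇ suc r then indicator (map (update ρ a r) (b ∷ L)) (ρ b ∷ u) else 0ℚ) ∎
    where open ≡-Reasoning
  ... | no ne = trans (raise-cong r 1 u (λ t _ → indicator-∷-≢ (map ρ L) t ne)) (trans (raise-zero r 1 u)
      (sym (∑-zero L (λ {a} a∈ → if-zero (ρ a ≡ᵇ suc r)
        (indicator-∷-≢ (map (update ρ a r) L) u (λ e → ne (trans (sym (update-≢ ρ r (All.lookup b∉ a∈))) e)))))))

∈-cellAtL : ∀ {cs c} → c ∈ cs → Σ ℕ λ k → k < length cs × cellAtL cs k ≡ c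
∈-cellAtL (here refl) = 0 , s≤s z≤n , refl
∈-cellAtL (there i) = let k , lt , e = ∈-cellAtL i in suc k , s≤s lt , e

-- Yamanouchi words and row-increasing fillings.

down : ℕ → List ℕ
down n = map suc (downFrom n)

reverse-letters : ∀ n → reverse (letters n) ≡ down n
reverse-letters n = trans (sym (Listₚ.reverse-map suc (upTo n))) (cong (map suc) (Listₚ.reverse-upTo n))

occ-mono-∷ : ∀ y x w → occ y w ≤ occ y (x ∷ w)
occ-mono-∷ y x w with x ≡ᵇ y
... | true = n≤1+n _
... | false = ≤-refl

yamanouchi-tail : ∀ x w → Yamanouchi (x ∷ w) → Yamanouchi w
yamanouchi-tail zero w y = y
yamanouchi-tail (suc x) w y = proj₁ y

yamanouchi-step : ∀ w → Yamanouchi w → ∀ y → occ (suc y) w ≤ occ y w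
yamanouchi-step [] yam y = z≤n
yamanouchi-step (zero ∷ w) yam y = ≤-trans (yamanouchi-step w yam y) (occ-mono-∷ y 0 w)
yamanouchi-step (suc z ∷ w) (yam , lt) y with z ℕ.≟ y
... | yes refl = ≤-trans (≤-reflexive (occ-≡ (suc y) w)) (≤-trans lt (occ-mono-∷ y (suc y) w))
... | no ne = ≤-trans (≤-reflexive (occ-≢ w (ne ∘ suc-injective))) (≤-trans (yamanouchi-step w yam y) (occ-mono-∷ y (suc z) w))

yamanouchi-antitone : ∀ w → Yamanouchi w → ∀ {y z} → y ≤ z → occ z w ≤ occ y w
yamanouchi-antitone w yam {y} {zero} z≤n = ≤-refl
yamanouchi-antitone w yam {y} {suc z} le with m≤n⇒m<n∨m≡n le
... | inj₁ (s≤s le') = ≤-trans (yamanouchi-step w yam z) (yamanouchi-antitone w yam le')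
... | inj₂ refl = ≤-refl

module _ (ρ : ℕ → ℕ) where

  prefixOcc : ℕ → ℕ → ℕ
  prefixOcc y a = occ y (map ρ (down a))

  prefixOcc-suc-≡ : ∀ a → prefixOcc (ρ (suc a)) (suc a) ≡ suc (prefixOcc (ρ (suc a)) a)
  prefixOcc-suc-≡ a = occ-≡ (ρ (suc a)) (map ρ (down a))

  prefixOcc-mono : ∀ y {a b} → a ≤ b → prefixOcc y a ≤ prefixOcc y b
  prefixOcc-mono y {a} {zero} z≤n = ≤-refl
  prefixOcc-mono y {a} {suc b} le with m≤n⇒m<n∨m≡n le
  ... | inj₁ (s≤s le') = ≤-trans (prefixOcc-mono y le') (occ-mono-∷ y (ρ (suc b)) (map ρ (down b)))
  ... | inj₂ refl = ≤-refl

  yamanouchi-prefix : ∀ {n a} → a ≤ n → Yamanouchi (map ρ (down n)) → Yamanouchi (map ρ (down a))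
  yamanouchi-prefix {zero} z≤n yam = yam
  yamanouchi-prefix {suc n} le yam with m≤n⇒m<n∨m≡n le
  ... | inj₁ (s≤s le') = yamanouchi-prefix le' (yamanouchi-tail (ρ (suc n)) (map ρ (down n)) yam)
  ... | inj₂ refl = yam

  -- The cell of letter a in the row-increasing filling whose row word is ρ.
  rowCell : ℕ → Cell
  rowCell a = ρ a , prefixOcc (ρ a) (a ∸ 1)

  rowCell-< : ∀ {a b} → 1 ≤ a → a < b → ρ a ≡ ρ b → proj₂ (rowCell a) < proj₂ (rowCell b)
  rowCell-< {suc a} {suc b} _ (s≤s lt) e = <-≤-trans
    (≤-reflexive (sym (prefixOcc-suc-≡ a))) (≤-trans (prefixOcc-mono (ρ (suc a)) lt) (≤-reflexive (cong (λ y → prefixOcc y b) e)))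

  rowCell-injective : ∀ {a b} → 1 ≤ a → 1 ≤ b → rowCell a ≡ rowCell b → a ≡ b
  rowCell-injective {a} {b} la lb e with <-cmp a b
  ... | tri< lt _ _ = ⊥-elim (<-irrefl (cong proj₂ e) (rowCell-< la lt (cong proj₁ e)))
  ... | tri≈ _ q _ = q
  ... | tri> _ _ gt = ⊥-elim (<-irrefl (cong proj₂ (sym e)) (rowCell-< lb gt (cong proj₁ (sym e))))

zip-map-self : ∀ {A : Set} (f : ℕ → A) w {c a} → (c , a) ∈ zip (map f w) w → c ≡ f a
zip-map-self f (x ∷ w) (here refl) = refl
zip-map-self f (x ∷ w) (there i) = zip-map-self f w i

tr-mono-< : ∀ i {a b} → a < b → ¬ (a ≡ i × b ≡ suc i) → tr i (suc i) a < tr i (suc i) b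
tr-mono-< i {a} {b} lt ne with tr-view i (suc i) a | tr-view i (suc i) b
... | is-left refl e | is-left refl e' = ⊥-elim (<-irrefl refl lt)
... | is-left refl e | is-right refl e' = ⊥-elim (ne (refl , refl))
... | is-left refl e | is-other _ b≢ e' rewrite e | e' = ≤∧≢⇒< lt (≢-sym b≢)
... | is-right refl e | is-left refl e' = ⊥-elim (<-asym lt (n<1+n i))
... | is-right refl e | is-right refl e' = ⊥-elim (<-irrefl refl lt)
... | is-right refl e | is-other _ _ e' rewrite e | e' = <-trans (n<1+n i) lt
... | is-other _ _ e | is-left refl e' rewrite e | e' = m<n⇒m<1+n lt
... | is-other a≢ _ e | is-right refl e' rewrite e | e' = ≤∧≢⇒< (≤-pred lt) a≢
... | is-other _ _ e | is-other _ _ e' rewrite e | e' = lt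

-- Indexed lists of tableaux and signed basis vectors.

nth : List (List ℕ) → ℕ → List ℕ
nth []       k = []
nth (S ∷ L) zero = S
nth (S ∷ L) (suc k) = nth L k

nth-∈ : ∀ {L k} → k < length L → nth L k ∈ L
nth-∈ {S ∷ L} {zero} lt = here refl
nth-∈ {S ∷ L} {suc k} (s≤s lt) = there (nth-∈ lt)

∈-nth : ∀ {L S} → S ∈ L → Σ ℕ λ k → k < length L × nth L k ≡ S
∈-nth (here refl) = 0 , s≤s z≤n , refl
∈-nth (there S∈) = let k , lt , e = ∈-nth S∈ in suc k , s≤s lt , e

nth-AllPairs : ∀ {R : List ℕ → List ℕ → Set} {L} → AllPairs R L → ∀ {j k} → j < k → k < length L → R (nth L j) (nth L k)
nth-AllPairs (r ∷ a) {zero} {suc k} _ (s≤s lt) = All.lookup r (nth-∈ lt)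
nth-AllPairs (r ∷ a) {suc j} {suc k} (s≤s jk) (s≤s lt) = nth-AllPairs a jk lt

map-nth-upTo : ∀ L → map (nth L) (upTo (length L)) ≡ L
map-nth-upTo L = trans (map-upTo (nth L) (length L)) (go L)
  where
  go : ∀ L → applyUpTo (nth L) (length L) ≡ L
  go [] = refl
  go (S ∷ L) = cong (S ∷_) (go L)

-- The operators send a basis vector to zero or to a basis vector up to sign. With symbols for these
-- values, the 0-Hecke relations become equations between finite data instead of coordinate
-- functions.
data Signed : Set where
  nil     : Signed
  pos neg : List ℕ → Signed

flip : Signed → Signed
flip nil = nil
flip (pos T) = neg T
flip (neg T) = pos T

⟦_⟧ : Signed → Coord
⟦ nil ⟧ = zeroC
⟦ pos T ⟧ = δ T
⟦ neg T ⟧ = negC (δ T)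

⟦flip⟧ : ∀ x S → ⟦ flip x ⟧ S ≡ - ⟦ x ⟧ S
⟦flip⟧ nil S = refl
⟦flip⟧ (pos T) S = refl
⟦flip⟧ (neg T) S = sym (⁻¹-involutive (δ T S))

δ-≡ : ∀ T → δ T T ≡ 1ℚ
δ-≡ T rewrite eqListᵇ-refl T = refl

δ-≢ : ∀ {S T} → S ≢ T → δ T S ≡ 0ℚ
δ-≢ ne rewrite eqListᵇ-false ne = refl

-- Words, contents and sorted lists.

∈-words⁻ : ∀ n m {w} → w ∈ words n m → length w ≡ n × (∀ {x} → x ∈ w → x ∈ letters m)
∈-words⁻ zero m (here refl) = refl , λ ()
∈-words⁻ (suc n) m w∈ with find (∈-concatMap⁻ (λ w → map (_∷ w) (letters m)) {words n m} w∈)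
... | v , v∈ , w∈' with ∈-map⁻ (_∷ v) w∈'
... | x , x∈ , refl = let l , h = ∈-words⁻ n m v∈ in cong suc l , λ { (here refl) → x∈ ; (there y∈) → h y∈ }

∈-words⁺ : ∀ n m {w} → length w ≡ n → (∀ {x} → x ∈ w → x ∈ letters m) → w ∈ words n m
∈-words⁺ zero m {[]} l h = here refl
∈-words⁺ (suc n) m {x ∷ w} l h = ∈-concatMap⁺ (λ w → map (_∷ w) (letters m))
  (lose (∈-words⁺ n m (suc-injective l) (h ∘ there)) (∈-map⁺ (_∷ w) (h (here refl))))

words-unique : ∀ n m → Unique (words n m)
words-unique zero m = [] ∷ []
words-unique (suc n) m = concatMap-unique (λ w → map (_∷ w) (letters m)) tail (words-unique n m)
    (λ _ → Uniqueₚ.map⁺ ∷-injectiveˡ (letters-unique m)) retract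
  where
  tail : List ℕ → List ℕ
  tail [] = []
  tail (x ∷ w) = w
  retract : ∀ {w v} → w ∈ words n m → v ∈ map (_∷ w) (letters m) → tail v ≡ w
  retract {w} w∈ v∈ with ∈-map⁻ (_∷ w) v∈
  ... | x , _ , refl = refl

occ-∉ : ∀ {x} w → x ∉ w → occ x w ≡ 0
occ-∉ [] x∉ = refl
occ-∉ (y ∷ w) x∉ = trans (occ-≢ w (λ e → x∉ (here (sym e)))) (occ-∉ w (x∉ ∘ there))

occ-∈ : ∀ {x} w → occ x w ≢ 0 → x ∈ w
occ-∈ [] ne = ⊥-elim (ne refl)
occ-∈ {x} (y ∷ w) ne with y ℕ.≟ x
... | yes refl = here refl
... | no y≢x = there (occ-∈ w (ne ∘ trans (occ-≢ w y≢x)))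

occ-↭ : ∀ v w → (∀ x → occ x v ≡ occ x w) → v ↭ w
occ-↭ [] [] h = refl
occ-↭ [] (y ∷ w) h with trans (h y) (occ-≡ y w)
... | ()
occ-↭ (x ∷ v) w h with ∈-∃++ (occ-∈ {x} w (λ e → ℕₚ.1+n≢0 (trans (sym (occ-≡ x v)) (trans (h x) e))))
... | as , bs , refl = trans↭ (prep x (occ-↭ v (as ++ bs) rest)) (↭-sym (shift x as bs))
  where
  rest : ∀ y → occ y v ≡ occ y (as ++ bs)
  rest y with x ℕ.≟ y
  ... | yes refl = suc-injective (trans (sym (occ-≡ x v)) (trans (h x) (trans (countᵇ-↭ (_≡ᵇ x) (shift x as bs)) (occ-≡ x (as ++ bs)))))
  ... | no x≢y = trans (sym (occ-≢ v x≢y)) (trans (h y) (trans (countᵇ-↭ (_≡ᵇ y) (shift x as bs)) (occ-≢ (as ++ bs) x≢y)))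

countᵇ-none : ∀ {A : Set} {p : A → Bool} xs → (∀ {x} → x ∈ xs → p x ≡ false) → countᵇ p xs ≡ 0
countᵇ-none [] h = refl
countᵇ-none (x ∷ xs) h rewrite h (here refl) = countᵇ-none xs (h ∘ there)

-- Together with `≤-at` this locates a value in a sorted list: `v` occupies the indices from the
-- number of entries below `v` up to, but excluding, the number of entries at most `v`.
at-≤ : ∀ {ms} → AllPairs _≤_ ms → ∀ v q → q < countᵇ (_≤ᵇ v) ms → at ms q ≤ v
at-≤ [] v q ()
at-≤ {x ∷ ms} (le ∷ s) v q lt with x ℕ.≤? v
at-≤ {x ∷ ms} (le ∷ s) v zero lt | yes x≤v = x≤v
at-≤ {x ∷ ms} (le ∷ s) v (suc q) lt | yes x≤v rewrite ≤⇒≤ᵇ-true x≤v = at-≤ s v q (≤-pred lt)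
at-≤ {x ∷ ms} (le ∷ s) v q lt | no x≰v = ⊥-elim (ℕₚ.n≮0 (subst (q <_) none lt))
  where
  above : ∀ {y} → v < y → (y ≤ᵇ v) ≡ false
  above {y} v<y with y ≤ᵇ v in e
  ... | true = ⊥-elim (<⇒≱ v<y (≤ᵇ-true e))
  ... | false = refl
  none : countᵇ (_≤ᵇ v) (x ∷ ms) ≡ 0
  none = countᵇ-none (x ∷ ms) λ { (here refl) → above (≰⇒> x≰v) ; (there y∈) → above (<-≤-trans (≰⇒> x≰v) (All.lookup le y∈)) }

≤-at : ∀ {ms} → AllPairs _≤_ ms → ∀ v q → countᵇ (_<ᵇ v) ms ≤ q → q < length ms → v ≤ at ms q
≤-at {x ∷ ms} (le ∷ s) v q h lt with x ℕ.<? v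
≤-at {x ∷ ms} (le ∷ s) v zero h lt | yes x<v rewrite <⇒<ᵇ-true x<v = ⊥-elim (ℕₚ.n≮0 h)
≤-at {x ∷ ms} (le ∷ s) v (suc q) h (s≤s lt) | yes x<v rewrite <⇒<ᵇ-true x<v = ≤-at s v q (≤-pred h) lt
≤-at {x ∷ ms} (le ∷ s) v zero h lt | no x≮v = ≮⇒≥ x≮v
≤-at {x ∷ ms} (le ∷ s) v (suc q) h (s≤s lt) | no x≮v = ≤-trans (≮⇒≥ x≮v) (All.lookup le (at-∈ ms lt))

at-mono : ∀ {ms} → AllPairs _≤_ ms → ∀ {j k} → j ≤ k → k < length ms → at ms j ≤ at ms k
at-mono {x ∷ ms} (le ∷ s) {zero} {zero} jk lt = ≤-refl
at-mono {x ∷ ms} (le ∷ s) {zero} {suc k} jk (s≤s lt) = All.lookup le (at-∈ ms lt)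
at-mono {x ∷ ms} (le ∷ s) {suc j} {suc k} (s≤s jk) (s≤s lt) = at-mono s jk lt

∈-≤-maxL : ∀ {ms x} → x ∈ ms → x ≤ maxL ms
∈-≤-maxL {y ∷ ms} (here refl) = ℕₚ.m≤m⊔n y (maxL ms)
∈-≤-maxL {y ∷ ms} (there x∈) = ≤-trans (∈-≤-maxL x∈) (ℕₚ.m≤n⊔m y (maxL ms))

countᵇ-<-upTo : ∀ n a → a ≤ n → countᵇ (_<ᵇ a) (upTo n) ≡ a
countᵇ-<-upTo n zero le = countᵇ-none (upTo n) (λ {x} _ → ≮⇒<ᵇ-false {x} z≤n)
countᵇ-<-upTo (suc n) (suc a) (s≤s le) = cong suc (begin
  countᵇ (_<ᵇ suc a) (applyUpTo suc n) ≡⟨ cong (countᵇ (_<ᵇ suc a)) (sym (map-upTo suc n)) ⟩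
  countᵇ (_<ᵇ suc a) (map suc (upTo n)) ≡⟨ countᵇ-map (_<ᵇ suc a) suc (upTo n) ⟩
  countᵇ (_<ᵇ a) (upTo n) ≡⟨ countᵇ-<-upTo n a le ⟩
  a ∎)
  where open ≡-Reasoning

countᵇ-<-letters : ∀ n {a} → 1 ≤ a → a ≤ n → countᵇ (_<ᵇ a) (letters n) ≡ a ∸ 1
countᵇ-<-letters n {suc a} l u = trans (countᵇ-map (_<ᵇ suc a) suc (upTo n)) (countᵇ-<-upTo n a (<⇒≤ u))

sum-indicator : ∀ {A : Set} (p : A → Bool) xs → sum (map (λ x → if p x then 1 else 0) xs) ≡ countᵇ p xs
sum-indicator p [] = refl
sum-indicator p (x ∷ xs) with p x
... | true = cong suc (sum-indicator p xs)
... | false = sum-indicator p xs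

module _ {C : Set} where

  zip-proj₁ : ∀ (cs : List C) (w : List ℕ) → length cs ≡ length w → map proj₁ (zip cs w) ≡ cs
  zip-proj₁ [] [] l = refl
  zip-proj₁ (c ∷ cs) (x ∷ w) l = cong (c ∷_) (zip-proj₁ cs w (suc-injective l))

  zip-map-zip : ∀ (f : C × ℕ → ℕ) (cs : List C) w {c b} → (c , b) ∈ zip cs (map f (zip cs w)) →
                Σ ℕ λ v → (c , v) ∈ zip cs w × b ≡ f (c , v)
  zip-map-zip f (c ∷ cs) (x ∷ w) (here refl) = x , here refl , refl
  zip-map-zip f (c ∷ cs) (x ∷ w) (there i) = let v , j , e = zip-map-zip f cs w i in v , there j , e

  zip-mapʳ : ∀ (h : ℕ → ℕ) (cs : List C) w → zip cs (map h w) ≡ map (λ x → proj₁ x , h (proj₂ x)) (zip cs w)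
  zip-mapʳ h [] w = refl
  zip-mapʳ h (c ∷ cs) [] = refl
  zip-mapʳ h (c ∷ cs) (x ∷ w) = cong ((c , h x) ∷_) (zip-mapʳ h cs w)

-- The order in which standardization numbers the entries.
Before : Cell × ℕ → Cell × ℕ → Set
Before ((_ , c) , v) ((_ , c') , v') = v < v' ⊎ (v ≡ v' × c < c')

beforeᵇ : Cell × ℕ → Cell × ℕ → Bool
beforeᵇ ((_ , c) , v) ((_ , c') , v') = (v <ᵇ v') ∨ ((v ≡ᵇ v') ∧ (c <ᵇ c'))

beforeᵇ⁻ : ∀ x y → beforeᵇ x y ≡ true → Before x y
beforeᵇ⁻ ((_ , c) , v) ((_ , c') , v') e with v <ᵇ v' in e₁
... | true = inj₁ (<ᵇ-true e₁)
... | false = let p , q = ∧-true⁻ {v ≡ᵇ v'} e in inj₂ (≡ᵇ-true p , <ᵇ-true q)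

beforeᵇ⁺ : ∀ x y → Before x y → beforeᵇ x y ≡ true
beforeᵇ⁺ x y (inj₁ lt) rewrite <⇒<ᵇ-true lt = refl
beforeᵇ⁺ ((_ , c) , v) (_ , .v) (inj₂ (refl , lt)) rewrite ≮⇒<ᵇ-false {v} {v} ≤-refl | ≡ᵇ-refl v = <⇒<ᵇ-true lt

Before-irrefl : ∀ x → ¬ Before x x
Before-irrefl x (inj₁ lt) = <-irrefl refl lt
Before-irrefl x (inj₂ (_ , lt)) = <-irrefl refl lt

Before-trans : ∀ x y z → Before x y → Before y z → Before x z
Before-trans x y z (inj₁ a) (inj₁ b) = inj₁ (<-trans a b)
Before-trans x y z (inj₁ a) (inj₂ (refl , _)) = inj₁ a
Before-trans x y z (inj₂ (refl , _)) (inj₁ b) = inj₁ b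
Before-trans x y z (inj₂ (refl , a)) (inj₂ (refl , b)) = inj₂ (refl , <-trans a b)

beforeᵇ-irrefl : ∀ x → beforeᵇ x x ≡ false
beforeᵇ-irrefl x with beforeᵇ x x in e
... | true = ⊥-elim (Before-irrefl x (beforeᵇ⁻ x x e))
... | false = refl

-- Tableaux of a fixed partition shape and their order.

module Shape (n : ℕ) (sh : List ℕ) (part : IsPartition sh n) where

  decreasing : Linked (λ a b → b ≤ a) sh
  decreasing = proj₁ (proj₂ part)

  cells-unique : Unique (cells sh)
  cells-unique = cellsFrom-unique 0 sh

  length-cells : length (cells sh) ≡ n
  length-cells = trans (length-cellsFrom 0 sh) (proj₂ (proj₂ part))

  -- The weakly decreasing row lengths enter through this closure. It supplies the cell below a
  -- given one and the corner cells through which letters are compared.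
  cells-closed : ∀ {r r' c c'} → (r' , c') ∈ cells sh → r ≤ r' → c ≤ c' → (r , c) ∈ cells sh
  cells-closed x∈ r≤ c≤ = ∈-cells⁺ sh (≤-<-trans c≤ (<-≤-trans (∈-cells⁻ sh x∈) (at-antitone decreasing r≤)))

  Filling : List ℕ → Set
  Filling w = w ↭ letters n

  _∋_⟨_⟩ : List ℕ → Cell → ℕ → Set
  w ∋ c ⟨ a ⟩ = (c , a) ∈ filled sh w

  row col : List ℕ → ℕ → ℕ
  row w a = proj₁ (cellOf sh w a)
  col w a = proj₂ (cellOf sh w a)

  module _ {w : List ℕ} (fw : Filling w) where

    filling-unique : Unique w
    filling-unique = unique-resp-↭ (↭-sym fw) (letters-unique n)

    filling-length : length (cells sh) ≡ length w
    filling-length = trans length-cells (sym (trans (↭-length fw) (length-letters n)))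

    cellOf-∋ : ∀ {c a} → w ∋ c ⟨ a ⟩ → cellOf sh w a ≡ c
    cellOf-∋ = cellOfL-∈ filling-unique

    ∋-cellOf : ∀ {a} → 1 ≤ a → a ≤ n → w ∋ cellOf sh w a ⟨ a ⟩
    ∋-cellOf l u with zip-coverʳ filling-length (∈-resp-↭ (↭-sym fw) (∈-letters⁺ l u))
    ... | c , i = subst (w ∋_⟨ _ ⟩) (sym (cellOf-∋ i)) i

    ∋-letter : ∀ {c a} → w ∋ c ⟨ a ⟩ → 1 ≤ a × a ≤ n
    ∋-letter i = ∈-letters⁻ (∈-resp-↭ fw (zip-∈ʳ i))

    ∋-entry : ∀ {c} → c ∈ cells sh → Σ ℕ λ a → w ∋ c ⟨ a ⟩
    ∋-entry = zip-coverˡ filling-length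

    cellOf-∉ : ∀ {a} → ¬ (1 ≤ a × a ≤ n) → cellOf sh w a ≡ (0 , 0)
    cellOf-∉ a∉ = cellOfL-∉ {cells sh} {w} (λ a∈ → a∉ (∈-letters⁻ (∈-resp-↭ fw a∈)))

    -- `key-<` wants a bound at every number. Outside the letters `cellOf` returns row 0, which for
    -- the empty shape is not below `length sh`; hence the successor.
    row-bound : ∀ a → row w a < suc (length sh)
    row-bound a with 1 ℕ.≤? a | a ℕ.≤? n
    ... | yes l | yes u = m<n⇒m<1+n (at-positive sh (∈-cells⁻ sh (zip-∈ˡ (∋-cellOf l u))))
    ... | no nl | _ rewrite cellOf-∉ {a} (nl ∘ proj₁) = s≤s z≤n
    ... | yes _ | no nu rewrite cellOf-∉ {a} (nu ∘ proj₂) = s≤s z≤n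

  SYT ColPerms : List (List ℕ)
  SYT = syt sh n
  ColPerms = colPerms sh n

  RowIncreasing ColIncreasing : List ℕ → Set
  RowIncreasing w = ∀ {r c c' a b} → w ∋ (r , c) ⟨ a ⟩ → w ∋ (r , c') ⟨ b ⟩ → c < c' → a < b
  ColIncreasing w = ∀ {r r' c a b} → w ∋ (r , c) ⟨ a ⟩ → w ∋ (r' , c) ⟨ b ⟩ → r < r' → a < b

  Standard : List ℕ → Set
  Standard w = RowIncreasing w × ColIncreasing w

  imply⁻ : ∀ {a b} → not a ∨ b ≡ true → a ≡ true → b ≡ true
  imply⁻ e refl = e

  imply⁺ : ∀ {a b} → (a ≡ true → b ≡ true) → not a ∨ b ≡ true
  imply⁺ {true} h = h refl
  imply⁺ {false} h = refl

  standard⁻ : ∀ {w} → standardShapeᵇ sh w ≡ true → Standard w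
  standard⁻ {w} e =
    (λ {r} {c} {c'} i j lt → <ᵇ-true (imply⁻ (proj₁ (∧-true⁻ (allᵇ⁻ (allᵇ⁻ e i) j))) (cong₂ _∧_ (≡ᵇ-refl r) (<⇒<ᵇ-true lt)))) ,
    (λ {r} {r'} {c} i j lt → <ᵇ-true (imply⁻ (proj₂ (∧-true⁻ {not ((r ≡ᵇ r') ∧ _) ∨ _} (allᵇ⁻ (allᵇ⁻ e i) j))) (cong₂ _∧_ (≡ᵇ-refl c) (<⇒<ᵇ-true lt))))

  standard⁺ : ∀ {w} → Standard w → standardShapeᵇ sh w ≡ true
  standard⁺ {w} (ri , ci) = allᵇ⁺ (filled sh w) (λ { {(r , c) , a} i → allᵇ⁺ (filled sh w) (λ { {(r' , c') , b} j →
    cong₂ _∧_ (imply⁺ {(r ≡ᵇ r') ∧ (c <ᵇ c')} (λ e → let p , q = ∧-true⁻ {r ≡ᵇ r'} e in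
                 <⇒<ᵇ-true (ri i (subst (λ t → w ∋ (t , c') ⟨ b ⟩) (sym (≡ᵇ-true p)) j) (<ᵇ-true q))))
              (imply⁺ {(c ≡ᵇ c') ∧ (r <ᵇ r')} (λ e → let p , q = ∧-true⁻ {c ≡ᵇ c'} e in
                 <⇒<ᵇ-true (ci i (subst (λ t → w ∋ (r' , t) ⟨ b ⟩) (sym (≡ᵇ-true p)) j) (<ᵇ-true q)))) }) })

  ∈-syt⁻ : ∀ {w} → w ∈ SYT → Filling w × Standard w
  ∈-syt⁻ w∈ = let i , s = ∈-filterᵇ⁻ (standardShapeᵇ sh) (perms (letters n)) w∈ in ∈-perms⁻ (letters n) i , standard⁻ s

  ∈-syt⁺ : ∀ {w} → Filling w → Standard w → w ∈ SYT
  ∈-syt⁺ fw sw = ∈-filterᵇ⁺ (standardShapeᵇ sh) (∈-perms⁺ (letters n) fw) (standard⁺ sw)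

  syt-unique : Unique SYT
  syt-unique = filterᵇ-unique (standardShapeᵇ sh) (perms-unique (letters-unique n))

  -- The rows of the letters 1, ..., `n` compared lexicographically. It depends on the tabloid only,
  -- so it also compares fillings that are not standard.
  rank : List ℕ → ℕ
  rank w = key (suc (length sh)) (row w) n

  -- If `a` were further west in `S`, the cell that it occupies there would hold a smaller letter
  -- `b` in `T`. By the agreement below `a`, that cell would hold `b` in `S` too.
  no-earlier-column : ∀ {S T a} → Filling S → Filling T → RowIncreasing T → 1 ≤ a → a ≤ n →
    (∀ b → 1 ≤ b → b < a → cellOf sh S b ≡ cellOf sh T b) → row S a ≡ row T a → ¬ col S a < col T a
  no-earlier-column {S} {T} {a} fS fT rT l u pre er lt
    with ∋-entry fT (zip-∈ˡ (∋-cellOf fS l u))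
  ... | b , i = <-irrefl (zip-uniqueˡ cells-unique at-b (∋-cellOf fS l u)) b<a
    where
    b<a : b < a
    b<a = rT (subst (λ r → T ∋ (r , col S a) ⟨ b ⟩) er i) (∋-cellOf fT l u) lt
    lu = ∋-letter fT i
    at-b : S ∋ cellOf sh S a ⟨ b ⟩
    at-b = subst (S ∋_⟨ b ⟩) (trans (pre b (proj₁ lu) b<a) (cellOf-∋ fT i)) (∋-cellOf fS (proj₁ lu) (proj₂ lu))

  row-determines-cell : ∀ {S T a} → Filling S → RowIncreasing S → Filling T → RowIncreasing T → 1 ≤ a → a ≤ n →
    (∀ b → 1 ≤ b → b < a → cellOf sh S b ≡ cellOf sh T b) → row S a ≡ row T a → cellOf sh S a ≡ cellOf sh T a
  row-determines-cell {S} {T} {a} fS rS fT rT l u pre er with <-cmp (col S a) (col T a)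
  ... | tri< lt _ _ = ⊥-elim (no-earlier-column fS fT rT l u pre er lt)
  ... | tri≈ _ e _ = cong₂ _,_ er e
  ... | tri> _ _ gt = ⊥-elim (no-earlier-column fT fS rS l u (λ b l lt → sym (pre b l lt)) (sym er) gt)

  rows-determine-cells : ∀ {S T} → Filling S → RowIncreasing S → Filling T → RowIncreasing T →
    (∀ a → 1 ≤ a → a ≤ n → row S a ≡ row T a) → ∀ a → 1 ≤ a → a ≤ n → cellOf sh S a ≡ cellOf sh T a
  rows-determine-cells {S} {T} fS rS fT rT er a l u = go (suc a) a ≤-refl l u
    where
    go : ∀ k a → a < k → 1 ≤ a → a ≤ n → cellOf sh S a ≡ cellOf sh T a
    go (suc k) a (s≤s le) l u = row-determines-cell fS rS fT rT l u
      (λ b l' lt → go k b (<-≤-trans lt le) l' (≤-trans (<⇒≤ lt) u)) (er a l u)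

  cells-determine : ∀ {S T} → Filling S → Filling T → (∀ a → 1 ≤ a → a ≤ n → cellOf sh S a ≡ cellOf sh T a) → S ≡ T
  cells-determine {S} {T} fS fT e = zip-ext cells-unique (filling-length fS) (filling-length fT) move
    where
    move : ∀ {c a} → S ∋ c ⟨ a ⟩ → T ∋ c ⟨ a ⟩
    move {c} {a} i = let l , u = ∋-letter fS i in
      subst (T ∋_⟨ a ⟩) (trans (sym (e a l u)) (cellOf-∋ fS i)) (∋-cellOf fT l u)

  rank-injective : ∀ {S T} → S ∈ SYT → T ∈ SYT → rank S ≡ rank T → S ≡ T
  rank-injective {S} {T} S∈ T∈ e with ∈-syt⁻ S∈ | ∈-syt⁻ T∈ | first-difference (row S) (row T) n
  ... | fS , rS , _ | fT , rT , _ | inj₁ same = cells-determine fS fT (rows-determine-cells fS rS fT rT same)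
  ... | fS , _ | fT , _ | inj₂ (a , l , u , pre , ne) with <-cmp (row S a) (row T a)
  ...   | tri< lt _ _ = ⊥-elim (<-irrefl e (key-< _ n a (row-bound fS) l u pre lt))
  ...   | tri≈ _ e' _ = ⊥-elim (ne e')
  ...   | tri> _ _ gt = ⊥-elim (<-irrefl (sym e) (key-< _ n a (row-bound fT) l u (λ b l lt → sym (pre b l lt)) gt))

  -- At the first letter in different positions the rows must differ, since equal rows would force
  -- equal cells by `row-determines-cell`. So the weak inequality of rows in ◁ is strict.
  ◁⇒rank-< : ∀ {S T} → S ∈ SYT → T ∈ SYT → S ◁[ sh ] T → rank S < rank T
  ◁⇒rank-< {S} {T} S∈ T∈ (a , l , pre , ne , r≤ , _) with ∈-syt⁻ S∈ | ∈-syt⁻ T∈ | a ℕ.≤? n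
  ... | fS , rS , _ | fT , rT , _ | no nu = ⊥-elim (ne (trans (cellOf-∉ fS (nu ∘ proj₂)) (sym (cellOf-∉ fT (nu ∘ proj₂)))))
  ... | fS , rS , _ | fT , rT , _ | yes u with m≤n⇒m<n∨m≡n r≤
  ...   | inj₁ lt = key-< _ n a (row-bound fS) l u (λ b l lt → cong proj₁ (pre b l lt)) lt
  ...   | inj₂ e = ⊥-elim (ne (row-determines-cell fS rS fT rT l u pre e))

  -- Polytabloids

  tab : List ℕ → List ℕ
  tab = tabloid sh n

  length-tab : ∀ w → length (tab w) ≡ n
  length-tab w = trans (length-map _ (letters n)) (length-letters n)

  tab-row : ∀ {v w} → tab v ≡ tab w → ∀ a → 1 ≤ a → a ≤ n → row v a ≡ row w a
  tab-row e a l u = map-injective-∈ (letters n) e (∈-letters⁺ l u)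

  tab-cong : ∀ {v w} → (∀ a → 1 ≤ a → a ≤ n → row v a ≡ row w a) → tab v ≡ tab w
  tab-cong h = map-cong-∈ (letters n) (λ a∈ → let l , u = ∈-letters⁻ a∈ in h _ l u)

  at-tab : ∀ w {k} → k < n → at (tab w) k ≡ row w (suc k)
  at-tab w {k} lt = trans (at-map _ (letters n) (subst (k <_) (sym (length-letters n)) lt)) (cong (row w) (at-letters lt))

  columnOf : ℕ → ℕ
  columnOf k = proj₂ (cellAt sh k)

  ColumnPreserving : List ℕ → Set
  ColumnPreserving p = p ↭ upTo n × (∀ {c k} → (c , k) ∈ zip (cells sh) p → columnOf k ≡ proj₂ c)

  ∈-colPerms⁻ : ∀ {p} → p ∈ ColPerms → ColumnPreserving p
  ∈-colPerms⁻ {p} p∈ = let i , e = ∈-filterᵇ⁻ _ (perms (upTo n)) p∈ in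
    ∈-perms⁻ (upTo n) i , (λ j → ≡ᵇ-true (allᵇ⁻ e j))

  ∈-colPerms⁺ : ∀ {p} → ColumnPreserving p → p ∈ ColPerms
  ∈-colPerms⁺ {p} (r , h) = ∈-filterᵇ⁺ _ (∈-perms⁺ (upTo n) r)
    (allᵇ⁺ (zip (cells sh) p) (λ {ck} i → subst (λ t → (columnOf (proj₂ ck) ≡ᵇ t) ≡ true) (h i) (≡ᵇ-refl (columnOf (proj₂ ck)))))

  colPerms-unique : Unique ColPerms
  colPerms-unique = filterᵇ-unique _ (perms-unique (Uniqueₚ.upTo⁺ n))

  upTo∈colPerms : upTo n ∈ ColPerms
  upTo∈colPerms = ∈-colPerms⁺ (refl , same)
    where
    same : ∀ {c k} → (c , k) ∈ zip (cells sh) (upTo n) → columnOf k ≡ proj₂ c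
    same i with zip-index i
    ... | k , lt , lt' , refl , refl =
      cong columnOf (at-applyUpTo n id (subst (k <_) length-cells lt))

  module _ {p} (p∈ : p ∈ ColPerms) where

    colPerm-unique : Unique p
    colPerm-unique = unique-resp-↭ (↭-sym (proj₁ (∈-colPerms⁻ p∈))) (Uniqueₚ.upTo⁺ n)

    colPerm-length : length p ≡ n
    colPerm-length = trans (↭-length (proj₁ (∈-colPerms⁻ p∈))) (length-upTo n)

    ∈-colPerm⁺ : ∀ {k} → k < n → k ∈ p
    ∈-colPerm⁺ lt = ∈-resp-↭ (↭-sym (proj₁ (∈-colPerms⁻ p∈))) (∈-upTo⁺ lt)

    ∈-colPerm⁻ : ∀ {k} → k ∈ p → k < n
    ∈-colPerm⁻ k∈ = ∈-upTo⁻ (∈-resp-↭ (proj₁ (∈-colPerms⁻ p∈)) k∈)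

    map-tr-∈colPerms : ∀ {x y} → x < n → y < n → columnOf x ≡ columnOf y → map (tr x y) p ∈ ColPerms
    map-tr-∈colPerms {x} {y} lx ly e =
      ∈-colPerms⁺ (trans↭ (map-tr-↭ colPerm-unique (∈-colPerm⁺ lx) (∈-colPerm⁺ ly)) (proj₁ (∈-colPerms⁻ p∈)) , same)
      where
      same : ∀ {c k} → (c , k) ∈ zip (cells sh) (map (tr x y) p) → columnOf k ≡ proj₂ c
      same i with zip-map⁻ (tr x y) i
      ... | j , refl , i' with tr-view x y j
      ... | is-left refl e' = trans (cong columnOf e') (trans (sym e) (proj₂ (∈-colPerms⁻ p∈) i'))
      ... | is-right refl e' = trans (cong columnOf e') (trans e (proj₂ (∈-colPerms⁻ p∈) i'))
      ... | is-other _ _ e' = trans (cong columnOf e') (proj₂ (∈-colPerms⁻ p∈) i')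

    module _ {w} (fw : Filling w) where

      permute-filling : Filling (permute w p)
      permute-filling = trans↭ (subst (map (at w) p ↭_)
        (trans (cong (map (at w) ∘ upTo) (sym (trans (↭-length fw) (length-letters n)))) (map-at-upTo w))
        (↭ₚ.map⁺ (at w) (proj₁ (∈-colPerms⁻ p∈)))) fw

  module _ {w} (fw : Filling w) where

    length-filling : length w ≡ n
    length-filling = trans (↭-length fw) (length-letters n)

    ∋-at : ∀ {k} → k < n → w ∋ cellAt sh k ⟨ at w k ⟩
    ∋-at {k} lt = zip-at (subst (k <_) (sym length-cells) lt) (filling-length fw)

    ∋-index : ∀ {a} → 1 ≤ a → a ≤ n → Σ ℕ λ k → k < n × at w k ≡ a × cellAt sh k ≡ cellOf sh w a
    ∋-index l u with ∈-at (∈-resp-↭ (↭-sym fw) (∈-letters⁺ l u))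
    ... | k , lt , refl = k , lt' , refl , sym (cellOf-∋ fw (∋-at lt'))
      where
      lt' : k < n
      lt' = subst (k <_) length-filling lt

    permute-columns : ∀ {p} → p ∈ ColPerms → ∀ {c a} → permute w p ∋ c ⟨ a ⟩ → col w a ≡ proj₂ c
    permute-columns p∈ i with zip-map⁻ (at w) i
    ... | k , refl , j = trans (cong proj₂ (cellOf-∋ fw (∋-at (∈-colPerm⁻ p∈ (zip-∈ʳ j))))) (proj₂ (∈-colPerms⁻ p∈) j)

    -- Let `a` be the first letter whose row changes; columns do not change. If `a` moved down, its
    -- new cell would hold in `w` a letter `b < a`, and `b`, having kept its cell, would still be
    -- there. So `a` moves up and the rank grows.
    permute-rank : ColIncreasing w → ∀ {p} → p ∈ ColPerms →
      (∀ a → 1 ≤ a → a ≤ n → row w a ≡ row (permute w p) a) ⊎ rank w < rank (permute w p)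
    permute-rank cw {p} p∈ with first-difference (row w) (row (permute w p)) n
    ... | inj₁ same = inj₁ same
    ... | inj₂ (a , l , u , pre , ne) = inj₂ (key-< _ n a (row-bound fw) l u pre up)
      where
      v = permute w p
      fv : Filling v
      fv = permute-filling p∈ fw
      same-col : ∀ b → 1 ≤ b → b ≤ n → col w b ≡ col v b
      same-col b l u = permute-columns p∈ (∋-cellOf fv l u)
      up : row w a < row v a
      up with <-cmp (row w a) (row v a)
      ... | tri< lt _ _ = lt
      ... | tri≈ _ e _ = ⊥-elim (ne e)
      ... | tri> _ _ gt = ⊥-elim (<-irrefl (sym (zip-uniqueˡ cells-unique (∋-cellOf fv l u) at-b)) b<a)
        where
        below = ∋-entry fw (zip-∈ˡ (∋-cellOf fv l u))
        b = proj₁ below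
        lu = ∋-letter fw (proj₂ below)
        b<a : b < a
        b<a = cw (subst (λ c → w ∋ (row v a , c) ⟨ b ⟩) (sym (same-col a l u)) (proj₂ below)) (∋-cellOf fw l u) gt
        at-b : v ∋ cellOf sh v a ⟨ b ⟩
        at-b = subst (v ∋_⟨ b ⟩)
          (trans (cong₂ _,_ (sym (pre b (proj₁ lu) b<a)) (sym (same-col b (proj₁ lu) (proj₂ lu)))) (cellOf-∋ fw (proj₂ below)))
          (∋-cellOf fv (proj₁ lu) (proj₂ lu))

    permute-rows-fixed : ∀ {p} → p ∈ ColPerms → (∀ a → 1 ≤ a → a ≤ n → row w a ≡ row (permute w p) a) → p ≡ upTo n
    permute-rows-fixed {p} p∈ same = map-cancel-∈ p (upTo n) inj
        (trans (sym w≡v) (trans (sym (map-at-upTo w)) (cong (map (at w) ∘ upTo) length-filling)))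
      where
      w≡v : w ≡ permute w p
      w≡v = cells-determine fw (permute-filling p∈ fw) (λ a l u →
        cong₂ _,_ (same a l u) (permute-columns p∈ (∋-cellOf (permute-filling p∈ fw) l u)))
      inj : ∀ {x y} → x ∈ p → y ∈ upTo n → at w x ≡ at w y → x ≡ y
      inj {x} {y} x∈ y∈ = at-injective (filling-unique fw) (subst (x <_) (sym length-filling) (∈-colPerm⁻ p∈ x∈))
        (subst (y <_) (sym length-filling) (∈-upTo⁻ y∈))

  term : List ℕ → List ℕ → List ℕ → ℚ
  term w τ p = if eqListᵇ (tab (permute w p)) τ then sgn p else 0ℚ

  term-≡ : ∀ w {τ p} → tab (permute w p) ≡ τ → term w τ p ≡ sgn p
  term-≡ w {p = p} refl rewrite eqListᵇ-refl (tab (permute w p)) = refl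

  term-≢ : ∀ w {τ p} → tab (permute w p) ≢ τ → term w τ p ≡ 0ℚ
  term-≢ w ne rewrite eqListᵇ-false ne = refl

  poly-support : ∀ w τ → (∀ {p} → p ∈ ColPerms → tab (permute w p) ≢ τ) → poly sh n w τ ≡ 0ℚ
  poly-support w τ h = ∑-zero ColPerms (λ p∈ → term-≢ w (h p∈))

  poly-length : ∀ w τ → length τ ≢ n → poly sh n w τ ≡ 0ℚ
  poly-length w τ ne = poly-support w τ (λ {p} _ e → ne (trans (cong length (sym e)) (length-tab (permute w p))))

  -- By `permute-rows-fixed` the identity alone preserves the tabloid, so one term survives. With
  -- `poly-below` this is the unitriangularity of polytabloids, in a form that covers `sᵢT` as well.
  poly-leading : ∀ {w} → Filling w → ColIncreasing w → poly sh n w (tab w) ≡ 1ℚ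
  poly-leading {w} fw cw = trans (∑-single (term w (tab w)) colPerms-unique upTo∈colPerms other)
      (trans (term-≡ w (cong tab permute-upTo)) (sgn-upTo n))
    where
    permute-upTo : permute w (upTo n) ≡ w
    permute-upTo = trans (cong (map (at w) ∘ upTo) (sym (length-filling fw))) (map-at-upTo w)
    other : ∀ {p} → p ∈ ColPerms → p ≢ upTo n → term w (tab w) p ≡ 0ℚ
    other p∈ ne = term-≢ w (λ e → ne (permute-rows-fixed fw p∈ (tab-row (sym e))))

  poly-below : ∀ {w S} → Filling w → ColIncreasing w → rank S < rank w → poly sh n w (tab S) ≡ 0ℚ
  poly-below {w} {S} fw cw lt = poly-support w (tab S) excl
    where
    excl : ∀ {p} → p ∈ ColPerms → tab (permute w p) ≢ tab S
    excl {p} p∈ e with permute-rank fw cw p∈ | key-cong (suc (length sh)) n (tab-row {permute w p} {S} e)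
    ... | inj₁ same | ek = <-irrefl (trans (sym ek) (sym (key-cong _ n same))) lt
    ... | inj₂ lt' | ek = <-asym lt (subst (rank w <_) ek lt')

  ∑-colPerms-tr : ∀ {x y} → x < n → y < n → columnOf x ≡ columnOf y → (f : List ℕ → ℚ) →
                  ∑ ColPerms (f ∘ map (tr x y)) ≡ ∑ ColPerms f
  ∑-colPerms-tr {x} {y} lx ly e f = ∑-reindex (map (tr x y)) f colPerms-unique
    (λ p∈ → map-tr-∈colPerms p∈ lx ly e) (λ {p} _ → map-tr-involutive x y p)

  sgn-colPerm-tr : ∀ {x y p} → p ∈ ColPerms → x < n → y < n → x ≢ y → sgn (map (tr x y) p) ≡ - sgn p
  sgn-colPerm-tr p∈ lx ly = sgn-map-tr (colPerm-unique p∈) (∈-colPerm⁺ p∈ lx) (∈-colPerm⁺ p∈ ly)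

  -- Exchanging the letters amounts to composing each column permutation with the transposition of
  -- their positions. This permutes the column group and reverses every sign.
  poly-exchange : ∀ {w a b} → Filling w → 1 ≤ a → a ≤ n → 1 ≤ b → b ≤ n → a ≢ b → col w a ≡ col w b →
                  poly sh n (map (tr a b) w) ≈ᵥ negᵥ (poly sh n w)
  poly-exchange {w} {a} {b} fw la ua lb ub ne e τ with ∋-index fw la ua | ∋-index fw lb ub
  ... | x , lx , refl , cx | y , ly , refl , cy =
    trans (∑-cong ColPerms termwise)
    (trans (∑-neg ColPerms (term w τ ∘ map (tr x y)))
      (cong -_ (∑-colPerms-tr lx ly (trans (cong proj₂ cx) (trans e (sym (cong proj₂ cy)))) (term w τ))))
    where
    x≢y : x ≢ y
    x≢y x≡y = ne (cong (at w) x≡y)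
    bound : ∀ {k} → k < n → k < length w
    bound {k} = subst (k <_) (sym (length-filling fw))
    commute : ∀ {k} → k < n → tr (at w x) (at w y) (at w k) ≡ at w (tr x y k)
    commute {k} lk with tr-view x y k
    ... | is-left refl t = trans (tr-left (at w x) (at w y)) (cong (at w) (sym t))
    ... | is-right refl t = trans (tr-right (at w x) (at w y)) (cong (at w) (sym t))
    ... | is-other k≢x k≢y t = trans (tr-other (k≢x ∘ at-injective (filling-unique fw) (bound lk) (bound lx))
                                               (k≢y ∘ at-injective (filling-unique fw) (bound lk) (bound ly)))
                                 (cong (at w) (sym t))
    permuted : ∀ {p} → p ∈ ColPerms → permute (map (tr (at w x) (at w y)) w) p ≡ permute w (map (tr x y) p)
    permuted {p} p∈ = trans (map-cong-∈ p (λ k∈ → let lk = ∈-colPerm⁻ p∈ k∈ in trans (at-map _ w (bound lk)) (commute lk)))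
                        (map-∘ p)
    termwise : ∀ {p} → p ∈ ColPerms → term (map (tr (at w x) (at w y)) w) τ p ≡ - term w τ (map (tr x y) p)
    termwise {p} p∈ rewrite permuted p∈ with eqListᵇ (tab (permute w (map (tr x y) p))) τ
    ... | true = neg-flip (sgn-colPerm-tr p∈ lx ly x≢y)
    ... | false = refl

  -- Simple transpositions on fillings, tabloids and polytabloids.

  sw : ℕ → List ℕ → List ℕ
  sw i = map (tr i (suc i))

  sw-filling : ∀ {i w} → 1 ≤ i → i < n → Filling w → Filling (sw i w)
  sw-filling {i} {w} l u fw = trans↭ (map-tr-↭ (filling-unique fw) (mem l (<⇒≤ u)) (mem (s≤s z≤n) u)) fw
    where
    mem : ∀ {a} → 1 ≤ a → a ≤ n → a ∈ w
    mem l u = ∈-resp-↭ (↭-sym fw) (∈-letters⁺ l u)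

  cellOf-sw : ∀ {i w} → 1 ≤ i → i < n → Filling w → ∀ {a} → 1 ≤ a → a ≤ n → cellOf sh (sw i w) (tr i (suc i) a) ≡ cellOf sh w a
  cellOf-sw {i} l u fw la ua = cellOf-∋ (sw-filling l u fw) (zip-map⁺ (tr i (suc i)) (∋-cellOf fw la ua))

  tr-letter : ∀ {i a} → 1 ≤ i → i < n → 1 ≤ a → a ≤ n → 1 ≤ tr i (suc i) a × tr i (suc i) a ≤ n
  tr-letter {i} {a} l u la ua with tr-view i (suc i) a
  ... | is-left _ e rewrite e = s≤s z≤n , u
  ... | is-right _ e rewrite e = l , <⇒≤ u
  ... | is-other _ _ e rewrite e = la , ua

  cellOf-sw′ : ∀ {i w} → 1 ≤ i → i < n → Filling w → ∀ {a} → 1 ≤ a → a ≤ n → cellOf sh (sw i w) a ≡ cellOf sh w (tr i (suc i) a)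
  cellOf-sw′ {i} {w} l u fw {a} la ua = let lt , ut = tr-letter l u la ua in
    trans (cong (cellOf sh (sw i w)) (sym (tr-involutive i (suc i) a))) (cellOf-sw l u fw lt ut)

  tab-sw : ∀ {i w} → 1 ≤ i → i < n → Filling w → tab (sw i w) ≡ swapCode i (tab w)
  tab-sw {suc i} {w} l u fw = at-ext (trans (length-tab _) (sym (trans (length-swapCode (suc i) (tab w)) (length-tab w)))) same
    where
    same : ∀ k → k < length (tab (sw (suc i) w)) → at (tab (sw (suc i) w)) k ≡ at (swapCode (suc i) (tab w)) k
    same k lt = begin
      at (tab (sw (suc i) w)) k ≡⟨ at-tab (sw (suc i) w) k<n ⟩
      row (sw (suc i) w) (suc k) ≡⟨ cong proj₁ (cellOf-sw′ l u fw (s≤s z≤n) k<n) ⟩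
      -- Letters count from 1 and positions in the code from 0; after the shift the transposition is
      -- `swapIdx (suc i)` by definition.
      row w (tr (suc i) (suc (suc i)) (suc k)) ≡⟨ cong (row w) (sym (tr-natural suc suc-injective i (suc i) k)) ⟩
      row w (suc (tr i (suc i) k)) ≡⟨ at-tab w (tr-bound (<-trans (n<1+n i) u) u k<n) ⟨
      at (tab w) (swapIdx (suc i) k) ≡⟨ at-swapCode (suc i) (tab w) (subst (k <_) (sym (length-tab w)) k<n) ⟨
      at (swapCode (suc i) (tab w)) k ∎
      where
      open ≡-Reasoning
      k<n : k < n
      k<n = subst (k <_) (length-tab (sw (suc i) w)) lt

  -- `actS` applies `swapCode i` to the argument of a function, which is the action of the inverse
  -- on tabloids. It agrees with moving the letters because `swapCode i` is an involution on codes
  -- of length `n`.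
  actS-poly : ∀ {i w} → 1 ≤ i → i < n → Filling w → actS i (poly sh n w) ≈ᵥ poly sh n (sw i w)
  actS-poly {i} {w} l u fw τ = ∑-cong ColPerms termwise
    where
    permute-sw : ∀ {p} → p ∈ ColPerms → permute (sw i w) p ≡ sw i (permute w p)
    permute-sw {p} p∈ = trans (map-cong-∈ p (λ {k} k∈ → at-map (tr i (suc i)) w
      (subst (k <_) (sym (length-filling fw)) (∈-colPerm⁻ p∈ k∈)))) (map-∘ p)
    involutive : ∀ τ → length τ ≡ n → swapCode i (swapCode i τ) ≡ τ
    involutive τ e = swapCode-involutive τ (subst (i <_) (sym e) u)
    test : ∀ {p} → p ∈ ColPerms → eqListᵇ (tab (permute w p)) (swapCode i τ) ≡ eqListᵇ (tab (permute (sw i w) p)) τ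
    test {p} p∈ rewrite permute-sw p∈ | tab-sw l u (permute-filling p∈ fw) = bool-ext
      (λ e → let e' = eqListᵇ-true (tab (permute w p)) (swapCode i τ) e in
        trans (cong (λ t → eqListᵇ (swapCode i t) τ) e')
          (trans (cong (λ t → eqListᵇ t τ) (involutive τ (trans (sym (length-swapCode i τ)) (trans (cong length (sym e')) (length-tab (permute w p))))))
            (eqListᵇ-refl τ)))
      (λ e → let e' = eqListᵇ-true (swapCode i (tab (permute w p))) τ e in
        trans (cong (λ t → eqListᵇ (tab (permute w p)) (swapCode i t)) (sym e'))
          (trans (cong (eqListᵇ (tab (permute w p))) (involutive (tab (permute w p)) (length-tab (permute w p))))
            (eqListᵇ-refl (tab (permute w p)))))
    termwise : ∀ {p} → p ∈ ColPerms → term w (swapCode i τ) p ≡ term (sw i w) τ p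
    termwise {p} p∈ = cong (λ b → if b then sgn p else 0ℚ) (test p∈)

  -- Polytabloids as highest weight vectors.

  reversedLetters : List ℕ
  reversedLetters = reverse (letters n)

  reversedLetters-↭ : reversedLetters ↭ letters n
  reversedLetters-↭ = ↭ₚ.↭-reverse (letters n)

  reverse-test : ∀ v t → eqListᵇ (tab v) (reverse t) ≡ eqListᵇ (map (row v) reversedLetters) t
  reverse-test v t = trans (bool-ext
    (λ e → trans (cong (λ z → eqListᵇ z t) (trans (cong reverse (eqListᵇ-true (tab v) (reverse t) e)) (reverse-involutive t))) (eqListᵇ-refl t))
    (λ e → trans (cong (λ z → eqListᵇ (tab v) (reverse z)) (sym (eqListᵇ-true (reverse (tab v)) t e)))
      (trans (cong (eqListᵇ (tab v)) (reverse-involutive (tab v))) (eqListᵇ-refl (tab v)))))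
    (cong (λ z → eqListᵇ z t) (sym (Listₚ.reverse-map (row v) (letters n))))

  lowered : ℕ → List ℕ → List ℕ → ℕ → ℚ
  lowered r u v a = if row v a ≡ᵇ suc r then indicator (map (update (row v) a r) reversedLetters) u else 0ℚ

  row-at : ∀ {v} → Filling v → ∀ {k} → k < n → row v (at v k) ≡ proj₁ (cellAt sh k)
  row-at fv lt = cong proj₁ (cellOf-∋ fv (∋-at fv lt))

  -- Lowering the entry of the cell above another cell of the same column yields a function of the
  -- column permutation that is invariant under exchanging the entries of the two cells.
  column-cancel : ∀ {w} → Filling w → ∀ r u {k} → k < n →
    ∑ ColPerms (λ p → sgn p * lowered r u (permute w p) (at (permute w p) k)) ≡ 0ℚ
  column-cancel {w} fw r u {k} lk with proj₁ (cellAt sh k) ℕ.≟ suc r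
  ... | no ne = ∑-zero ColPerms (λ {p} p∈ → trans (cong (sgn p *_) (off (permute-filling p∈ fw))) (*-zeroʳ (sgn p)))
    where
    off : ∀ {v} → Filling v → lowered r u v (at v k) ≡ 0ℚ
    off fv rewrite row-at fv lk | ≡ᵇ-false ne = refl
  -- `k'` is the position of the cell directly below the cell at `k`, thus in row `r`.
  ... | yes e with ∈-cellAtL (cells-closed (subst (λ x → (x , columnOf k) ∈ cells sh) e (zip-∈ˡ (∋-at fw lk))) (n≤1+n r) (≤-refl {columnOf k}))
  ... | k' , lt , e' = ∑-antisymmetric φ f colPerms-unique closed involutive anti
    where
    f : List ℕ → ℚ
    f p = sgn p * lowered r u (permute w p) (at (permute w p) k)
    -- In `permute w p` this exchanges the entries of the cells at `k` and `k'`. The transposition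
    -- depends on `p`, but `φ p` has the same two values at `k` and `k'` in the other order, so `φ`
    -- undoes itself.
    φ : List ℕ → List ℕ
    φ p = map (tr (at p k) (at p k')) p
    lk' : k' < n
    lk' = subst (k' <_) length-cells lt
    k≢k' : k ≢ k'
    k≢k' refl = 1+n≢n (trans (sym e) (cong proj₁ e'))
    module _ {p} (p∈ : p ∈ ColPerms) where
      bound : ∀ {j} → j < n → j < length p
      bound {j} = subst (j <_) (sym (colPerm-length p∈))
      entry : ∀ {j} → j < n → at p j < n
      entry lj = ∈-colPerm⁻ p∈ (at-∈ p (bound lj))
      cell-entry : ∀ {j} → j < n → columnOf (at p j) ≡ columnOf j
      cell-entry {j} lj = proj₂ (∈-colPerms⁻ p∈) (zip-at (subst (j <_) (sym length-cells) lj) (trans length-cells (sym (colPerm-length p∈))))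
      distinct : at p k ≢ at p k'
      distinct = k≢k' ∘ at-injective (colPerm-unique p∈) (bound lk) (bound lk')
      closed : φ p ∈ ColPerms
      closed = map-tr-∈colPerms p∈ (entry lk) (entry lk') (trans (cell-entry lk) (trans (sym (cong proj₂ e')) (sym (cell-entry lk'))))
      at-φ : ∀ {j} → j < n → at (φ p) j ≡ tr (at p k) (at p k') (at p j)
      at-φ lj = at-map _ p (bound lj)
      φ-k : at (φ p) k ≡ at p k'
      φ-k = trans (at-φ lk) (tr-left (at p k) (at p k'))
      φ-k' : at (φ p) k' ≡ at p k
      φ-k' = trans (at-φ lk') (tr-right (at p k) (at p k'))
      involutive : φ (φ p) ≡ p
      involutive rewrite φ-k | φ-k' = trans (map-cong (tr-comm (at p k') (at p k)) (φ p)) (map-tr-involutive (at p k) (at p k') p)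
      v v' : List ℕ
      v = permute w p
      v' = permute w (φ p)
      fv : Filling v
      fv = permute-filling p∈ fw
      fv' : Filling v'
      fv' = permute-filling closed fw
      v-at : ∀ {j} → j < n → at v j ≡ at w (at p j)
      v-at lj = at-map _ p (bound lj)
      v'-at : ∀ {j} → j < n → at v' j ≡ at w (at (φ p) j)
      v'-at {j} lj = at-map _ (φ p) (subst (j <_) (sym (colPerm-length closed)) lj)
      v'-k : at v' k ≡ at v k'
      v'-k = trans (v'-at lk) (trans (cong (at w) φ-k) (sym (v-at lk')))
      v'-k' : at v' k' ≡ at v k
      v'-k' = trans (v'-at lk') (trans (cong (at w) φ-k') (sym (v-at lk)))
      v-injective : ∀ {i j} → i < n → j < n → at v i ≡ at v j → i ≡ j
      v-injective {i} {j} li lj = at-injective (filling-unique fv) (subst (i <_) (sym (length-filling fv)) li) (subst (j <_) (sym (length-filling fv)) lj)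
      row-k' : proj₁ (cellAt sh k') ≡ r
      row-k' = cong proj₁ e'
      -- In either filling one of the two letters already lies in row `r` and the other is lowered
      -- to row `r`. Afterwards it cannot be seen which was which.
      same-update : ∀ {j} → j < n → update (row v') (at v' k) r (at v j) ≡ update (row v) (at v k) r (at v j)
      same-update {j} lj with j ℕ.≟ k | j ℕ.≟ k'
      ... | yes refl | _ = trans (update-≢ (row v') r (λ q → k≢k' (v-injective lk lk' (trans q v'-k))))
            (trans (cong (row v') (sym v'-k')) (trans (row-at fv' lk') (trans row-k' (sym (update-≡ (row v) r refl)))))
      ... | no j≢k | yes refl = trans (update-≡ (row v') r (sym v'-k)) (sym (trans (update-≢ (row v) r (j≢k ∘ v-injective lj lk)) (trans (row-at fv lj) row-k')))
      ... | no j≢k | no j≢k' = trans (update-≢ (row v') r (λ q → j≢k' (v-injective lj lk' (trans q v'-k))))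
            (trans (cong (row v') fixed) (trans (row-at fv' lj) (trans (sym (row-at fv lj)) (sym (update-≢ (row v) r (j≢k ∘ v-injective lj lk))))))
        where
        fixed : at v j ≡ at v' j
        fixed = trans (v-at lj) (trans (cong (at w) (sym (trans (at-φ lj) (tr-other
          (j≢k ∘ at-injective (colPerm-unique p∈) (bound lj) (bound lk)) (j≢k' ∘ at-injective (colPerm-unique p∈) (bound lj) (bound lk')))))) (sym (v'-at lj)))
      invariant : lowered r u v' (at v' k) ≡ lowered r u v (at v k)
      invariant rewrite row-at fv lk | row-at fv' lk | e | ≡ᵇ-refl r = cong (λ z → indicator z u)
        (map-cong-∈ reversedLetters (λ {a} a∈ → let
           l , h = ∈-letters⁻ (∈-resp-↭ reversedLetters-↭ a∈)
           j , lj , q , _ = ∋-index fv l h in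
           subst (λ a → update (row v') (at v' k) r a ≡ update (row v) (at v k) r a) q (same-update lj)))
      anti : f (φ p) ≡ - f p
      anti = trans (cong₂ _*_ (sgn-colPerm-tr p∈ (entry lk) (entry lk') distinct) invariant)
        (sym (neg-distribˡ-* (sgn p) (lowered r u v (at v k))))

  -- Each tabloid expands into a sum over its letters. Indexing this sum by cells instead makes its
  -- range independent of the column permutation, so the two sums can be interchanged and
  -- `column-cancel` applies cell by cell.
  poly-highest-weight : ∀ {w} → Filling w → ∀ r u → raise r 1 (λ t → poly sh n w (reverse t)) u ≡ 0ℚ
  poly-highest-weight {w} fw r u = begin
    raise r 1 (λ t → poly sh n w (reverse t)) u
      ≡⟨ raise-cong r 1 u (λ t _ → ∑-cong ColPerms (λ {p} _ → scaled p t)) ⟩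
    raise r 1 (λ t → ∑ ColPerms (λ p → sgn p * indicator (σ p) t)) u
      ≡⟨ raise-∑ r 1 ColPerms (λ p t → sgn p * indicator (σ p) t) u ⟩
    ∑ ColPerms (λ p → raise r 1 (λ t → sgn p * indicator (σ p) t) u)
      ≡⟨ ∑-cong ColPerms (λ {p} p∈ → trans (raise-* r 1 (sgn p) (indicator (σ p)) u) (cong (sgn p *_) (expand p∈))) ⟩
    ∑ ColPerms (λ p → sgn p * ∑ (upTo n) (λ k → lowered r u (permute w p) (at (permute w p) k)))
      ≡⟨ ∑-cong ColPerms (λ {p} _ → sym (∑-*ˡ (upTo n) (sgn p) (λ k → lowered r u (permute w p) (at (permute w p) k)))) ⟩
    ∑ ColPerms (λ p → ∑ (upTo n) (λ k → sgn p * lowered r u (permute w p) (at (permute w p) k)))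
      ≡⟨ ∑-swap ColPerms (upTo n) (λ p k → sgn p * lowered r u (permute w p) (at (permute w p) k)) ⟩
    ∑ (upTo n) (λ k → ∑ ColPerms (λ p → sgn p * lowered r u (permute w p) (at (permute w p) k)))
      ≡⟨ ∑-zero (upTo n) (λ k∈ → column-cancel fw r u (∈-upTo⁻ k∈)) ⟩
    0ℚ ∎
    where
    open ≡-Reasoning
    σ : List ℕ → List ℕ
    σ p = map (row (permute w p)) reversedLetters
    scaled : ∀ p t → term w (reverse t) p ≡ sgn p * indicator (σ p) t
    scaled p t rewrite reverse-test (permute w p) t with eqListᵇ (σ p) t
    ... | true = sym (*-identityʳ (sgn p))
    ... | false = sym (*-zeroʳ (sgn p))
    expand : ∀ {p} → p ∈ ColPerms → raise r 1 (indicator (σ p)) u ≡ ∑ (upTo n) (λ k → lowered r u (permute w p) (at (permute w p) k))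
    expand {p} p∈ = begin
      raise r 1 (indicator (σ p)) u ≡⟨ raise-indicator r (row v) (unique-resp-↭ (↭-sym reversedLetters-↭) (letters-unique n)) u ⟩
      ∑ reversedLetters (lowered r u v) ≡⟨ ∑-↭ (lowered r u v) (trans↭ reversedLetters-↭ (↭-sym fv)) ⟩
      ∑ v (lowered r u v) ≡⟨ cong (λ z → ∑ z (lowered r u v)) (map-at-upTo v) ⟨
      ∑ (map (at v) (upTo (length v))) (lowered r u v) ≡⟨ ∑-map (at v) (upTo (length v)) (lowered r u v) ⟩
      ∑ (upTo (length v)) (lowered r u v ∘ at v) ≡⟨ cong (λ m → ∑ (upTo m) (lowered r u v ∘ at v)) (length-filling fv) ⟩
      ∑ (upTo n) (lowered r u v ∘ at v) ∎
      where
      v = permute w p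
      fv : Filling v
      fv = permute-filling p∈ fw

  -- Straightening

  module _ {v : List ℕ} (fv : Filling v) where

    prefixOcc-≤ : ∀ y → prefixOcc (row v) y n ≤ at sh y
    prefixOcc-≤ y = subst₂ _≤_ e₁ e₂ (unique-⊆-length
        (map-unique (cellOf sh v) inj (filterᵇ-unique test (unique-resp-↭ (↭-sym down-↭) (letters-unique n)))) sub)
      where
      test : ℕ → Bool
      test a = row v a ≡ᵇ y
      down-↭ : down n ↭ letters n
      down-↭ = subst (_↭ letters n) (reverse-letters n) reversedLetters-↭
      bounds : ∀ {a} → a ∈ filterᵇ test (down n) → 1 ≤ a × a ≤ n
      bounds a∈ = ∈-letters⁻ (∈-resp-↭ down-↭ (proj₁ (∈-filterᵇ⁻ test (down n) a∈)))
      inj : ∀ {a b} → a ∈ filterᵇ test (down n) → b ∈ filterᵇ test (down n) → cellOf sh v a ≡ cellOf sh v b → a ≡ b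
      inj {a} {b} a∈ b∈ e = let la , ua = bounds a∈ ; lb , ub = bounds b∈ in
        zip-uniqueˡ cells-unique (subst (v ∋_⟨ a ⟩) e (∋-cellOf fv la ua)) (∋-cellOf fv lb ub)
      sub : ∀ {c} → c ∈ map (cellOf sh v) (filterᵇ test (down n)) → c ∈ map (y ,_) (upTo (at sh y))
      sub c∈ with ∈-map⁻ (cellOf sh v) c∈
      ... | a , a∈ , refl with ≡ᵇ-true {row v a} {y} (proj₂ (∈-filterᵇ⁻ test (down n) a∈))
      ... | refl = let l , u = bounds a∈ in ∈-map⁺ (y ,_) (∈-upTo⁺ (∈-cells⁻ sh (zip-∈ˡ (∋-cellOf fv l u))))
      e₁ : length (map (cellOf sh v) (filterᵇ test (down n))) ≡ prefixOcc (row v) y n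
      e₁ = trans (length-map (cellOf sh v) (filterᵇ test (down n))) (sym (countᵇ-map (_≡ᵇ y) (row v) (down n)))
      e₂ : length (map (y ,_) (upTo (at sh y))) ≡ at sh y
      e₂ = trans (length-map (y ,_) (upTo (at sh y))) (length-upTo (at sh y))

    rowCell-∈ : ∀ {a} → 1 ≤ a → a ≤ n → rowCell (row v) a ∈ cells sh
    rowCell-∈ {suc a} l u = ∈-cells⁺ sh (<-≤-trans (≤-reflexive (sym (prefixOcc-suc-≡ (row v) a)))
      (≤-trans (prefixOcc-mono (row v) (row v (suc a)) u) (prefixOcc-≤ (row v (suc a)))))

    -- The row cells are distinct, they lie in the shape because no row of `v` holds more letters
    -- than its length, and there are as many of them as cells.
    rowCells-↭ : map (rowCell (row v)) (letters n) ↭ cells sh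
    rowCells-↭ = unique-⊆-↭ (map-unique (rowCell (row v))
        (λ a∈ b∈ → rowCell-injective (row v) (proj₁ (∈-letters⁻ a∈)) (proj₁ (∈-letters⁻ b∈))) (letters-unique n))
      sub (≤-reflexive (trans length-cells (sym (trans (length-map (rowCell (row v)) (letters n)) (length-letters n)))))
      where
      sub : ∀ {c} → c ∈ map (rowCell (row v)) (letters n) → c ∈ cells sh
      sub c∈ with ∈-map⁻ (rowCell (row v)) c∈
      ... | a , a∈ , refl = let l , u = ∈-letters⁻ a∈ in rowCell-∈ l u

    -- Sort every row of `v`; this keeps the tabloid. Suppose that `b` lies north of `a` in column
    -- `c` and `b < a`. Then the row of `b` has `c + 1` letters up to `b`, so by the Yamanouchi
    -- condition the row of `a` has at least as many, all smaller than `a`. That puts `a` east of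
    -- column `c`.
    yamanouchi-syt : Yamanouchi (reverse (tab v)) → Σ (List ℕ) λ S → S ∈ SYT × tab S ≡ tab v
    -- `S` arranges the letters so that their row cells appear in the order of `cells sh`, which is
    -- the encoding of a filling as a word.
    yamanouchi-syt yam₀ with ↭ₚ.↭-map-inv (rowCell (row v)) rowCells-↭
    ... | S , e , r = S , ∈-syt⁺ fS (rowInc , colInc) , tab-cong same-row
      where
      ρ = row v
      fS : Filling S
      fS = ↭-sym r
      yam : Yamanouchi (map ρ (down n))
      yam = subst Yamanouchi (trans (sym (Listₚ.reverse-map ρ (letters n))) (cong (map ρ) (reverse-letters n))) yam₀
      cell : ∀ {c a} → S ∋ c ⟨ a ⟩ → c ≡ rowCell ρ a
      cell {c} {a} i = zip-map-self (rowCell ρ) S (subst (λ cs → (c , a) ∈ zip cs S) e i)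
      same-row : ∀ a → 1 ≤ a → a ≤ n → row S a ≡ row v a
      same-row a l u = cong proj₁ (cell (∋-cellOf fS l u))
      rowInc : RowIncreasing S
      rowInc {r} {c} {c'} {a} {b} i j lt with cell i | cell j | <-cmp a b
      ... | _ | _ | tri< a<b _ _ = a<b
      ... | p | q | tri≈ _ refl _ = ⊥-elim (<-irrefl (cong proj₂ (trans p (sym q))) lt)
      ... | p | q | tri> _ _ b<a = ⊥-elim (<-asym lt (subst₂ _<_ (sym (cong proj₂ q)) (sym (cong proj₂ p))
              (rowCell-< ρ (proj₁ (∋-letter fS j)) b<a (trans (sym (cong proj₁ q)) (cong proj₁ p)))))
      colInc : ColIncreasing S
      colInc {r} {r'} {c} {a} {b} i j lt = ≰⇒> absurd
        where
        absurd : ¬ b ≤ a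
        absurd b≤a with cell i | cell j | ∋-letter fS i | ∋-letter fS j
        absurd b≤a | refl | q | la , ua | lb , ub with m≤n⇒m<n∨m≡n b≤a
        ... | inj₂ refl = <-irrefl (sym (cong proj₁ q)) lt
        absurd b≤a | refl | q | s≤s {n = a'} _ , ua | s≤s {n = b'} _ , ub | inj₁ (s≤s b≤a') = <-irrefl refl (begin-strict
            c ≡⟨ cong proj₂ q ⟩
            prefixOcc ρ (ρ (suc b')) b' <⟨ ≤-reflexive (sym (prefixOcc-suc-≡ ρ b')) ⟩
            prefixOcc ρ (ρ (suc b')) (suc b') ≤⟨ yamanouchi-antitone (map ρ (down (suc b'))) (yamanouchi-prefix ρ ub yam) (subst (r ≤_) (cong proj₁ q) (<⇒≤ lt)) ⟩
            prefixOcc ρ r (suc b') ≤⟨ prefixOcc-mono ρ r b≤a' ⟩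
            prefixOcc ρ r a' ∎)
          where open ℕₚ.≤-Reasoning

  open Data.List.Sort (On.decTotalOrder ℕₚ.≤-decTotalOrder rank) using (sort; sort-↗; sort-↭)

  sytByRank : List (List ℕ)
  sytByRank = sort SYT

  sytByRank-↭ : sytByRank ↭ SYT
  sytByRank-↭ = sort-↭ SYT

  sytByRank-∈ : ∀ {S} → S ∈ sytByRank → S ∈ SYT
  sytByRank-∈ = ∈-resp-↭ sytByRank-↭

  Ascending : List (List ℕ) → Set
  Ascending = AllPairs (λ S T → rank S < rank T)

  sytByRank-ascending : Ascending sytByRank
  sytByRank-ascending = strengthen sytByRank-∈ (Linkedₚ.Linked⇒AllPairs ≤-trans (sort-↗ SYT))
      (unique-resp-↭ (↭-sym sytByRank-↭) syt-unique)
    where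
    strengthen : ∀ {L} → (∀ {S} → S ∈ L → S ∈ SYT) → AllPairs (λ S T → rank S ≤ rank T) L → Unique L → Ascending L
    strengthen sub [] [] = []
    strengthen sub (le ∷ a) (ne ∷ u) = All.tabulate (λ T∈ → ≤∧≢⇒< (All.lookup le T∈)
      (λ e → All.lookup ne T∈ (rank-injective (sub (here refl)) (sub (there T∈)) e))) ∷ strengthen (sub ∘ there) a u

  subtract : List ℕ → TVec → TVec
  subtract S v τ = v τ + (- v (tab S)) * poly sh n S τ

  -- Forward elimination. In ascending order of rank the current value at `tab S` is already the
  -- coefficient of `S`, because no later standard polytabloid involves `tab S`.
  solve : List (List ℕ) → TVec → Coord
  solve []      v X = 0ℚ
  solve (S ∷ L) v X = if eqListᵇ X S then v (tab S) else solve L (subtract S v) X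

  solve-head : ∀ S L v → solve (S ∷ L) v S ≡ v (tab S)
  solve-head S L v rewrite eqListᵇ-refl S = refl

  solve-tail : ∀ {S L T} v → rank S < rank T → solve (S ∷ L) v T ≡ solve L (subtract S v) T
  solve-tail {S} {L} {T} v lt rewrite eqListᵇ-false {T} {S} (λ { refl → <-irrefl refl lt }) = refl

  solve-∑ : ∀ {L} → Ascending L → (∀ {S} → S ∈ L → S ∈ SYT) → ∀ v {T} → T ∈ L →
            ∑ L (λ S → solve L v S * poly sh n S (tab T)) ≡ v (tab T)
  solve-∑ {S ∷ L} (lt ∷ asc) sub v (here refl) = begin
    solve (S ∷ L) v S * poly sh n S (tab S) + ∑ L (λ X → solve (S ∷ L) v X * poly sh n X (tab S))
      ≡⟨ cong₂ _+_ (cong₂ _*_ (solve-head S L v) (let fS , sS = ∈-syt⁻ (sub (here refl)) in poly-leading fS (proj₂ sS)))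
           (∑-zero L (λ {X} X∈ → trans (cong (solve (S ∷ L) v X *_) (let fX , sX = ∈-syt⁻ (sub (there X∈)) in
              poly-below {S = S} fX (proj₂ sX) (All.lookup lt X∈))) (*-zeroʳ (solve (S ∷ L) v X)))) ⟩
    v (tab S) * 1ℚ + 0ℚ ≡⟨ +-identityʳ (v (tab S) * 1ℚ) ⟩
    v (tab S) * 1ℚ ≡⟨ *-identityʳ (v (tab S)) ⟩
    v (tab S) ∎
    where open ≡-Reasoning
  solve-∑ {S ∷ L} (lt ∷ asc) sub v {T} (there T∈) = begin
    solve (S ∷ L) v S * b + ∑ L (λ X → solve (S ∷ L) v X * poly sh n X (tab T))
      ≡⟨ cong₂ _+_ (cong (_* b) (solve-head S L v))
           (∑-cong L (λ {X} X∈ → cong (_* poly sh n X (tab T)) (solve-tail {L = L} v (All.lookup lt X∈)))) ⟩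
    a * b + ∑ L (λ X → solve L (subtract S v) X * poly sh n X (tab T))
      ≡⟨ cong (a * b +_) (solve-∑ asc (sub ∘ there) (subtract S v) T∈) ⟩
    a * b + (v (tab T) + (- a) * b) ≡⟨ cong (λ z → a * b + (v (tab T) + z)) (neg-distribˡ-* a b) ⟨
    a * b + (v (tab T) + (- (a * b))) ≡⟨ cong (a * b +_) (Qₚ.+-comm (v (tab T)) (- (a * b))) ⟩
    a * b + ((- (a * b)) + v (tab T)) ≡⟨ Qₚ.+-assoc (a * b) (- (a * b)) (v (tab T)) ⟨
    a * b + (- (a * b)) + v (tab T) ≡⟨ cong (_+ v (tab T)) (+-inverseʳ (a * b)) ⟩
    0ℚ + v (tab T) ≡⟨ +-identityˡ (v (tab T)) ⟩
    v (tab T) ∎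
    where
    open ≡-Reasoning
    a = v (tab S)
    b = poly sh n S (tab T)

  -- Subtracting a zero multiple changes nothing, so up to rank `m` the elimination reads off values
  -- of the original `v`.
  solve-leading : ∀ {L} → Ascending L → ∀ v m → (∀ {S} → S ∈ L → rank S < m → v (tab S) ≡ 0ℚ) →
                  ∀ {T} → T ∈ L → rank T ≤ m → solve L v T ≡ v (tab T)
  solve-leading {S ∷ L} asc v m h (here refl) le = solve-head S L v
  solve-leading {S ∷ L} (lt ∷ asc) v m h {T} (there T∈) le =
    trans (solve-tail {L = L} v (All.lookup lt T∈))
      (trans (solve-leading asc (subtract S v) m (λ X∈ lt' → trans (unchanged (tab _)) (h (there X∈) lt')) T∈ le) (unchanged (tab T)))
    where
    unchanged : ∀ τ → subtract S v τ ≡ v τ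
    unchanged τ rewrite h (here refl) (<-≤-trans (All.lookup lt T∈) le) =
      trans (cong (v τ +_) (*-zeroˡ (poly sh n S τ))) (+-identityʳ (v τ))

  poly-row-bound : ∀ {w} → Filling w → ∀ t → Any (suc (length sh) ≤_) t → poly sh n w (reverse t) ≡ 0ℚ
  poly-row-bound {w} fw t big = poly-support w (reverse t) excl
    where
    excl : ∀ {p} → p ∈ ColPerms → tab (permute w p) ≢ reverse t
    excl {p} p∈ e with find (Anyₚ.reverse⁺ big)
    ... | x , x∈ , le with ∈-map⁻ (row (permute w p)) (subst (x ∈_) (sym e) x∈)
    ... | a , _ , refl = <⇒≱ (row-bound (permute-filling p∈ fw) a) le

  -- A tabloid in the support comes from a filling of the shape, so if its row word is Yamanouchi
  -- then `yamanouchi-syt` realizes it by a standard tableau.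
  poly-yamanouchi : ∀ {w} → Filling w → ∀ t → Yamanouchi t → ¬ (Any (λ S → tab S ≡ reverse t) SYT) →
                    poly sh n w (reverse t) ≡ 0ℚ
  poly-yamanouchi {w} fw t yam none = poly-support w (reverse t) excl
    where
    excl : ∀ {p} → p ∈ ColPerms → tab (permute w p) ≢ reverse t
    excl {p} p∈ e with yamanouchi-syt (permute-filling p∈ fw)
                         (subst Yamanouchi (trans (sym (reverse-involutive t)) (cong reverse (sym e))) yam)
    ... | S , S∈ , e' = none (lose S∈ (trans e' e))

  coordinates : List ℕ → Coord
  coordinates w = solve sytByRank (poly sh n w)

  -- The residual is a combination of polytabloids, hence a highest weight vector. At a Yamanouchi
  -- word it vanishes either by the choice of the coefficients, if the word belongs to a standard
  -- tableau, or because no polytabloid has support there.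
  straightening : ∀ {w} → Filling w → poly sh n w ≈ᵥ comb sh n (coordinates w)
  straightening {w} fw τ with length τ ℕ.≟ n
  ... | no ne = trans (poly-length w τ ne) (sym (∑-zero SYT (λ {S} _ →
          trans (cong (coordinates w S *_) (poly-length S τ ne)) (*-zeroʳ (coordinates w S)))))
  ... | yes e = begin
    poly sh n w τ ≡⟨ +-identityʳ (poly sh n w τ) ⟨
    poly sh n w τ + 0ℚ ≡⟨ cong (poly sh n w τ +_) (+-inverseˡ (expansion τ)) ⟨
    poly sh n w τ + (- expansion τ + expansion τ) ≡⟨ Qₚ.+-assoc (poly sh n w τ) (- expansion τ) (expansion τ) ⟨
    poly sh n w τ + (- expansion τ) + expansion τ ≡⟨ cong (_+ expansion τ) (cong (poly sh n w τ +_) (sym (neg-expansion τ))) ⟩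
    residual τ + expansion τ ≡⟨ cong (_+ expansion τ) residual-zero ⟩
    0ℚ + expansion τ ≡⟨ +-identityˡ (expansion τ) ⟩
    expansion τ ≡⟨ ∑-↭ (λ S → c S * poly sh n S τ) sytByRank-↭ ⟩
    comb sh n c τ ∎
    where
    open ≡-Reasoning
    c = coordinates w
    L = sytByRank
    expansion residual : TVec
    expansion τ = ∑ L (λ S → c S * poly sh n S τ)
    residual τ = poly sh n w τ + ∑ L (λ S → (- c S) * poly sh n S τ)
    neg-expansion : ∀ τ → ∑ L (λ S → (- c S) * poly sh n S τ) ≡ - expansion τ
    neg-expansion τ = trans (∑-cong L (λ {S} _ → sym (neg-distribˡ-* (c S) (poly sh n S τ)))) (∑-neg L (λ S → c S * poly sh n S τ))
    residual-vanishes : ∀ τ → poly sh n w τ ≡ 0ℚ → (∀ {S} → S ∈ L → poly sh n S τ ≡ 0ℚ) → residual τ ≡ 0ℚ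
    residual-vanishes τ h h' = trans (cong₂ _+_ h (∑-zero L (λ {S} S∈ → trans (cong ((- c S) *_) (h' S∈)) (*-zeroʳ (- c S))))) (+-identityˡ 0ℚ)
    filling : ∀ {S} → S ∈ L → Filling S
    filling S∈ = proj₁ (∈-syt⁻ (sytByRank-∈ S∈))
    killed : ∀ r u → length u ≡ n → raise r 1 (residual ∘ reverse) u ≡ 0ℚ
    killed r u _ = trans (raise-+ r 1 (poly sh n w ∘ reverse) (λ t → ∑ L (λ S → (- c S) * poly sh n S (reverse t))) u)
      (trans (cong₂ _+_ (poly-highest-weight fw r u)
        (trans (raise-∑ r 1 L (λ S t → (- c S) * poly sh n S (reverse t)) u)
          (∑-zero L (λ {S} S∈ → trans (raise-* r 1 (- c S) (poly sh n S ∘ reverse) u)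
            (trans (cong ((- c S) *_) (poly-highest-weight (filling S∈) r u)) (*-zeroʳ (- c S)))))))
        (+-identityˡ 0ℚ))
    bounded : ∀ t → length t ≡ n → Any (suc (length sh) ≤_) t → residual (reverse t) ≡ 0ℚ
    bounded t _ big = residual-vanishes (reverse t) (poly-row-bound fw t big) (λ S∈ → poly-row-bound (filling S∈) t big)
    at-standard : ∀ t → length t ≡ n → Yamanouchi t → residual (reverse t) ≡ 0ℚ
    at-standard t _ yam with Any.any? (λ S → tab S ≟ʷ reverse t) SYT
    ... | no none = residual-vanishes (reverse t) (poly-yamanouchi fw t yam none) (λ S∈ → poly-yamanouchi (filling S∈) t yam none)
    ... | yes found with find found
    ...   | S , S∈ , q = subst (λ z → residual z ≡ 0ℚ) q (begin
            residual (tab S) ≡⟨ cong (poly sh n w (tab S) +_) (neg-expansion (tab S)) ⟩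
            poly sh n w (tab S) + (- expansion (tab S))
              ≡⟨ cong (λ z → poly sh n w (tab S) + (- z)) (solve-∑ sytByRank-ascending sytByRank-∈ (poly sh n w) (∈-resp-↭ (↭-sym sytByRank-↭) S∈)) ⟩
            poly sh n w (tab S) + (- poly sh n w (tab S)) ≡⟨ +-inverseʳ (poly sh n w (tab S)) ⟩
            0ℚ ∎)
    residual-zero : residual τ ≡ 0ℚ
    residual-zero = trans (cong residual (sym (reverse-involutive τ)))
      -- The letters of these words are row indices, and by `row-bound` none reaches
      -- `suc (length sh)`.
      (highest-weight-zero n (suc (length sh)) (residual ∘ reverse) killed bounded at-standard (reverse τ)
        (trans (Listₚ.length-reverse τ) e))

  -- The operators π̄ᵢ

  -- The first branch merges two cases of the definition: `i` and `i + 1` in one column, where `sᵢ`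
  -- negates the polytabloid, and `sᵢT` standard and later than `T`. Both have the value `- e_T`.
  step : ℕ → List ℕ → Signed
  step i T = if row T i <ᵇ row T (suc i) then neg T else (if row T (suc i) <ᵇ row T i then pos (sw i T) else nil)

  step-lt : ∀ {i T} → row T i < row T (suc i) → step i T ≡ neg T
  step-lt lt rewrite <⇒<ᵇ-true lt = refl

  step-gt : ∀ {i T} → row T (suc i) < row T i → step i T ≡ pos (sw i T)
  step-gt gt rewrite ≮⇒<ᵇ-false (<⇒≤ gt) | <⇒<ᵇ-true gt = refl

  step-eq : ∀ {i T} → row T i ≡ row T (suc i) → step i T ≡ nil
  step-eq {i} {T} e rewrite ≮⇒<ᵇ-false (≤-reflexive (sym e)) | ≮⇒<ᵇ-false (≤-reflexive e) = refl

  step* : ℕ → Signed → Signed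
  step* i nil = nil
  step* i (pos T) = step i T
  step* i (neg T) = flip (step i T)

  π : ℕ → List ℕ → Coord
  π i T = ⟦ step i T ⟧

  row-sw : ∀ {i T} → 1 ≤ i → i < n → Filling T → ∀ {a} → 1 ≤ a → a ≤ n → row (sw i T) a ≡ row T (tr i (suc i) a)
  row-sw l u fT la ua = cong proj₁ (cellOf-sw′ l u fT la ua)

  row-sw-left : ∀ {i T} → 1 ≤ i → i < n → Filling T → row (sw i T) i ≡ row T (suc i)
  row-sw-left {i} {T} l u fT = trans (row-sw l u fT l (<⇒≤ u)) (cong (row T) (tr-left i (suc i)))

  row-sw-right : ∀ {i T} → 1 ≤ i → i < n → Filling T → row (sw i T) (suc i) ≡ row T i
  row-sw-right {i} {T} l u fT = trans (row-sw l u fT (s≤s z≤n) u) (cong (row T) (tr-right i (suc i)))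

  row-sw-other : ∀ {i T a} → 1 ≤ i → i < n → Filling T → 1 ≤ a → a ≤ n → a ≢ i → a ≢ suc i → row (sw i T) a ≡ row T a
  row-sw-other {i} {T} l u fT la ua ne ne' = trans (row-sw l u fT la ua) (cong (row T) (tr-other ne ne'))

  cellOf-sw-before : ∀ {i T} → 1 ≤ i → i < n → Filling T → ∀ b → 1 ≤ b → b < i → cellOf sh T b ≡ cellOf sh (sw i T) b
  cellOf-sw-before {i} {T} l u fT b lb lt = sym (trans (cellOf-sw′ l u fT lb (<⇒≤ (<-trans lt u)))
    (cong (cellOf sh T) (tr-other (<⇒≢ lt) (<⇒≢ (m<n⇒m<1+n lt)))))

  cellOf-sw-left : ∀ {i T} → 1 ≤ i → i < n → Filling T → cellOf sh (sw i T) i ≡ cellOf sh T (suc i)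
  cellOf-sw-left {i} {T} l u fT = trans (cellOf-sw′ l u fT l (<⇒≤ u)) (cong (cellOf sh T) (tr-left i (suc i)))

  sw-RowIncreasing : ∀ {i T} → 1 ≤ i → i < n → Filling T → RowIncreasing T → row T i ≢ row T (suc i) → RowIncreasing (sw i T)
  sw-RowIncreasing {i} l u fT rT ne j k lt with zip-map⁻ (tr i (suc i)) j | zip-map⁻ (tr i (suc i)) k
  ... | a , refl , j' | b , refl , k' = tr-mono-< i (rT j' k' lt)
    λ { (refl , refl) → ne (trans (cong proj₁ (cellOf-∋ fT j')) (sym (cong proj₁ (cellOf-∋ fT k')))) }

  sw-ColIncreasing : ∀ {i T} → 1 ≤ i → i < n → Filling T → ColIncreasing T →
                     (row T i < row T (suc i) → col T i ≢ col T (suc i)) → ColIncreasing (sw i T)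
  sw-ColIncreasing {i} l u fT cT ne j k lt with zip-map⁻ (tr i (suc i)) j | zip-map⁻ (tr i (suc i)) k
  ... | a , refl , j' | b , refl , k' = tr-mono-< i (cT j' k' lt)
    λ { (refl , refl) → ne (subst₂ _<_ (sym (cong proj₁ (cellOf-∋ fT j'))) (sym (cong proj₁ (cellOf-∋ fT k'))) lt)
                           (trans (cong proj₂ (cellOf-∋ fT j')) (sym (cong proj₂ (cellOf-∋ fT k')))) }

  sw-∈-syt : ∀ {i T} → 1 ≤ i → i < n → T ∈ SYT → row T i ≢ row T (suc i) →
             (row T i < row T (suc i) → col T i ≢ col T (suc i)) → sw i T ∈ SYT
  sw-∈-syt l u T∈ ne ne' = let fT , rT , cT = ∈-syt⁻ T∈ in
    ∈-syt⁺ (sw-filling l u fT) (sw-RowIncreasing l u fT rT ne , sw-ColIncreasing l u fT cT ne')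

  sw-gt-∈-syt : ∀ {i T} → 1 ≤ i → i < n → T ∈ SYT → row T (suc i) < row T i → sw i T ∈ SYT
  sw-gt-∈-syt l u T∈ gt = sw-∈-syt l u T∈ (<⇒≢ gt ∘ sym) (λ lt → ⊥-elim (<-asym gt lt))

  -- The corner cell in the row of `a` and the column of `b` holds a letter strictly between them.
  -- So neither of two consecutive letters lies strictly southwest of the other, which gives the
  -- column inequality in ◁ for `T` and `sᵢT`.
  letter-between : ∀ {T a b} → T ∈ SYT → 1 ≤ a → a ≤ n → 1 ≤ b → b ≤ n → row T a < row T b → col T a < col T b → suc a < b
  letter-between T∈ la ua lb ub rlt clt with ∈-syt⁻ T∈
  ... | fT , rT , cT with ∋-entry fT (cells-closed (zip-∈ˡ (∋-cellOf fT lb ub)) (<⇒≤ rlt) (≤-refl))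
  ... | x , i = <-≤-trans (s≤s (rT (∋-cellOf fT la ua) i clt)) (cT i (∋-cellOf fT lb ub) rlt)

  sw-◁ : ∀ {i T} → 1 ≤ i → i < n → T ∈ SYT → row T (suc i) < row T i → sw i T ◁[ sh ] T
  sw-◁ {i} {T} l u T∈ gt with ∈-syt⁻ T∈
  ... | fT , _ = i , l , (λ b lb lt → sym (cellOf-sw-before l u fT b lb lt)) ,
      (λ e → <-irrefl (cong proj₁ (trans (sym (cellOf-sw-left l u fT)) e)) gt) ,
      subst (_≤ row T i) (sym (cong proj₁ (cellOf-sw-left l u fT))) (<⇒≤ gt) ,
      subst (col T i ≤_) (sym (cong proj₂ (cellOf-sw-left l u fT)))
        (≮⇒≥ (λ lt → <⇒≱ (letter-between T∈ (s≤s z≤n) u l (<⇒≤ u) gt lt) (m≤n⇒m≤1+n (n≤1+n i))))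

  ◁-sw : ∀ {i T} → 1 ≤ i → i < n → T ∈ SYT → row T i < row T (suc i) → T ◁[ sh ] sw i T
  ◁-sw {i} {T} l u T∈ lt with ∈-syt⁻ T∈
  ... | fT , _ = i , l , cellOf-sw-before l u fT ,
      (λ e → <-irrefl (cong proj₁ (trans e (cellOf-sw-left l u fT))) lt) ,
      subst (row T i ≤_) (sym (cong proj₁ (cellOf-sw-left l u fT))) (<⇒≤ lt) ,
      subst (_≤ col T i) (sym (cong proj₂ (cellOf-sw-left l u fT)))
        (≮⇒≥ (λ clt → <-irrefl refl (letter-between T∈ l (<⇒≤ u) (s≤s z≤n) u lt clt)))

  sw-rank-< : ∀ {i T} → 1 ≤ i → i < n → T ∈ SYT → row T (suc i) < row T i → rank (sw i T) < rank T
  sw-rank-< l u T∈ gt = ◁⇒rank-< (sw-gt-∈-syt l u T∈ gt) T∈ (sw-◁ l u T∈ gt)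

  module _ {i T} (l : 1 ≤ i) (u : i < n) (T∈ : T ∈ SYT) (e : row T i ≡ row T (suc i)) where

    private
      fT : Filling T
      fT = proj₁ (∈-syt⁻ T∈)
      fw : Filling (sw i T)
      fw = sw-filling l u fT
      cw : ColIncreasing (sw i T)
      cw = sw-ColIncreasing l u fT (proj₂ (proj₂ (∈-syt⁻ T∈))) (λ lt → ⊥-elim (<-irrefl e lt))

    sw-same-rows : ∀ a → 1 ≤ a → a ≤ n → row (sw i T) a ≡ row T a
    sw-same-rows a la ua = trans (row-sw l u fT la ua) (rows a)
      where
      rows : ∀ a → row T (tr i (suc i) a) ≡ row T a
      rows a with tr-view i (suc i) a
      ... | is-left refl q = trans (cong (row T) q) (sym e)
      ... | is-right refl q = trans (cong (row T) q) e
      ... | is-other _ _ q = cong (row T) q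

    -- `sᵢT` keeps increasing up the columns, since `i` and `i + 1` share no column, and it has the
    -- rank of `T`. By `poly-below` its polytabloid vanishes at all tabloids of smaller rank, so
    -- nothing is subtracted before `T` is reached.
    sw-coordinates : ∀ {S} → S ∈ SYT → rank S ≤ rank T → coordinates (sw i T) S ≡ poly sh n (sw i T) (tab S)
    sw-coordinates S∈ = solve-leading sytByRank-ascending (poly sh n (sw i T)) (rank T)
        (λ {X} _ lt → below X lt) (∈-resp-↭ (↭-sym sytByRank-↭) S∈)
      where
      below : ∀ X → rank X < rank T → poly sh n (sw i T) (tab X) ≡ 0ℚ
      below X lt = poly-below {S = X} fw cw (subst (rank X <_) (sym (key-cong _ n sw-same-rows)) lt)

    sw-leading : coordinates (sw i T) T ≡ 1ℚ
    sw-leading = trans (sw-coordinates T∈ ≤-refl)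
      (trans (cong (poly sh n (sw i T)) (tab-cong {T} {sw i T} (λ a la ua → sym (sw-same-rows a la ua))))
        (poly-leading fw cw))

    sw-below : ∀ {S} → S ∈ SYT → rank S < rank T → coordinates (sw i T) S ≡ 0ℚ
    sw-below {S} S∈ lt = trans (sw-coordinates S∈ (<⇒≤ lt))
      (poly-below {S = S} fw cw (subst (rank S <_) (sym (key-cong _ n sw-same-rows)) lt))

  ≈-reflexive : ∀ {c d : Coord} → c ≡ d → c ≈[ sh , n ] d
  ≈-reflexive refl = All.tabulate (λ _ → refl)

  π-spec : ∀ i → 1 ≤ i → i < n → ∀ T → T ∈ SYT → PiSpec sh n i T (π i T)
  π-spec i l u T T∈ with <-cmp (row T i) (row T (suc i)) | ∈-syt⁻ T∈
  ... | tri≈ _ e _ | fT , _ = inj₁ ((coordinates (sw i T) ,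
        (λ τ → trans (actS-poly l u fT τ) (straightening (sw-filling l u fT) τ)) , sw-leading l u T∈ e ,
        (λ S S∈ lt → sw-below l u T∈ e S∈ (◁⇒rank-< S∈ T∈ lt))) , ≈-reflexive (cong ⟦_⟧ (step-eq {i} {T} e)))
  ... | tri> _ _ gt | fT , _ = inj₂ (inj₂ (sw i T , sw-gt-∈-syt l u T∈ gt , sw-◁ l u T∈ gt , actS-poly l u fT ,
        ≈-reflexive (cong ⟦_⟧ (step-gt {i} {T} gt))))
  ... | tri< lt _ _ | fT , _ with col T i ℕ.≟ col T (suc i)
  ...   | yes e = inj₂ (inj₁ (inj₂ (λ τ → trans (actS-poly l u fT τ)
          (poly-exchange fT l (<⇒≤ u) (s≤s z≤n) u (≢-sym 1+n≢n) e τ)) , ≈-reflexive (cong ⟦_⟧ (step-lt {i} {T} lt))))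
  ...   | no ne = inj₂ (inj₁ (inj₁ (sw i T , sw-∈-syt l u T∈ (<⇒≢ lt) (λ _ → ne) , ◁-sw l u T∈ lt , actS-poly l u fT) ,
          ≈-reflexive (cong ⟦_⟧ (step-lt {i} {T} lt))))

  -- The 0-Hecke relations

  ValidSigned : Signed → Set
  ValidSigned nil = ⊤
  ValidSigned (pos T) = T ∈ SYT
  ValidSigned (neg T) = T ∈ SYT

  step-valid : ∀ {i T} → 1 ≤ i → i < n → T ∈ SYT → ValidSigned (step i T)
  step-valid {i} {T} l u T∈ with <-cmp (row T i) (row T (suc i))
  ... | tri< lt _ _ = subst ValidSigned (sym (step-lt {i} {T} lt)) T∈
  ... | tri≈ _ e _ = subst ValidSigned (sym (step-eq {i} {T} e)) tt
  ... | tri> _ _ gt = subst ValidSigned (sym (step-gt {i} {T} gt)) (sw-gt-∈-syt l u T∈ gt)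

  flip-valid : ∀ x → ValidSigned x → ValidSigned (flip x)
  flip-valid nil v = v
  flip-valid (pos T) v = v
  flip-valid (neg T) v = v

  step*-valid : ∀ {i} x → 1 ≤ i → i < n → ValidSigned x → ValidSigned (step* i x)
  step*-valid nil l u v = tt
  step*-valid (pos T) l u v = step-valid l u v
  step*-valid {i} (neg T) l u v = flip-valid (step i T) (step-valid l u v)

  πbar-δ : ∀ f {T} → T ∈ SYT → ∀ S → πbar sh n f (δ T) S ≡ f T S
  πbar-δ f {T} T∈ S = trans (∑-single (λ X → δ T X * f X S) syt-unique T∈
      (λ {X} _ ne → trans (cong (_* f X S) (δ-≢ ne)) (*-zeroˡ (f X S))))
    (trans (cong (_* f T S) (δ-≡ T)) (*-identityˡ (f T S)))

  πbar-⟦⟧ : ∀ i x → ValidSigned x → ∀ S → πbar sh n (π i) ⟦ x ⟧ S ≡ ⟦ step* i x ⟧ S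
  πbar-⟦⟧ i nil v S = ∑-zero SYT (λ {X} _ → *-zeroˡ (π i X S))
  πbar-⟦⟧ i (pos T) v S = πbar-δ (π i) v S
  πbar-⟦⟧ i (neg T) v S = begin
    ∑ SYT (λ X → (- δ T X) * π i X S) ≡⟨ ∑-cong SYT (λ {X} _ → sym (neg-distribˡ-* (δ T X) (π i X S))) ⟩
    ∑ SYT (λ X → - (δ T X * π i X S)) ≡⟨ ∑-neg SYT (λ X → δ T X * π i X S) ⟩
    - πbar sh n (π i) (δ T) S ≡⟨ cong -_ (πbar-δ (π i) v S) ⟩
    - π i T S ≡⟨ ⟦flip⟧ (step i T) S ⟨
    ⟦ flip (step i T) ⟧ S ∎
    where open ≡-Reasoning

  πbar-cong : ∀ f {c d} → (∀ {T} → T ∈ SYT → c T ≡ d T) → ∀ S → πbar sh n f c S ≡ πbar sh n f d S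
  πbar-cong f h S = ∑-cong SYT (λ {T} T∈ → cong (_* f T S) (h T∈))

  πbar-congˡ : ∀ f g c S → (∀ {T} → T ∈ SYT → f T S ≡ g T S) → πbar sh n f c S ≡ πbar sh n g c S
  πbar-congˡ f g c S h = ∑-cong SYT (λ {T} T∈ → cong (c T *_) (h T∈))

  πbar-∘ : ∀ f g c S → πbar sh n f (πbar sh n g c) S ≡ πbar sh n (λ U → πbar sh n f (g U)) c S
  πbar-∘ f g c S = begin
    ∑ Y (λ T → ∑ Y (λ U → c U * g U T) * f T S) ≡⟨ ∑-cong Y (λ {T} _ → sym (∑-*ʳ Y (f T S) (λ U → c U * g U T))) ⟩
    ∑ Y (λ T → ∑ Y (λ U → c U * g U T * f T S)) ≡⟨ ∑-swap Y Y (λ T U → c U * g U T * f T S) ⟩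
    ∑ Y (λ U → ∑ Y (λ T → c U * g U T * f T S)) ≡⟨ ∑-cong Y (λ {U} _ → ∑-cong Y (λ {T} _ → Qₚ.*-assoc (c U) (g U T) (f T S))) ⟩
    ∑ Y (λ U → ∑ Y (λ T → c U * (g U T * f T S))) ≡⟨ ∑-cong Y (λ {U} _ → ∑-*ˡ Y (c U) (λ T → g U T * f T S)) ⟩
    ∑ Y (λ U → c U * ∑ Y (λ T → g U T * f T S)) ∎
    where
    open ≡-Reasoning
    Y = SYT

  -- By linearity a relation between composites on arbitrary coordinate vectors reduces to one
  -- between signed symbols for each standard tableau.
  πbar-step₂ : ∀ i j c S → 1 ≤ j → j < n → πbar sh n (π i) (πbar sh n (π j) c) S ≡ πbar sh n (λ U → ⟦ step* i (step j U) ⟧) c S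
  πbar-step₂ i j c S l u = trans (πbar-∘ (π i) (π j) c S)
    (πbar-congˡ (λ U → πbar sh n (π i) (π j U)) (λ U → ⟦ step* i (step j U) ⟧) c S (λ {U} U∈ → πbar-⟦⟧ i (step j U) (step-valid l u U∈) S))

  πbar-step₃ : ∀ h i j c S → 1 ≤ i → i < n → 1 ≤ j → j < n →
    πbar sh n (π h) (πbar sh n (π i) (πbar sh n (π j) c)) S ≡ πbar sh n (λ U → ⟦ step* h (step* i (step j U)) ⟧) c S
  πbar-step₃ h i j c S li ui lj uj = trans (πbar-cong (π h) (λ {T} _ → πbar-step₂ i j c T lj uj) S)
    (trans (πbar-∘ (π h) (λ U → ⟦ step* i (step j U) ⟧) c S)
      (πbar-congˡ (λ U → πbar sh n (π h) ⟦ step* i (step j U) ⟧) (λ U → ⟦ step* h (step* i (step j U)) ⟧) c S (λ {U} U∈ → πbar-⟦⟧ h (step* i (step j U)) (step*-valid (step j U) li ui (step-valid lj uj U∈)) S)))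

  step-quadratic : ∀ {i T} → 1 ≤ i → i < n → Filling T → step* i (step i T) ≡ flip (step i T)
  step-quadratic {i} {T} l u fT with <-cmp (row T i) (row T (suc i))
  ... | tri< lt _ _ = trans (cong (step* i) e) (trans (cong flip e) (cong flip (sym e)))
    where
    e : step i T ≡ neg T
    e = step-lt lt
  ... | tri≈ _ q _ = trans (cong (step* i) e) (cong flip (sym e))
    where
    e : step i T ≡ nil
    e = step-eq {i} {T} q
  ... | tri> _ _ gt = trans (cong (step* i) e)
      (trans (step-lt (subst₂ _<_ (sym (row-sw-left l u fT)) (sym (row-sw-right l u fT)) gt)) (cong flip (sym e)))
    where
    e : step i T ≡ pos (sw i T)
    e = step-gt gt

  sw-comm : ∀ {i j} T → 2 ℕ.+ i ≤ j → sw i (sw j T) ≡ sw j (sw i T)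
  sw-comm {i} {j} T le = trans (sym (map-∘ T)) (trans (map-cong commute T) (map-∘ T))
    where
    i<j : i < j
    i<j = <-trans (n<1+n i) le
    commute : ∀ z → tr i (suc i) (tr j (suc j) z) ≡ tr j (suc j) (tr i (suc i) z)
    commute z = trans (tr-natural (tr i (suc i)) (tr-injective i (suc i)) j (suc j) z)
      (cong₂ (λ x y → tr x y (tr i (suc i) z)) (tr-other (≢-sym (<⇒≢ i<j)) (≢-sym (<⇒≢ le)))
        (tr-other (≢-sym (<⇒≢ (m<n⇒m<1+n i<j))) (≢-sym (<⇒≢ (m<n⇒m<1+n le)))))

  data Comparison (i : ℕ) (T : List ℕ) : Set where
    less    : row T i < row T (suc i) → Comparison i T
    equal   : row T i ≡ row T (suc i) → Comparison i T
    greater : row T (suc i) < row T i → Comparison i T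

  compareRows : ∀ i T → Comparison i T
  compareRows i T with <-cmp (row T i) (row T (suc i))
  ... | tri< lt _ _ = less lt
  ... | tri≈ _ e _ = equal e
  ... | tri> _ _ gt = greater gt

  -- Swapping `j` and `j + 1` leaves the rows of `i` and `i + 1` alone, and conversely, so the two
  -- comparisons of rows are independent of the order of the steps.
  step-commute : ∀ {i j T} → 1 ≤ i → i < n → 1 ≤ j → j < n → 2 ℕ.+ i ≤ j → Filling T → step* i (step j T) ≡ step* j (step i T)
  step-commute {i} {j} {T} li ui lj uj le fT = go (compareRows i T) (compareRows j T)
    where
    i<j : i < j
    i<j = <-trans (n<1+n i) le
    at-i : row (sw j T) i ≡ row T i
    at-i = row-sw-other lj uj fT li (<⇒≤ ui) (<⇒≢ i<j) (<⇒≢ (m<n⇒m<1+n i<j))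
    at-1+i : row (sw j T) (suc i) ≡ row T (suc i)
    at-1+i = row-sw-other lj uj fT (s≤s z≤n) ui (<⇒≢ le) (<⇒≢ (m<n⇒m<1+n le))
    at-j : row (sw i T) j ≡ row T j
    at-j = row-sw-other li ui fT lj (<⇒≤ uj) (≢-sym (<⇒≢ i<j)) (≢-sym (<⇒≢ le))
    at-1+j : row (sw i T) (suc j) ≡ row T (suc j)
    at-1+j = row-sw-other li ui fT (s≤s z≤n) uj (≢-sym (<⇒≢ (m<n⇒m<1+n i<j))) (≢-sym (<⇒≢ (m<n⇒m<1+n le)))
    chain : ∀ {h k s s' t t'} → step k T ≡ s → step* h s ≡ s' → step h T ≡ t → step* k t ≡ t' → s' ≡ t' → step* h (step k T) ≡ step* k (step h T)
    chain {h} {k} a b c d e = trans (cong (step* h) a) (trans b (trans e (sym (trans (cong (step* k) c) d))))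
    go : Comparison i T → Comparison j T → step* i (step j T) ≡ step* j (step i T)
    go (less p) (less q) = chain (step-lt q) (cong flip (step-lt p)) (step-lt p) (cong flip (step-lt q)) refl
    go (less p) (equal q) = chain (step-eq {j} {T} q) refl (step-lt p) (cong flip (step-eq {j} {T} q)) refl
    go (less p) (greater q) = chain (step-gt q) (step-lt (subst₂ _<_ (sym at-i) (sym at-1+i) p)) (step-lt p) (cong flip (step-gt q)) refl
    go (equal p) (less q) = chain (step-lt q) (cong flip (step-eq {i} {T} p)) (step-eq {i} {T} p) refl refl
    go (equal p) (equal q) = chain (step-eq {j} {T} q) refl (step-eq {i} {T} p) refl refl
    go (equal p) (greater q) = chain (step-gt q) (step-eq {i} {sw j T} (trans at-i (trans p (sym at-1+i)))) (step-eq {i} {T} p) refl refl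
    go (greater p) (less q) = chain (step-lt q) (cong flip (step-gt p)) (step-gt p) (step-lt (subst₂ _<_ (sym at-j) (sym at-1+j) q)) refl
    go (greater p) (equal q) = chain (step-eq {j} {T} q) refl (step-gt p) (step-eq {j} {sw i T} (trans at-j (trans q (sym at-1+j)))) refl
    go (greater p) (greater q) = chain (step-gt q) (step-gt (subst₂ _<_ (sym at-1+i) (sym at-i) p)) (step-gt p)
      (step-gt (subst₂ _<_ (sym at-1+j) (sym at-j) q)) (cong pos (sw-comm T le))

  -- Both sides exchange `i` with `i + 2`, being conjugates of one simple transposition by the
  -- other.
  sw-braid : ∀ i T → sw i (sw (suc i) (sw i T)) ≡ sw (suc i) (sw i (sw (suc i) T))
  sw-braid i T = trans (fuse i (suc i) T) (trans (map-cong braid T) (sym (fuse (suc i) i T)))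
    where
    fuse : ∀ i j T → sw i (sw j (sw i T)) ≡ map (λ z → tr i (suc i) (tr j (suc j) (tr i (suc i) z))) T
    fuse i j T = trans (cong (sw i) (sym (map-∘ T))) (sym (map-∘ T))
    t₁ = tr i (suc i)
    t₂ = tr (suc i) (suc (suc i))
    i<2+i : i < suc (suc i)
    i<2+i = m<n⇒m<1+n (n<1+n i)
    braid : ∀ z → t₁ (t₂ (t₁ z)) ≡ t₂ (t₁ (t₂ z))
    braid z = begin
      t₁ (t₂ (t₁ z)) ≡⟨ tr-natural t₁ (tr-injective i (suc i)) (suc i) (suc (suc i)) (t₁ z) ⟩
      tr (t₁ (suc i)) (t₁ (suc (suc i))) (t₁ (t₁ z))
        ≡⟨ cong₂ (λ x y → tr x y (t₁ (t₁ z))) (tr-right i (suc i)) (tr-other (≢-sym (<⇒≢ i<2+i)) 1+n≢n) ⟩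
      tr i (suc (suc i)) (t₁ (t₁ z)) ≡⟨ cong (tr i (suc (suc i))) (trans (tr-involutive i (suc i) z) (sym (tr-involutive (suc i) (suc (suc i)) z))) ⟩
      tr i (suc (suc i)) (t₂ (t₂ z))
        ≡⟨ cong₂ (λ x y → tr x y (t₂ (t₂ z))) (tr-other (≢-sym 1+n≢n) (<⇒≢ i<2+i)) (tr-left (suc i) (suc (suc i))) ⟨
      tr (t₂ i) (t₂ (suc i)) (t₂ (t₂ z)) ≡⟨ tr-natural t₂ (tr-injective (suc i) (suc (suc i))) i (suc i) (t₂ z) ⟨
      t₂ (t₁ (t₂ z)) ∎
      where open ≡-Reasoning

  module Braid (i : ℕ) (l : 1 ≤ i) (u : suc i < n) where

    -- The steps `i` and `i + 1` depend only on the order of these three rows, and the swaps permute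
    -- the triple. The braid relation is thereby reduced to the possible relative orders of `x`,
    -- `y`, `z`.
    Rows : List ℕ → ℕ → ℕ → ℕ → Set
    Rows T x y z = Filling T × row T i ≡ x × row T (suc i) ≡ y × row T (suc (suc i)) ≡ z

    private
      u′ : i < n
      u′ = <-trans (n<1+n i) u
      A = step* i
      B = step* (suc i)

    rows-sw₁ : ∀ {T x y z} → Rows T x y z → Rows (sw i T) y x z
    rows-sw₁ (fT , ex , ey , ez) = sw-filling l u′ fT , trans (row-sw-left l u′ fT) ey , trans (row-sw-right l u′ fT) ex ,
      trans (row-sw-other l u′ fT (s≤s z≤n) u (≢-sym (<⇒≢ (m<n⇒m<1+n (n<1+n i)))) 1+n≢n) ez

    rows-sw₂ : ∀ {T x y z} → Rows T x y z → Rows (sw (suc i) T) x z y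
    rows-sw₂ (fT , ex , ey , ez) = sw-filling (s≤s z≤n) u fT ,
      trans (row-sw-other (s≤s z≤n) u fT l (<⇒≤ u′) (≢-sym 1+n≢n) (<⇒≢ (m<n⇒m<1+n (n<1+n i)))) ex ,
      trans (row-sw-left (s≤s z≤n) u fT) ez , trans (row-sw-right (s≤s z≤n) u fT) ey

    lt₁ : ∀ {T x y z} → Rows T x y z → x < y → step i T ≡ neg T
    lt₁ (_ , refl , refl , refl) p = step-lt p
    eq₁ : ∀ {T x y z} → Rows T x y z → x ≡ y → step i T ≡ nil
    eq₁ {T} (_ , refl , refl , refl) p = step-eq {i} {T} p
    gt₁ : ∀ {T x y z} → Rows T x y z → y < x → step i T ≡ pos (sw i T)
    gt₁ (_ , refl , refl , refl) p = step-gt p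
    lt₂ : ∀ {T x y z} → Rows T x y z → y < z → step (suc i) T ≡ neg T
    lt₂ (_ , refl , refl , refl) p = step-lt p
    eq₂ : ∀ {T x y z} → Rows T x y z → y ≡ z → step (suc i) T ≡ nil
    eq₂ {T} (_ , refl , refl , refl) p = step-eq {suc i} {T} p
    gt₂ : ∀ {T x y z} → Rows T x y z → z < y → step (suc i) T ≡ pos (sw (suc i) T)
    gt₂ (_ , refl , refl , refl) p = step-gt p

    left : ∀ {T s₁ s₂ s₃} → step i T ≡ s₁ → B s₁ ≡ s₂ → A s₂ ≡ s₃ → A (B (step i T)) ≡ s₃
    left a b c = trans (cong (A ∘ B) a) (trans (cong A b) c)

    right : ∀ {T s₁ s₂ s₃} → step (suc i) T ≡ s₁ → A s₁ ≡ s₂ → B s₂ ≡ s₃ → s₃ ≡ B (A (step (suc i) T))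
    right a b c = sym (trans (cong (B ∘ A) a) (trans (cong B b) c))

    step-braid : ∀ {T x y z} → Rows T x y z → A (B (step i T)) ≡ B (A (step (suc i) T))
    -- The comparison of `x` with `z` adds information only when `y` is strictly above both or
    -- strictly below both.
    step-braid {T} {x} {y} {z} R with <-cmp x y | <-cmp y z | <-cmp x z
    ... | tri< p _ _ | tri< q _ _ | _ = trans (left (lt₁ R p) (cong flip (lt₂ R q)) (lt₁ R p)) (right (lt₂ R q) (cong flip (lt₁ R p)) (lt₂ R q))
    ... | tri< p _ _ | tri≈ _ q _ | _ = trans (left (lt₁ R p) (cong flip (eq₂ R q)) refl) (right (eq₂ R q) refl refl)
    ... | tri< p _ _ | tri> _ _ q | tri< r _ _ = trans (left (lt₁ R p) (cong flip (gt₂ R q)) (cong flip (lt₁ (rows-sw₂ R) r)))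
          (right (gt₂ R q) (lt₁ (rows-sw₂ R) r) (cong flip (lt₂ (rows-sw₂ R) q)))
    ... | tri< p _ _ | tri> _ _ q | tri≈ _ r _ = trans (left (lt₁ R p) (cong flip (gt₂ R q)) (cong flip (eq₁ (rows-sw₂ R) r)))
          (right (gt₂ R q) (eq₁ (rows-sw₂ R) r) refl)
    ... | tri< p _ _ | tri> _ _ q | tri> _ _ r = trans (left (lt₁ R p) (cong flip (gt₂ R q)) (cong flip (gt₁ (rows-sw₂ R) r)))
          (right (gt₂ R q) (gt₁ (rows-sw₂ R) r) (lt₂ (rows-sw₁ (rows-sw₂ R)) p))
    ... | tri≈ _ p _ | tri< q _ _ | _ = trans (left (eq₁ R p) refl refl) (right (lt₂ R q) (cong flip (eq₁ R p)) refl)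
    ... | tri≈ _ p _ | tri≈ _ q _ | _ = trans (left (eq₁ R p) refl refl) (right (eq₂ R q) refl refl)
    ... | tri≈ _ p _ | tri> _ _ q | _ = trans (left (eq₁ R p) refl refl)
          (right (gt₂ R q) (gt₁ (rows-sw₂ R) (subst (z <_) (sym p) q)) (eq₂ (rows-sw₁ (rows-sw₂ R)) p))
    ... | tri> _ _ p | tri< q _ _ | tri< r _ _ = trans (left (gt₁ R p) (lt₂ (rows-sw₁ R) r) (cong flip (lt₁ (rows-sw₁ R) p)))
          (right (lt₂ R q) (cong flip (gt₁ R p)) (cong flip (lt₂ (rows-sw₁ R) r)))
    ... | tri> _ _ p | tri< q _ _ | tri≈ _ r _ = trans (left (gt₁ R p) (eq₂ (rows-sw₁ R) r) refl)
          (right (lt₂ R q) (cong flip (gt₁ R p)) (cong flip (eq₂ (rows-sw₁ R) r)))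
    ... | tri> _ _ p | tri< q _ _ | tri> _ _ r = trans (left (gt₁ R p) (gt₂ (rows-sw₁ R) r) (lt₁ (rows-sw₂ (rows-sw₁ R)) q))
          (right (lt₂ R q) (cong flip (gt₁ R p)) (cong flip (gt₂ (rows-sw₁ R) r)))
    ... | tri> _ _ p | tri≈ _ q _ | _ = trans (left (gt₁ R p) (gt₂ (rows-sw₁ R) (subst (_< x) q p)) (eq₁ (rows-sw₂ (rows-sw₁ R)) q))
          (right (eq₂ R q) refl refl)
    ... | tri> _ _ p | tri> _ _ q | _ = trans (left (gt₁ R p) (gt₂ (rows-sw₁ R) r) (gt₁ (rows-sw₂ (rows-sw₁ R)) q))
          -- For `x > y > z` all three steps swap on both sides; in the other cases at most two do,
          -- and the remaining tableaux agree without the braid rule.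
          (trans (cong pos (sw-braid i T)) (right (gt₂ R q) (gt₁ (rows-sw₂ R) r) (gt₂ (rows-sw₁ (rows-sw₂ R)) p)))
      where
      r : z < x
      r = <-trans q p

  π-hecke : HeckeRelations sh n π
  π-hecke = quadratic , commute , braid
    where
    quadratic : ∀ i → 1 ≤ i → i < n → ∀ c → πbar sh n (π i) (πbar sh n (π i) c) ≈[ sh , n ] negC (πbar sh n (π i) c)
    quadratic i l u c = All.tabulate (λ {S} _ → begin
      πbar sh n (π i) (πbar sh n (π i) c) S ≡⟨ πbar-step₂ i i c S l u ⟩
      ∑ SYT (λ U → c U * ⟦ step* i (step i U) ⟧ S)
        ≡⟨ ∑-cong SYT (λ {U} U∈ → trans
             (cong (λ x → c U * ⟦ x ⟧ S) (step-quadratic l u (proj₁ (∈-syt⁻ U∈))))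
             (trans (cong (c U *_) (⟦flip⟧ (step i U) S)) (sym (neg-distribʳ-* (c U) (π i U S))))) ⟩
      ∑ SYT (λ U → - (c U * π i U S)) ≡⟨ ∑-neg SYT (λ U → c U * π i U S) ⟩
      - πbar sh n (π i) c S ∎)
      where open ≡-Reasoning
    commute : ∀ i j → 1 ≤ i → i < n → 1 ≤ j → j < n → 2 ℕ.+ i ≤ j → ∀ c →
      πbar sh n (π i) (πbar sh n (π j) c) ≈[ sh , n ] πbar sh n (π j) (πbar sh n (π i) c)
    commute i j li ui lj uj le c = All.tabulate (λ {S} _ → trans (πbar-step₂ i j c S lj uj)
      (trans (πbar-congˡ (λ U → ⟦ step* i (step j U) ⟧) (λ U → ⟦ step* j (step i U) ⟧) c S (λ {U} U∈ → cong (λ x → ⟦ x ⟧ S) (step-commute li ui lj uj le (proj₁ (∈-syt⁻ U∈)))))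
        (sym (πbar-step₂ j i c S li ui))))
    braid : ∀ i → 1 ≤ i → suc i < n → ∀ c →
      πbar sh n (π i) (πbar sh n (π (suc i)) (πbar sh n (π i) c))
        ≈[ sh , n ] πbar sh n (π (suc i)) (πbar sh n (π i) (πbar sh n (π (suc i)) c))
    braid i l u c = All.tabulate (λ {S} _ → trans (πbar-step₃ i (suc i) i c S (s≤s z≤n) u l u′)
      (trans (πbar-congˡ (λ U → ⟦ step* i (step* (suc i) (step i U)) ⟧) (λ U → ⟦ step* (suc i) (step* i (step (suc i) U)) ⟧) c S
        (λ {U} U∈ → cong (λ x → ⟦ x ⟧ S) (Braid.step-braid i l u (proj₁ (∈-syt⁻ U∈) , refl , refl , refl))))
        (sym (πbar-step₃ (suc i) i (suc i) c S l u′ (s≤s z≤n) u))))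
      where
      u′ : i < n
      u′ = <-trans (n<1+n i) u

  -- The composition series

  basisVector : ℕ → Coord
  basisVector k = δ (nth sytByRank k)

  descent : List ℕ → ℕ → Bool
  descent T i = row T i <ᵇ row T (suc i)

  length-sytByRank : length sytByRank ≡ length SYT
  length-sytByRank = ↭-length sytByRank-↭

  nth-rank-< : ∀ {j k} → j < k → k < length sytByRank → rank (nth sytByRank j) < rank (nth sytByRank k)
  nth-rank-< = nth-AllPairs sytByRank-ascending

  spanC-single : ∀ {k} a j → k ≤ length sytByRank → j < k → (∀ m → m ≢ j → a m ≡ 0ℚ) →
                 ∀ S → spanC k a basisVector S ≡ a j * basisVector j S
  spanC-single {k} a j le lt h S = ∑-single (λ m → a m * basisVector m S) (Uniqueₚ.upTo⁺ k) (∈-upTo⁺ lt)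
    (λ {m} _ ne → trans (cong (_* basisVector m S) (h m ne)) (*-zeroˡ (basisVector m S)))

  compositionSeries : IsCompositionSeries sh n π basisVector (λ k → descent (nth sytByRank k))
  compositionSeries = independent , quotient
    where
    L = sytByRank
    bound : ∀ {k} → k < length SYT → k < length L
    bound {k} = subst (k <_) (sym length-sytByRank)
    distinct : ∀ {j k} → j < length L → k < length L → j ≢ k → nth L k ≢ nth L j
    distinct {j} {k} lj lk ne e with <-cmp j k
    ... | tri< lt _ _ = <-irrefl (cong rank (sym e)) (nth-rank-< lt lk)
    ... | tri≈ _ q _ = ne q
    ... | tri> _ _ gt = <-irrefl (cong rank e) (nth-rank-< gt lj)
    independent : ∀ a → spanC (length SYT) a basisVector ≈[ sh , n ] zeroC → ∀ k → k < length SYT → a k ≡ 0ℚ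
    independent a h k lk = trans (sym evaluate) (All.lookup h (sytByRank-∈ (nth-∈ (bound lk))))
      where
      evaluate : spanC (length SYT) a basisVector (nth L k) ≡ a k
      evaluate = trans (∑-single (λ j → a j * basisVector j (nth L k)) (Uniqueₚ.upTo⁺ (length SYT)) (∈-upTo⁺ lk)
          (λ {j} j∈ ne → trans (cong (a j *_) (δ-≢ (distinct (bound (∈-upTo⁻ j∈)) (bound lk) ne))) (*-zeroʳ (a j))))
        (trans (cong (a k *_) (δ-≡ (nth L k))) (*-identityʳ (a k)))
    spanC-zero : ∀ k S → spanC k (λ _ → 0ℚ) basisVector S ≡ 0ℚ
    spanC-zero k S = ∑-zero (upTo k) (λ {j} _ → *-zeroˡ (basisVector j S))
    quotient : ∀ k → k < length SYT → ∀ i → 1 ≤ i → i < n → Σ (ℕ → ℚ) λ b →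
      addC (πbar sh n (π i) (basisVector k)) (if descent (nth L k) i then basisVector k else zeroC) ≈[ sh , n ] spanC k b basisVector
    quotient k lk i l u with compareRows i (nth L k) | sytByRank-∈ (nth-∈ (bound lk))
    ... | less lt | T∈ = (λ _ → 0ℚ) , All.tabulate (λ {S} _ → trans
          (cong₂ _+_ (trans (πbar-δ (π i) T∈ S) (cong (λ x → ⟦ x ⟧ S) (step-lt {i} {nth L k} lt)))
             (cong (λ b → (if b then basisVector k else zeroC) S) (<⇒<ᵇ-true lt)))
          (trans (+-inverseˡ (basisVector k S)) (sym (spanC-zero k S))))
    ... | equal e | T∈ = (λ _ → 0ℚ) , All.tabulate (λ {S} _ → trans
          (cong₂ _+_ (trans (πbar-δ (π i) T∈ S) (cong (λ x → ⟦ x ⟧ S) (step-eq {i} {nth L k} e)))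
             (cong (λ b → (if b then basisVector k else zeroC) S) (≮⇒<ᵇ-false (≤-reflexive (sym e)))))
          (trans (+-identityˡ 0ℚ) (sym (spanC-zero k S))))
    ... | greater gt | T∈ with ∈-nth (∈-resp-↭ (↭-sym sytByRank-↭) (sw-gt-∈-syt l u T∈ gt))
    -- The image is the single basis vector of `sᵢT`, found at position `j` of the sorted list. Its
    -- rank is smaller, so `j < k` and it lies in the span of the earlier vectors.
    ...   | j , lj , e = (λ m → if m ≡ᵇ j then 1ℚ else 0ℚ) , All.tabulate (λ {S} _ → begin
          πbar sh n (π i) (basisVector k) S + (if descent (nth L k) i then basisVector k else zeroC) S
            ≡⟨ cong₂ _+_ (trans (πbar-δ (π i) T∈ S) (cong (λ x → ⟦ x ⟧ S) (step-gt {i} {nth L k} gt)))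
                 (cong (λ b → (if b then basisVector k else zeroC) S) (≮⇒<ᵇ-false (<⇒≤ gt))) ⟩
          δ (sw i (nth L k)) S + 0ℚ ≡⟨ +-identityʳ (δ (sw i (nth L k)) S) ⟩
          δ (sw i (nth L k)) S ≡⟨ cong (λ T → δ T S) e ⟨
          basisVector j S ≡⟨ *-identityˡ (basisVector j S) ⟨
          1ℚ * basisVector j S ≡⟨ cong (λ b → (if b then 1ℚ else 0ℚ) * basisVector j S) (≡ᵇ-refl j) ⟨
          (if j ≡ᵇ j then 1ℚ else 0ℚ) * basisVector j S
            ≡⟨ spanC-single (λ m → if m ≡ᵇ j then 1ℚ else 0ℚ) j (<⇒≤ (bound lk)) j<k
                 (λ m ne → cong (λ b → if b then 1ℚ else 0ℚ) (≡ᵇ-false ne)) S ⟨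
          spanC k (λ m → if m ≡ᵇ j then 1ℚ else 0ℚ) basisVector S ∎)
      where
      open ≡-Reasoning
      lower : rank (nth L j) < rank (nth L k)
      lower = subst (λ T → rank T < rank (nth L k)) (sym e) (sw-rank-< l u T∈ gt)
      j<k : j < k
      j<k with <-cmp j k
      ... | tri< lt _ _ = lt
      ... | tri≈ _ refl _ = ⊥-elim (<-irrefl refl lower)
      ... | tri> _ _ k<j = ⊥-elim (<-asym lower (nth-rank-< k<j lj))

  -- Standardization

  RowWeak ColStrict : List ℕ → Set
  RowWeak w = ∀ {r c c' a b} → w ∋ (r , c) ⟨ a ⟩ → w ∋ (r , c') ⟨ b ⟩ → c < c' → a ≤ b
  ColStrict = ColIncreasing

  semistandard⁻ : ∀ {w} → semistandardShapeᵇ sh w ≡ true → RowWeak w × ColStrict w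
  semistandard⁻ {w} e =
    (λ {r} {c} {c'} i j lt → ≤ᵇ-true (imply⁻ (proj₁ (∧-true⁻ (allᵇ⁻ (allᵇ⁻ e i) j))) (cong₂ _∧_ (≡ᵇ-refl r) (<⇒<ᵇ-true lt)))) ,
    (λ {r} {r'} {c} i j lt → <ᵇ-true (imply⁻ (proj₂ (∧-true⁻ {not ((r ≡ᵇ r') ∧ _) ∨ _} (allᵇ⁻ (allᵇ⁻ e i) j))) (cong₂ _∧_ (≡ᵇ-refl c) (<⇒<ᵇ-true lt))))

  semistandard⁺ : ∀ {w} → RowWeak w × ColStrict w → semistandardShapeᵇ sh w ≡ true
  semistandard⁺ {w} (ri , ci) = allᵇ⁺ (filled sh w) (λ { {(r , c) , a} i → allᵇ⁺ (filled sh w) (λ { {(r' , c') , b} j →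
    cong₂ _∧_ (imply⁺ {(r ≡ᵇ r') ∧ (c <ᵇ c')} (λ e → let p , q = ∧-true⁻ {r ≡ᵇ r'} e in
                 ≤⇒≤ᵇ-true (ri i (subst (λ t → w ∋ (t , c') ⟨ b ⟩) (sym (≡ᵇ-true p)) j) (<ᵇ-true q))))
              (imply⁺ {(c ≡ᵇ c') ∧ (r <ᵇ r')} (λ e → let p , q = ∧-true⁻ {c ≡ᵇ c'} e in
                 <⇒<ᵇ-true (ci i (subst (λ t → w ∋ (r' , t) ⟨ b ⟩) (sym (≡ᵇ-true p)) j) (<ᵇ-true q)))) }) })

  preceding : List ℕ → Cell × ℕ → ℕ
  preceding w x = countᵇ (λ y → beforeᵇ y x) (filled sh w)

  standardize : List ℕ → List ℕ
  standardize w = map (suc ∘ preceding w) (filled sh w)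

  module _ {w : List ℕ} (lw : length w ≡ n) where

    private
      l : length (cells sh) ≡ length w
      l = trans length-cells (sym lw)

    filled-unique : Unique (filled sh w)
    filled-unique = Uniqueₚ.map⁻ (subst Unique (sym (zip-proj₁ (cells sh) w l)) cells-unique)

    countᵇ-filled : ∀ p → countᵇ (p ∘ proj₂) (filled sh w) ≡ countᵇ p w
    countᵇ-filled p = trans (sym (countᵇ-map p proj₂ (filled sh w))) (cong (countᵇ p) (zip-proj₂ (cells sh) w l))

    length-filled : length (filled sh w) ≡ n
    length-filled = trans (sym (length-map proj₁ (filled sh w))) (trans (cong length (zip-proj₁ (cells sh) w l)) length-cells)

    preceding-mono : ∀ {x y} → x ∈ filled sh w → Before x y → preceding w x < preceding w y
    preceding-mono {x} {y} x∈ lt = countᵇ-mono-< (filled sh w)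
      (λ {z} _ e → beforeᵇ⁺ z y (Before-trans z x y (beforeᵇ⁻ z x e) lt)) x∈ (beforeᵇ-irrefl x) (beforeᵇ⁺ x y lt)

    preceding-bound : ∀ {x} → x ∈ filled sh w → preceding w x < n
    preceding-bound {x} x∈ = <-≤-trans
      (countᵇ-mono-< {q = λ _ → true} (filled sh w) (λ _ _ → refl) x∈ (beforeᵇ-irrefl x) refl)
      (subst (countᵇ (λ _ → true) (filled sh w) ≤_) length-filled (countᵇ-≤ (λ _ → true) (filled sh w)))

    module _ (ss : RowWeak w × ColStrict w) where

      -- Columns are strict, so equal values never share a column; value and column together
      -- separate the cells.
      Before-total : ∀ {x y} → x ∈ filled sh w → y ∈ filled sh w → x ≢ y → Before x y ⊎ Before y x
      Before-total {(r , c) , v} {(r' , c') , v'} i j ne with <-cmp v v' | <-cmp c c'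
      ... | tri< lt _ _ | _ = inj₁ (inj₁ lt)
      ... | tri> _ _ gt | _ = inj₂ (inj₁ gt)
      ... | tri≈ _ refl _ | tri< lt _ _ = inj₁ (inj₂ (refl , lt))
      ... | tri≈ _ refl _ | tri> _ _ gt = inj₂ (inj₂ (refl , gt))
      ... | tri≈ _ refl _ | tri≈ _ refl _ with <-cmp r r'
      ...   | tri< lt _ _ = ⊥-elim (<-irrefl refl (proj₂ ss i j lt))
      ...   | tri≈ _ refl _ = ⊥-elim (ne refl)
      ...   | tri> _ _ gt = ⊥-elim (<-irrefl refl (proj₂ ss j i gt))

      Before-reflect : ∀ {x y} → x ∈ filled sh w → y ∈ filled sh w → preceding w x < preceding w y → Before x y
      Before-reflect {x} {y} i j lt with Before-total i j (λ { refl → <-irrefl refl lt })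
      ... | inj₁ b = b
      ... | inj₂ b = ⊥-elim (<-asym lt (preceding-mono {y} {x} j b))

      standardize-filling : Filling (standardize w)
      standardize-filling = unique-⊆-↭ (map-unique (suc ∘ preceding w) inj filled-unique) sub
          (≤-reflexive (trans (length-letters n) (sym (trans (length-map _ (filled sh w)) length-filled))))
        where
        ≟-entry : (x y : Cell × ℕ) → Dec (x ≡ y)
        ≟-entry = Productₚ.≡-dec (Productₚ.≡-dec ℕ._≟_ ℕ._≟_) ℕ._≟_
        inj : ∀ {x y} → x ∈ filled sh w → y ∈ filled sh w → suc (preceding w x) ≡ suc (preceding w y) → x ≡ y
        inj {x} {y} i j e with ≟-entry x y
        ... | yes q = q
        ... | no ne with Before-total i j ne
        ...   | inj₁ b = ⊥-elim (<-irrefl (suc-injective e) (preceding-mono {x} {y} i b))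
        ...   | inj₂ b = ⊥-elim (<-irrefl (suc-injective (sym e)) (preceding-mono {y} {x} j b))
        sub : ∀ {a} → a ∈ standardize w → a ∈ letters n
        sub a∈ with ∈-map⁻ (suc ∘ preceding w) a∈
        ... | x , x∈ , refl = ∈-letters⁺ (s≤s z≤n) (preceding-bound x∈)

      standardize-entry : ∀ {c b} → standardize w ∋ c ⟨ b ⟩ → Σ ℕ λ v → w ∋ c ⟨ v ⟩ × b ≡ suc (preceding w (c , v))
      standardize-entry = zip-map-zip (suc ∘ preceding w) (cells sh) w

      standardize-∈-syt : standardize w ∈ SYT
      standardize-∈-syt = ∈-syt⁺ standardize-filling (rowInc , colInc)
        where
        rowInc : RowIncreasing (standardize w)
        rowInc {r} {c} {c'} i j lt with standardize-entry i | standardize-entry j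
        ... | v , i' , refl | v' , j' , refl = s≤s (preceding-mono {(r , c) , v} {(r , c') , v'} i' (before (proj₁ ss i' j' lt)))
          where
          before : v ≤ v' → Before ((r , c) , v) ((r , c') , v')
          before le with m≤n⇒m<n∨m≡n le
          ... | inj₁ v<v' = inj₁ v<v'
          ... | inj₂ e = inj₂ (e , lt)
        colInc : ColIncreasing (standardize w)
        colInc {r} {r'} {c} i j lt with standardize-entry i | standardize-entry j
        ... | v , i' , refl | v' , j' , refl = s≤s (preceding-mono {(r , c) , v} {(r' , c) , v'} i' (inj₁ (proj₂ ss i' j' lt)))

  -- Both letters are compared with the one in the corner cell `(r , c')`.
  standard-mono : ∀ {T r r' c c' a b} → Filling T → Standard T → T ∋ (r , c) ⟨ a ⟩ → T ∋ (r' , c') ⟨ b ⟩ → r ≤ r' → c ≤ c' → a ≤ b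
  standard-mono {T} {r} {r'} {c} {c'} {a} {b} fT (rT , cT) i j r≤ c≤ with ∋-entry fT (cells-closed (zip-∈ˡ j) r≤ (≤-refl {c'}))
  ... | x , k = ≤-trans a≤x x≤b
    where
    a≤x : a ≤ x
    a≤x with m≤n⇒m<n∨m≡n c≤
    ... | inj₁ lt = <⇒≤ (rT i k lt)
    ... | inj₂ refl = ≤-reflexive (zip-uniqueˡ cells-unique i k)
    x≤b : x ≤ b
    x≤b with m≤n⇒m<n∨m≡n r≤
    ... | inj₁ lt = <⇒≤ (cT k j lt)
    ... | inj₂ refl = ≤-reflexive (zip-uniqueˡ cells-unique k j)

  -- The coefficient of a monomial: compatible and semistandard tableaux.

  module Monomial (ms : List ℕ) (mono : IsMonomial n ms) where

    private
      m = maxL ms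

    length-ms : length ms ≡ n
    length-ms = proj₁ mono

    sorted : AllPairs _≤_ ms
    sorted = Linkedₚ.Linked⇒AllPairs ≤-trans (proj₂ (proj₂ mono))

    ms-letters : ∀ {x} → x ∈ ms → x ∈ letters m
    ms-letters x∈ = ∈-letters⁺ (All.lookup (proj₁ (proj₂ mono)) x∈) (∈-≤-maxL x∈)

    exponent : ℕ → ℕ
    exponent a = at ms (a ∸ 1)

    -- The inverse of standardization on compatible tableaux: letter `a` becomes the `a`-th variable
    -- index of the monomial.
    relabel : List ℕ → List ℕ
    relabel = map exponent

    -- Word for word the test inside `coeffF n (descent T) ms`, so that the sum of these
    -- coefficients is a count by definition.
    compatibleᵇ : List ℕ → Bool
    compatibleᵇ T = allᵇ (λ j → not (descent T j) ∨ (at ms (j ∸ 1) <ᵇ at ms j)) (filterᵇ (λ j → j <ᵇ n) (letters n))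

    Compatible : List ℕ → Set
    Compatible T = ∀ j → 1 ≤ j → j < n → row T j < row T (suc j) → at ms (j ∸ 1) < at ms j

    compatible⁻ : ∀ {T} → compatibleᵇ T ≡ true → Compatible T
    compatible⁻ {T} e j l u lt = <ᵇ-true (imply⁻ (allᵇ⁻ e (∈-filterᵇ⁺ (λ j → j <ᵇ n) (∈-letters⁺ l (<⇒≤ u)) (<⇒<ᵇ-true u))) (<⇒<ᵇ-true lt))

    compatible⁺ : ∀ {T} → Compatible T → compatibleᵇ T ≡ true
    compatible⁺ {T} h = allᵇ⁺ (filterᵇ (λ j → j <ᵇ n) (letters n)) (λ {j} j∈ →
      let i , e = ∈-filterᵇ⁻ (λ j → j <ᵇ n) (letters n) j∈ in
      imply⁺ {descent T j} (λ d → <⇒<ᵇ-true (h j (proj₁ (∈-letters⁻ i)) (<ᵇ-true e) (<ᵇ-true d))))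

    exponent-mono : ∀ {a b} → a ≤ b → 1 ≤ b → b ≤ n → exponent a ≤ exponent b
    exponent-mono {a} {suc b} le l u = at-mono sorted (ℕₚ.∸-monoˡ-≤ 1 le) (subst (b <_) (sym length-ms) u)

    module _ {T} (T∈ : T ∈ SYT) (comp : Compatible T) where

      private
        fT : Filling T
        fT = proj₁ (∈-syt⁻ T∈)

      -- On a run of equal indices compatibility forbids descents, so each letter lies weakly south
      -- of its predecessor.
      rows-descend : ∀ {a b} → 1 ≤ a → a ≤ b → b ≤ n → exponent a ≡ exponent b → row T b ≤ row T a
      rows-descend {a} {zero} () z≤n u e
      rows-descend {a} {suc b} l le u e with m≤n⇒m<n∨m≡n le
      ... | inj₂ refl = ≤-refl
      ... | inj₁ (s≤s a≤b) = ≤-trans (≮⇒≥ no-descent) (rows-descend l a≤b (<⇒≤ u) same)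
        where
        1≤b : 1 ≤ b
        1≤b = ≤-trans l a≤b
        same : exponent a ≡ exponent b
        same = ≤-antisym (exponent-mono a≤b 1≤b (<⇒≤ u))
          (≤-trans (exponent-mono (n≤1+n b) (s≤s z≤n) u) (≤-reflexive (sym e)))
        no-descent : ¬ row T b < row T (suc b)
        no-descent lt = <-irrefl (trans (sym same) e) (comp b 1≤b u lt)

      -- If the labels agree, `b` lies weakly south of `a` by `rows-descend`. Were it also weakly
      -- west, `standard-mono` would give `b ≤ a`; so it lies strictly east.
      relabel-before : ∀ {c c' a b} → T ∋ c ⟨ a ⟩ → T ∋ c' ⟨ b ⟩ → a < b → Before (c , exponent a) (c' , exponent b)
      relabel-before {c} {c'} {a} {b} i j lt with ∋-letter fT i | ∋-letter fT j
      ... | la , ua | lb , ub with m≤n⇒m<n∨m≡n (exponent-mono (<⇒≤ lt) lb ub)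
      ...   | inj₁ strict = inj₁ strict
      ...   | inj₂ e = inj₂ (e , ≰⇒> (λ c'≤c → <⇒≱ lt (standard-mono fT (proj₂ (∈-syt⁻ T∈)) j i rows c'≤c)))
        where
        rows : proj₁ c' ≤ proj₁ c
        rows = subst₂ _≤_ (cong proj₁ (cellOf-∋ fT j)) (cong proj₁ (cellOf-∋ fT i)) (rows-descend la (<⇒≤ lt) ub e)

      relabel-semistandard : RowWeak (relabel T) × ColStrict (relabel T)
      relabel-semistandard = rowWeak , colStrict
        where
        rowWeak : RowWeak (relabel T)
        rowWeak i j lt with zip-map⁻ exponent i | zip-map⁻ exponent j
        ... | a , refl , i' | b , refl , j' = let lb , ub = ∋-letter fT j' in
          exponent-mono (<⇒≤ (proj₁ (proj₂ (∈-syt⁻ T∈)) i' j' lt)) lb ub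
        colStrict : ColStrict (relabel T)
        colStrict i j lt with zip-map⁻ exponent i | zip-map⁻ exponent j
        ... | a , refl , i' | b , refl , j' with relabel-before i' j' (proj₂ (proj₂ (∈-syt⁻ T∈)) i' j' lt)
        ...   | inj₁ strict = strict
        ...   | inj₂ (_ , c<c) = ⊥-elim (<-irrefl refl c<c)

      relabel-↭ : relabel T ↭ ms
      relabel-↭ = subst (relabel T ↭_) sorted-letters (↭ₚ.map⁺ exponent fT)
        where
        sorted-letters : relabel (letters n) ≡ ms
        sorted-letters = trans (sym (map-∘ (upTo n))) (trans (cong (map (at ms) ∘ upTo) (sym length-ms)) (map-at-upTo ms))

      -- On the relabelled cells `Before` is the order of the original letters, so the cell of `a`
      -- is preceded by exactly `a ∸ 1` cells.
      standardize-relabel : standardize (relabel T) ≡ T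
      standardize-relabel = begin
        map (suc ∘ preceding (relabel T)) (filled sh (relabel T))
          ≡⟨ cong (map (suc ∘ preceding (relabel T))) filled-relabel ⟩
        map (suc ∘ preceding (relabel T)) (map relabelled (filled sh T)) ≡⟨ map-∘ (filled sh T) ⟨
        map (suc ∘ preceding (relabel T) ∘ relabelled) (filled sh T) ≡⟨ map-cong-∈ (filled sh T) position ⟩
        map proj₂ (filled sh T) ≡⟨ zip-proj₂ (cells sh) T (filling-length fT) ⟩
        T ∎
        where
        open ≡-Reasoning
        relabelled : Cell × ℕ → Cell × ℕ
        relabelled x = proj₁ x , exponent (proj₂ x)
        filled-relabel : filled sh (relabel T) ≡ map relabelled (filled sh T)
        filled-relabel = zip-mapʳ exponent (cells sh) T
        position : ∀ {x} → x ∈ filled sh T → suc (preceding (relabel T) (relabelled x)) ≡ proj₂ x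
        position {c , a} i = trans (cong suc (begin
            countᵇ (λ y → beforeᵇ y (c , exponent a)) (filled sh (relabel T))
              ≡⟨ cong (countᵇ (λ y → beforeᵇ y (c , exponent a))) filled-relabel ⟩
            countᵇ (λ y → beforeᵇ y (c , exponent a)) (map relabelled (filled sh T))
              ≡⟨ countᵇ-map (λ y → beforeᵇ y (c , exponent a)) relabelled (filled sh T) ⟩
            countᵇ (λ y → beforeᵇ (relabelled y) (c , exponent a)) (filled sh T)
              ≡⟨ countᵇ-cong (filled sh T) order ⟩
            countᵇ ((_<ᵇ a) ∘ proj₂) (filled sh T) ≡⟨ countᵇ-filled (length-filling fT) (_<ᵇ a) ⟩
            countᵇ (_<ᵇ a) T ≡⟨ countᵇ-↭ (_<ᵇ a) fT ⟩
            countᵇ (_<ᵇ a) (letters n) ≡⟨ countᵇ-<-letters n la ua ⟩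
            a ∸ 1 ∎)) (suc-pred la)
          where
          la : 1 ≤ a
          la = proj₁ (∋-letter fT i)
          ua : a ≤ n
          ua = proj₂ (∋-letter fT i)
          suc-pred : ∀ {a} → 1 ≤ a → suc (a ∸ 1) ≡ a
          suc-pred {suc a} _ = refl
          order : ∀ {y} → y ∈ filled sh T → beforeᵇ (relabelled y) (c , exponent a) ≡ (proj₂ y <ᵇ a)
          order {y@(d , b)} j = bool-ext
            (λ e → <⇒<ᵇ-true (reflect (beforeᵇ⁻ (relabelled y) (c , exponent a) e)))
            (λ e → beforeᵇ⁺ (relabelled y) (c , exponent a) (relabel-before j i (<ᵇ-true e)))
            where
            reflect : Before (relabelled y) (c , exponent a) → b < a
            reflect bef with <-cmp b a
            ... | tri< lt _ _ = lt
            ... | tri> _ _ gt = ⊥-elim (Before-irrefl (c , exponent a)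
                    (Before-trans (c , exponent a) (relabelled y) (c , exponent a) (relabel-before i j gt) bef))
            ... | tri≈ _ refl _ with zip-uniqueʳ (filling-unique fT) i j
            ...   | refl = ⊥-elim (Before-irrefl (c , exponent a) bef)

    sameContent⁻ : ∀ {w} → w ∈ words n m → sameContentᵇ m w ms ≡ true → w ↭ ms
    sameContent⁻ {w} w∈ e = occ-↭ w ms counts
      where
      counts : ∀ x → occ x w ≡ occ x ms
      counts x with Any.any? (x ℕ.≟_) (letters m)
      ... | yes x∈ = ≡ᵇ-true (allᵇ⁻ e x∈)
      ... | no x∉ = trans (occ-∉ w (x∉ ∘ proj₂ (∈-words⁻ n m w∈))) (sym (occ-∉ ms (x∉ ∘ ms-letters)))

    sameContent⁺ : ∀ {w} → w ↭ ms → sameContentᵇ m w ms ≡ true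
    sameContent⁺ {w} r = allᵇ⁺ (letters m) (λ {v} _ → subst (λ k → (k ≡ᵇ occ v ms) ≡ true) (sym (countᵇ-↭ (_≡ᵇ v) r)) (≡ᵇ-refl (occ v ms)))

    module _ {w} (r : w ↭ ms) (ss : RowWeak w × ColStrict w) where

      private
        lw : length w ≡ n
        lw = trans (↭-length r) length-ms
        l : length (cells sh) ≡ length w
        l = trans length-cells (sym lw)

      -- All smaller entries precede `x`, and what precedes `x` has entries at most `v` but leaves
      -- out `x` itself. The number of predecessors is thus an index at which the sorted list `ms`
      -- has the value `v`.
      exponent-position : ∀ {x} → x ∈ filled sh w → exponent (suc (preceding w x)) ≡ proj₂ x
      exponent-position {x@(c , v)} x∈ = ≤-antisym
        (at-≤ sorted v q (subst (q <_) (trans (countᵇ-filled lw (_≤ᵇ v)) (countᵇ-↭ (_≤ᵇ v) r)) upper))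
        (≤-at sorted v q (subst (_≤ q) (trans (countᵇ-filled lw (_<ᵇ v)) (countᵇ-↭ (_<ᵇ v) r)) lower)
          (subst (q <_) (sym length-ms) (preceding-bound lw x∈)))
        where
        q = preceding w x
        lower : countᵇ ((_<ᵇ v) ∘ proj₂) (filled sh w) ≤ q
        lower = countᵇ-mono (filled sh w) (λ {y} _ e → beforeᵇ⁺ y x (inj₁ (<ᵇ-true e)))
        weaken : ∀ y → Before y x → proj₂ y ≤ v
        weaken y (inj₁ lt) = <⇒≤ lt
        weaken y (inj₂ (e , _)) = ≤-reflexive e
        upper : q < countᵇ ((_≤ᵇ v) ∘ proj₂) (filled sh w)
        upper = countᵇ-mono-< (filled sh w) (λ {y} _ e → ≤⇒≤ᵇ-true (weaken y (beforeᵇ⁻ y x e))) x∈ (beforeᵇ-irrefl x) (≤⇒≤ᵇ-true (≤-refl {v}))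

      relabel-standardize : relabel (standardize w) ≡ w
      relabel-standardize = trans (sym (map-∘ (filled sh w)))
        (trans (map-cong-∈ (filled sh w) exponent-position) (zip-proj₂ (cells sh) w l))

      -- Suppose that `j + 1` lies north of `j` and their values in `w` are equal. The tie-break
      -- puts `j + 1` strictly east, and the entry `u` of the corner cell then satisfies
      -- `v ≤ u < v'`, against the equality.
      standardize-compatible : Compatible (standardize w)
      standardize-compatible j lj uj lt
        with standardize-entry lw ss (∋-cellOf fS lj (<⇒≤ uj)) | standardize-entry lw ss (∋-cellOf fS (s≤s z≤n) uj)
        where
        fS : Filling (standardize w)
        fS = standardize-filling lw ss
      ... | v , i , e | v' , i' , e' = subst₂ _<_ (sym (trans (cong exponent e) (exponent-position i)))
              (sym (trans (cong exponent e') (exponent-position i')))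
              (value (Before-reflect lw ss {cellOf sh S j , v} {cellOf sh S (suc j) , v'} i i' (≤-reflexive (trans (sym e) (suc-injective e')))))
        where
        S = standardize w
        value : Before (cellOf sh S j , v) (cellOf sh S (suc j) , v') → v < v'
        value (inj₁ strict) = strict
        value (inj₂ (refl , cols)) with zip-coverˡ l (cells-closed (zip-∈ˡ i') (<⇒≤ lt) (≤-refl {col S (suc j)}))
        ... | u , k = ≤-<-trans (proj₁ ss i k cols) (proj₂ ss k i' lt)

    schur-expansion : sum (map (λ k → coeffF n (descent (nth sytByRank k)) ms) (upTo (length SYT))) ≡ coeffSchur sh n ms
    schur-expansion = begin
      sum (map (λ k → coeffF n (descent (nth L k)) ms) (upTo (length SYT)))
        ≡⟨ cong (λ N → sum (map (λ k → coefficient (nth L k)) (upTo N))) (sym length-sytByRank) ⟩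
      sum (map (coefficient ∘ nth L) (upTo (length L))) ≡⟨ cong sum (map-∘ (upTo (length L))) ⟩
      sum (map coefficient (map (nth L) (upTo (length L)))) ≡⟨ cong (sum ∘ map coefficient) (map-nth-upTo L) ⟩
      sum (map coefficient L) ≡⟨ sum-↭ (↭ₚ.map⁺ coefficient sytByRank-↭) ⟩
      sum (map coefficient SYT) ≡⟨ sum-indicator compatibleᵇ SYT ⟩
      countᵇ compatibleᵇ SYT
        ≡⟨ bijection-length relabel standardize (filterᵇ-unique compatibleᵇ syt-unique) (filterᵇ-unique schurᵇ (words-unique n m)) forth back ⟩
      coeffSchur sh n ms ∎
      where
      open ≡-Reasoning
      L = sytByRank
      coefficient : List ℕ → ℕ
      coefficient T = coeffF n (descent T) ms
      schurᵇ : List ℕ → Bool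
      schurᵇ w = semistandardShapeᵇ sh w ∧ sameContentᵇ m w ms
      forth : ∀ {T} → T ∈ filterᵇ compatibleᵇ SYT → relabel T ∈ filterᵇ schurᵇ (words n m) × standardize (relabel T) ≡ T
      forth {T} T∈ = let i , e = ∈-filterᵇ⁻ compatibleᵇ SYT T∈
                         r = relabel-↭ i (compatible⁻ {T} e) in
        ∈-filterᵇ⁺ schurᵇ (∈-words⁺ n m (trans (↭-length r) length-ms) (ms-letters ∘ ∈-resp-↭ r))
          (cong₂ _∧_ (semistandard⁺ {relabel T} (relabel-semistandard i (compatible⁻ {T} e))) (sameContent⁺ r)) ,
        standardize-relabel i (compatible⁻ {T} e)
      back : ∀ {w} → w ∈ filterᵇ schurᵇ (words n m) → standardize w ∈ filterᵇ compatibleᵇ SYT × relabel (standardize w) ≡ w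
      back {w} w∈ = let i , e = ∈-filterᵇ⁻ schurᵇ (words n m) w∈
                        e₁ , e₂ = ∧-true⁻ {semistandardShapeᵇ sh w} e
                        r = sameContent⁻ i e₂
                        ss = semistandard⁻ {w} e₁ in
        ∈-filterᵇ⁺ compatibleᵇ (standardize-∈-syt (trans (↭-length r) length-ms) ss)
          (compatible⁺ {standardize w} (standardize-compatible r ss)) ,
        relabel-standardize r ss

  specht-sqcc : SQCC-Specht sh n
  specht-sqcc = π , π-spec , π-hecke , basisVector , (λ k → descent (nth sytByRank k)) , compositionSeries , Monomial.schur-expansion

theorem4 : (n : ℕ) (sh : List ℕ) → IsPartition sh n → SQCC-Specht sh n
theorem4 n sh part = Shape.specht-sqcc n sh part
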